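{- \textsc{ConsCheck: $2$-Coloring} is fixed-parameter tractable when parameterized by the number $t^-$ of negative samples.
   Context: \textsc{ConsCheck: $2$-Coloring}: Input: a finite vertex set $V$ and labeled samples $(E_i,\lambda_i)_{i\in[t]}$, each $G_i=(V,E_i)$ a graph, $\lambda_i\in\{0,1\}$. Task: compute $X\subseteq V$ such that for each $i\in[t]$, $(X,V\setminus X)$ is a proper $2$-coloring of $G_i$ (both parts independent in $G_i$) iff $\lambda_i=1$, or report that none exists. The number of negative samples is $t^-=|\{i\in[t]:\lambda_i=0\}|$. Fixed-parameter tractable means solvable in time $f(t^-)\cdot|\mathcal{I}|^{\mathcal{O}(1)}$ for some computable $f$, where $|\mathcal{I}|$ is the input size. -}

module Defs where

open import Data.Nat using (ℕ; zero; suc; _+_; _*_; _^_; _≤_)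
open import Data.Fin using (Fin; zero; suc; toℕ)
open import Data.Bool using (Bool; true; false)
open import Data.List using (List; []; _∷_; _++_; replicate; length; concatMap; map; lookup)
open import Data.List.Relation.Unary.All using (All)
open import Data.List.Membership.Propositional using (_∈_)
open import Data.Product using (Σ; _×_; _,_; proj₁; proj₂)
open import Data.Sum using (_⊎_)
open import Data.Vec.Functional as VF using ()
open import Relation.Binary.PropositionalEquality using (_≡_; _≢_)
open import Relation.Nullary using (¬_)
open import Function.Bundles using (_⇔_)

-- A graph on vertex set V = Fin n, given by a (finite) list of edges.
-- Each pair (u , v) is the undirected edge {u , v}.
Graph : ℕ → Set
Graph n = List (Fin n × Fin n)

Loopless : ∀ {n} → Graph n → Set
Loopless E = ∀ {u v} → (u , v) ∈ E → u ≢ v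

Sample : ℕ → Set
Sample n = Graph n × Bool

record Instance : Set where
  constructor mkInstance
  field
    n       : ℕ
    samples : List (Sample n)
open Instance public

WellFormed : Instance → Set
WellFormed I = All (λ s → Loopless (proj₁ s)) (samples I)

Subset : ℕ → Set
Subset n = Fin n → Bool

Proper2Col : ∀ {n} → Subset n → Graph n → Set
Proper2Col X E = ∀ {u v} → (u , v) ∈ E → X u ≢ X v

Consistent : (I : Instance) → Subset (n I) → Set
Consistent I X = All (λ s → Proper2Col X (proj₁ s) ⇔ (proj₂ s ≡ true)) (samples I)

negCount : ∀ {n} → List (Sample n) → ℕ
negCount [] = 0
negCount ((_ , true) ∷ ss) = negCount ss
negCount ((_ , false) ∷ ss) = suc (negCount ss)

t⁻ : Instance → ℕ
t⁻ I = negCount (samples I)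

-- Machine model: deterministic single-tape Turing machines
-- tape alphabet Fin (5 + k):  0 = blank, 1 = '0', 2 = '1', 3 = '#', 4 = '$'

Sym : ℕ → Set
Sym k = Fin (5 + k)

blank s0 s1 sH sD : ∀ {k} → Sym k
blank = zero
s0 = suc zero
s1 = suc (suc zero)
sH = suc (suc (suc zero))
sD = suc (suc (suc (suc zero)))

data Move : Set where
  L R S : Move

record TM : Set where
  field
    k       : ℕ                      -- number of extra work symbols
    nQ      : ℕ                      -- states are Fin (suc nQ), start state zero
    halting : Fin (suc nQ) → Bool
    δ       : Fin (suc nQ) → Sym k → Fin (suc nQ) × Sym k × Move
open TM public

record Config (M : TM) : Set where
  constructor cfg
  field
    state : Fin (suc (nQ M))
    tape  : ℕ → Sym (k M)
    head  : ℕ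
open Config public

write : ∀ {A : Set} → (ℕ → A) → ℕ → A → (ℕ → A)
write t i a j with Data.Nat._≟_ i j
... | Relation.Nullary.yes _ = a
... | Relation.Nullary.no  _ = t j

move : Move → ℕ → ℕ
move L zero    = zero
move L (suc h) = h
move R h       = suc h
move S h       = h

step : (M : TM) → Config M → Config M
step M (cfg q t h) with halting M q
... | true  = cfg q t h
... | false with δ M q (t h)
...   | (q' , a , m) = cfg q' (write t h a) (move m h)

run : (M : TM) → ℕ → Config M → Config M
run M zero    c = c
run M (suc s) c = run M s (step M c)

inputTape : ∀ {k} → List (Sym k) → ℕ → Sym k
inputTape []       _       = blank
inputTape (a ∷ w)  zero    = a
inputTape (a ∷ w)  (suc i) = inputTape w i

initial : (M : TM) → List (Sym (k M)) → Config M
initial M w = cfg zero (inputTape w) 0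

TapeHolds : ∀ {k} → (ℕ → Sym k) → List (Sym k) → Set
TapeHolds t w = (∀ (i : Fin (length w)) → t (toℕ i) ≡ lookup w i) × (t (length w) ≡ blank)

HaltsWithin : (M : TM) → List (Sym (k M)) → ℕ → List (Sym (k M)) → Set
HaltsWithin M w s o =
  let c = run M s (initial M w) in
  (halting M (state c) ≡ true) × TapeHolds (tape c) o

unary : ∀ {k} → ℕ → List (Sym k)
unary m = replicate m s1 ++ (sH ∷ [])

bitSym : ∀ {k} → Bool → Sym k
bitSym true  = s1
bitSym false = s0

encEdge : ∀ {k n} → Fin n × Fin n → List (Sym k)
encEdge (u , v) = unary (toℕ u) ++ unary (toℕ v)

encSample : ∀ {k n} → Sample n → List (Sym k)
encSample (E , l) = bitSym l ∷ (concatMap encEdge E ++ (sD ∷ []))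

encInstance : ∀ k → Instance → List (Sym k)
encInstance k I = unary (n I) ++ concatMap encSample (samples I)

encSubset : ∀ {k n} → Subset n → List (Sym k)
encSubset X = VF.toList (λ i → bitSym (X i))

CorrectOutput : ∀ k → (I : Instance) → List (Sym k) → Set
CorrectOutput k I o =
  (Σ (Subset (n I)) λ X → (o ≡ encSubset X) × Consistent I X)
  ⊎ ((o ≡ sH ∷ []) × (∀ X → ¬ Consistent I X))

-- ConsCheck: 2-Coloring is FPT parameterized by t⁻:
-- a TM solves it in time f(t⁻) · |I|^c, |I| = length of the encoding.
-- (every Agda function ℕ → ℕ is computable.)
FPT-ConsCheck2Col-t⁻ : Set
FPT-ConsCheck2Col-t⁻ =
  Σ (ℕ → ℕ) λ f → Σ ℕ λ c → Σ TM λ M →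
    ∀ (I : Instance) → WellFormed I →
      Σ ℕ λ s → Σ (List (Sym (k M))) λ o →
        (s ≤ f (t⁻ I) * (length (encInstance (k M) I) ^ c))
        × HaltsWithin M (encInstance (k M) I) s o
        × CorrectOutput (k M) I o

{-# OPTIONS --safe #-}
module Submission where

-- Maintain a coloring x together with a family of vertex sets ("rows") inside which the colors are
-- already fixed relative to each other; the colorings agreeing with x up to a flip on each row are
-- the current solutions. An edge {u,v} is either decided by the rows, or independent of them, in
-- which case flipping the component of u makes it mono- or bichromatic and the two components are merged.
-- All edges of positive samples must be bichromatic. For each negative sample the edges are scanned,
-- and for every independent edge one guessed bit decides whether it is the monochromatic edge of the sample.
-- A negative sample never needs more than 2t⁻ guesses: the other negative samples are secured by
-- fixing the colors of at most 2(t⁻ − 1) vertices T, an independent edge can be made monochromatic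
-- unless both its components meet T, and making it bichromatic then makes one vertex of T redundant.
-- So 2 + 4 + ⋯ + 2t⁻ guessed bits suffice, and all of them can be enumerated.
-- The algorithm is a structured program over eleven stacks, which are the tracks of a single tape;
-- each stack operation is simulated by a sweep over the tape.

open import Defs hiding (L; R; S; n; samples; step; head)
open import Data.Bool as Bool using (Bool; true; false; not; _∧_; _∨_; _xor_; if_then_else_; T)
open import Data.Bool.Properties using (∨-assoc; ∨-identityʳ; ∨-zeroʳ; xor-same; xor-comm; xor-assoc; not-involutive; ¬-not)
open import Data.Empty using (⊥-elim)
open import Data.Fin as Fin using (Fin; zero; suc; toℕ; splitAt; join; _↑ˡ_; _↑ʳ_; funToFin; finToFun)
open import Data.Fin.Patterns
open import Data.Fin.Properties using (toℕ<n; splitAt-join; splitAt-↑ˡ; splitAt-↑ʳ; finToFun-funToFin)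
open import Data.List as List using (List; []; _∷_; _++_; _∷ʳ_; _ʳ++_; length; reverse; replicate; concatMap)
import Data.List.Properties as List
open import Data.List.Membership.Propositional using (_∈_; find)
open import Data.List.Membership.Propositional.Properties using (∈-∃++; ∈-++⁻; ∈-++⁺ˡ; ∈-++⁺ʳ)
open import Data.List.Relation.Unary.All as All using (All; []; _∷_)
import Data.List.Relation.Unary.All.Properties as All
open import Data.List.Relation.Unary.Any as Any using (Any; here; there; any?)
open import Data.Maybe using (Maybe; just; nothing; is-just; is-nothing)
open import Data.Nat using (ℕ; zero; suc; pred; _+_; _*_; _∸_; _^_; _≤_; _<_; _≤ᵇ_; z≤n; s≤s; NonZero)
open import Data.Nat.Properties
open import Data.Nat.Tactic.RingSolver using (solve-∀)
open import Data.Product using (Σ; ∃; _×_; _,_; map₁; proj₁; proj₂)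
open import Data.Sum as Sum using (_⊎_; inj₁; inj₂)
open import Data.Unit using (⊤; tt)
open import Data.Vec as Vec using (Vec; []; _∷_; lookup; toList; zipWith; _[_]≔_; _[_]%=_)
open import Data.Vec.Properties using (lookup∘updateAt; lookup∘updateAt′; lookup∘update; lookup∘update′; lookup-map; lookup-zipWith; lookup-replicate; tabulate∘lookup; tabulate-cong; toList-map; length-toList; []≔-lookup)
open import Function using (_∘_; id)
open import Function.Bundles using (_⇔_; mk⇔; Equivalence)
open import Relation.Binary.PropositionalEquality
open import Relation.Nullary using (¬_; Dec; yes; no; contradiction)

-- The monochromatic edge of a negative sample may be any of unboundedly many, so branching over
-- that edge directly is not affordable. The bound on the guesses serves completeness alone:
-- soundness holds for every guess sequence, because a negative sample that ends without a
-- monochromatic edge raises the failure flag. Guesses may therefore be padded or run out, and it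
-- suffices to try all sequences of one fixed length. The reference coloring of the completeness
-- proof is not fixed. It is replaced by a flipped one whenever a component avoiding the protected
-- vertices has to be flipped, and only the satisfaction of the later negative samples is carried
-- along. Samples already treated are safe from such flips: the positive samples come first, and
-- from then on every coloring compatible with the rows is proper on them; likewise, the accepted
-- edge of an earlier negative sample stays monochromatic in all remaining colorings.

-- Finite control sets and tape updates.

record Finite (A : Set) : Set where
  field
    size   : ℕ
    encode : A → Fin size
    decode : Fin size → A
    decode-encode : ∀ a → decode (encode a) ≡ a
open Finite

⊤-finite : Finite ⊤
⊤-finite = record { size = 1 ; encode = λ _ → zero ; decode = λ _ → tt ; decode-encode = λ _ → refl }

⊎-finite : ∀ {A B} → Finite A → Finite B → Finite (A ⊎ B)
⊎-finite FA FB = record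
  { size          = size FA + size FB
  ; encode        = join (size FA) (size FB) ∘ Sum.map (encode FA) (encode FB)
  ; decode        = Sum.map (decode FA) (decode FB) ∘ splitAt (size FA)
  ; decode-encode = λ { (inj₁ a) → trans (cong (Sum.map (decode FA) (decode FB)) (splitAt-join (size FA) (size FB) (inj₁ (encode FA a)))) (cong inj₁ (decode-encode FA a))
                      ; (inj₂ b) → trans (cong (Sum.map (decode FA) (decode FB)) (splitAt-join (size FA) (size FB) (inj₂ (encode FB b)))) (cong inj₂ (decode-encode FB b)) }
  }

write-here : ∀ {A : Set} (t : ℕ → A) h a → write t h a h ≡ a
write-here t h a with h ≟ h
... | yes _  = refl
... | no h≢h = ⊥-elim (h≢h refl)

write-there : ∀ {A : Set} (t : ℕ → A) {h j} a → h ≢ j → write t h a j ≡ t j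
write-there t {h} {j} a h≢j with h ≟ j
... | yes h≡j = ⊥-elim (h≢j h≡j)
... | no _    = refl

write-cong : ∀ {A : Set} {t t' : ℕ → A} h {a a'} → t ≗ t' → a ≡ a' → write t h a ≗ write t' h a'
write-cong h t≗t' a≡a' j with h ≟ j
... | yes _ = a≡a'
... | no _  = t≗t' j

write-id : ∀ {A : Set} (t : ℕ → A) h → write t h (t h) ≗ t
write-id t h j with h ≟ j
... | yes refl = refl
... | no _     = refl

-- Structured tape programs

module Tape (K : ℕ) where

  Tp : Set
  Tp = ℕ → Sym K

  infixr 5 _⨾_

  data TapeProg : Set where
    act   : (Sym K → Sym K) → Move → TapeProg
    _⨾_   : TapeProg → TapeProg → TapeProg
    ite   : (Sym K → Bool) → TapeProg → TapeProg → TapeProg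
    while : (Sym K → Bool) → TapeProg → TapeProg

  -- The final tape is only determined up to pointwise equality.
  data TapeRun : TapeProg → Tp → ℕ → Tp → ℕ → ℕ → Set where
    act     : ∀ {f m t t' h} → write t h (f (t h)) ≗ t' → TapeRun (act f m) t h t' (move m h) 1
    _⨾_     : ∀ {p q t t' t'' h h' h'' a b} → TapeRun p t h t' h' a → TapeRun q t' h' t'' h'' b →
              TapeRun (p ⨾ q) t h t'' h'' (a + b)
    ite-yes : ∀ {b p q t t' h h' s} → b (t h) ≡ true → TapeRun p t h t' h' s →
              TapeRun (ite b p q) t h t' h' (suc s)
    ite-no  : ∀ {b p q t t' h h' s} → b (t h) ≡ false → TapeRun q t h t' h' s →
              TapeRun (ite b p q) t h t' h' (suc s)
    leave    : ∀ {b p t h} → b (t h) ≡ false → TapeRun (while b p) t h t h 1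
    loop    : ∀ {b p t t' t'' h h' h'' s r} → b (t h) ≡ true → TapeRun p t h t' h' s →
              TapeRun (while b p) t' h' t'' h'' r → TapeRun (while b p) t h t'' h'' (suc (s + r))

  -- One control point per primitive action and one per test, the latter being the `⊤` summand. The
  -- number of machine states thus depends on the program text only.
  Ctrl : TapeProg → Set
  Ctrl (act f m)   = ⊤
  Ctrl (p ⨾ q)     = Ctrl p ⊎ Ctrl q
  Ctrl (ite b p q) = ⊤ ⊎ (Ctrl p ⊎ Ctrl q)
  Ctrl (while b p) = ⊤ ⊎ Ctrl p

  ctrl-finite : ∀ p → Finite (Ctrl p)
  ctrl-finite (act f m)   = ⊤-finite
  ctrl-finite (p ⨾ q)     = ⊎-finite (ctrl-finite p) (ctrl-finite q)
  ctrl-finite (ite b p q) = ⊎-finite ⊤-finite (⊎-finite (ctrl-finite p) (ctrl-finite q))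
  ctrl-finite (while b p) = ⊎-finite ⊤-finite (ctrl-finite p)

  entry : ∀ p → Ctrl p
  entry (act f m)   = tt
  entry (p ⨾ q)     = inj₁ (entry p)
  entry (ite b p q) = inj₁ tt
  entry (while b p) = inj₁ tt

  Trans : Set → Set
  Trans Q = Q → Sym K → Maybe Q × Sym K × Move

  redirect : ∀ {A B : Set} → (A → B) → Maybe B → Maybe A → Maybe B
  redirect e x (just q) = just (e q)
  redirect e x nothing  = x

  branch : ∀ {A : Set} → Bool → A → A → A
  branch true  x y = x
  branch false x y = y

  -- The control state nothing means that the program has terminated.
  trans-of : ∀ p → Trans (Ctrl p)
  trans-of (act f m)   _        a = nothing , f a , m
  trans-of (p ⨾ q)     (inj₁ x) a = map₁ (redirect inj₁ (just (inj₂ (entry q)))) (trans-of p x a)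
  trans-of (p ⨾ q)     (inj₂ x) a = map₁ (redirect inj₂ nothing) (trans-of q x a)
  trans-of (ite b p q) (inj₁ _) a =
    just (inj₂ (branch (b a) (inj₁ (entry p)) (inj₂ (entry q)))) , a , Move.S
  trans-of (ite b p q) (inj₂ (inj₁ x)) a = map₁ (redirect (inj₂ ∘ inj₁) nothing) (trans-of p x a)
  trans-of (ite b p q) (inj₂ (inj₂ x)) a = map₁ (redirect (inj₂ ∘ inj₂) nothing) (trans-of q x a)
  trans-of (while b p) (inj₁ _) a = branch (b a) (just (inj₂ (entry p))) nothing , a , Move.S
  trans-of (while b p) (inj₂ x) a = map₁ (redirect inj₂ (just (inj₁ tt))) (trans-of p x a)

  data Steps {Q : Set} (d : Trans Q) : Maybe Q → Tp → ℕ → Maybe Q → Tp → ℕ → ℕ → Set where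
    done : ∀ {q t t' h} → t ≗ t' → Steps d q t h q t' h 0
    _◅_ : ∀ {q q' x a m t t' h h' s} → d q (t h) ≡ (q' , a , m) →
           Steps d q' (write t h a) (move m h) x t' h' s → Steps d (just q) t h x t' h' (suc s)

  -- The continuation must accept every tape pointwise equal to `t₁`, since `done` may replace the
  -- tape by such a one and functions are not compared extensionally.
  steps-trans : ∀ {Q} {d : Trans Q} {x y z t t₁ t₂ h h₁ h₂ a b} → Steps d x t h y t₁ h₁ a →
                (∀ {u} → u ≗ t₁ → Steps d y u h₁ z t₂ h₂ b) → Steps d x t h z t₂ h₂ (a + b)
  steps-trans (done eq)   k = k eq
  steps-trans (e ◅ ss) k = e ◅ steps-trans ss k

  -- On the points of a subprogram the compound transition function is that of the subprogram with
  -- termination rewired to `exit`, so a run of the part is literally a segment of a run of the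
  -- whole.
  steps-lift : ∀ {A B} {d : Trans A} {d' : Trans B} (e : A → B) (exit : Maybe B) →
               (∀ q a → d' (e q) a ≡ map₁ (redirect e exit) (d q a)) →
               ∀ {x y t t' h h' s} → Steps d x t h y t' h' s →
               Steps d' (redirect e exit x) t h (redirect e exit y) t' h' s
  steps-lift e exit com (done eq) = done eq
  steps-lift e exit com (_◅_ {q = q} {t = t} {h = h} eq ss) =
    _◅_ (trans (com q (t h)) (cong (map₁ (redirect e exit)) eq)) (steps-lift e exit com ss)

  -- A test is a machine step that rewrites the scanned symbol by itself. This keeps the tape only
  -- up to pointwise equality, whence the generalization to `u`.
  simulate : ∀ {p t h t' h' s} → TapeRun p t h t' h' s → ∀ {u} → u ≗ t →
             Steps (trans-of p) (just (entry p)) u h nothing t' h' s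
  simulate {h = h} (act {f} w) u≗t =
    _◅_ refl (done λ j → trans (write-cong h u≗t (cong f (u≗t h)) j) (w j))
  simulate (_⨾_ {q = q} r r') u≗t =
    steps-trans (steps-lift inj₁ (just (inj₂ (entry q))) (λ _ _ → refl) (simulate r u≗t))
                (λ eq → steps-lift inj₂ nothing (λ _ _ → refl) (simulate r' eq))
  simulate {h = h} (ite-yes {b} {p} {q} e r) {u} u≗t =
    _◅_ (cong (λ z → just (inj₂ (branch z (inj₁ (entry p)) (inj₂ (entry q)))) , u h , Move.S) (trans (cong b (u≗t h)) e))
         (steps-lift (inj₂ ∘ inj₁) nothing (λ _ _ → refl) (simulate r λ j → trans (write-id u h j) (u≗t j)))
  simulate {h = h} (ite-no {b} {p} {q} e r) {u} u≗t =
    _◅_ (cong (λ z → just (inj₂ (branch z (inj₁ (entry p)) (inj₂ (entry q)))) , u h , Move.S) (trans (cong b (u≗t h)) e))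
         (steps-lift (inj₂ ∘ inj₂) nothing (λ _ _ → refl) (simulate r λ j → trans (write-id u h j) (u≗t j)))
  simulate {h = h} (leave {b} {p} e) {u} u≗t =
    _◅_ (cong (λ z → branch z (just (inj₂ (entry p))) nothing , u h , Move.S) (trans (cong b (u≗t h)) e))
         (done λ j → trans (write-id u h j) (u≗t j))
  simulate {h = h} (loop {b} {p} e r r') {u} u≗t =
    _◅_ (cong (λ z → branch z (just (inj₂ (entry p))) nothing , u h , Move.S) (trans (cong b (u≗t h)) e))
         (steps-trans (steps-lift inj₂ (just (inj₁ tt)) (λ _ _ → refl) (simulate r λ j → trans (write-id u h j) (u≗t j)))
                      (simulate r'))

  module _ (p : TapeProg) where
    private
      fin : Finite (Ctrl p)
      fin = ctrl-finite p

      QQ : Set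
      QQ = Fin (suc (suc (size fin)))

      target : Maybe (Ctrl p) → QQ
      target nothing  = suc zero
      target (just q) = suc (suc (encode fin q))

    -- State 0 jumps to the entry point of the program and state 1 is the halting state.
    machine : TM
    machine = record
      { k       = K
      ; nQ      = suc (size fin)
      ; halting = λ { (suc zero) → true ; _ → false }
      ; δ       = λ { zero a          → target (just (entry p)) , a , Move.S
                    ; (suc zero) a    → suc zero , a , Move.S
                    ; (suc (suc q)) a → map₁ target (trans-of p (decode fin q) a) }
      }

    private
      run-steps : ∀ {x t h t' h' s} → Steps (trans-of p) x t h nothing t' h' s →
                  let c = run machine s (cfg (target x) t h) in
                  halting machine (state c) ≡ true × tape c ≗ t'
      run-steps (done eq) = refl , eq
      run-steps (_◅_ {q = q} {t = t} {h = h} eq ss)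
        rewrite decode-encode fin q | eq = run-steps ss

    machine-halts : ∀ {w t' h' s} → TapeRun p (inputTape w) 0 t' h' s →
                    let c = run machine (suc s) (initial machine w) in
                    halting machine (state c) ≡ true × tape c ≗ t'
    machine-halts {w} r = run-steps (simulate r (write-id (inputTape w) 0))

-- (false,false), (true,false), (false,true), (true,true) are the input symbols 0, 1, # and $.
Γ : Set
Γ = Bool × Bool

pattern `0 = false , false
pattern `1 = true , false
pattern `# = false , true
pattern `$ = true , true

toFin₅ : Maybe Γ → Fin 5
toFin₅ nothing   = 0F
toFin₅ (just `0) = 1F
toFin₅ (just `1) = 2F
toFin₅ (just `#) = 3F
toFin₅ (just `$) = 4F

fromFin₅ : Fin 5 → Maybe Γ
fromFin₅ 0F = nothing
fromFin₅ 1F = just `0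
fromFin₅ 2F = just `1
fromFin₅ 3F = just `#
fromFin₅ 4F = just `$

fromFin₅-toFin₅ : ∀ a → fromFin₅ (toFin₅ a) ≡ a
fromFin₅-toFin₅ nothing   = refl
fromFin₅-toFin₅ (just `0) = refl
fromFin₅-toFin₅ (just `1) = refl
fromFin₅-toFin₅ (just `#) = refl
fromFin₅-toFin₅ (just `$) = refl

-- Words read by position and stacks read by height.

nth : ∀ {A : Set} → List A → ℕ → Maybe A
nth []      j       = nothing
nth (a ∷ l) zero    = just a
nth (a ∷ l) (suc j) = nth l j

-- The symbol at height j of a stack whose top is the head of the list.
height : List Γ → ℕ → Maybe Γ
height []      j = nothing
height (a ∷ l) j with j ≟ length l
... | yes _ = just a
... | no _  = height l j

height-top : ∀ a l → height (a ∷ l) (length l) ≡ just a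
height-top a l with length l ≟ length l
... | yes _ = refl
... | no ¬p = ⊥-elim (¬p refl)

height-below : ∀ a l {j} → j ≢ length l → height (a ∷ l) j ≡ height l j
height-below a l {j} j≢ with j ≟ length l
... | yes p = ⊥-elim (j≢ p)
... | no _  = refl

height-beyond : ∀ l {j} → length l ≤ j → height l j ≡ nothing
height-beyond []      le = refl
height-beyond (a ∷ l) le = trans (height-below a l (λ e → <-irrefl (sym e) le)) (height-beyond l (<⇒≤ le))

height-inside : ∀ l {j} → j < length l → is-just (height l j) ≡ true
height-inside (a ∷ l) {j} (s≤s le) with j ≟ length l
... | yes _ = refl
... | no ¬p = height-inside l (≤∧≢⇒< le ¬p)

height-pred : ∀ l → height l (pred (length l)) ≡ List.head l
height-pred []      = refl
height-pred (a ∷ l) = height-top a l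

length-snoc : ∀ (l : List Γ) x → length (l ∷ʳ x) ≡ suc (length l)
length-snoc l x = trans (List.length-++ l) (+-comm (length l) 1)

height-snoc : ∀ l x j → height (l ∷ʳ x) (suc j) ≡ height l j
height-snoc []      x j = refl
height-snoc (a ∷ l) x j with j ≟ length l
... | yes refl = trans (cong (height (a ∷ (l ∷ʳ x))) (sym (length-snoc l x))) (height-top a (l ∷ʳ x))
... | no ¬p    = trans (height-below a (l ∷ʳ x) λ e → ¬p (suc-injective (trans e (length-snoc l x)))) (height-snoc l x j)

height-snoc-zero : ∀ l x → height (l ∷ʳ x) 0 ≡ just x
height-snoc-zero []      x = refl
height-snoc-zero (a ∷ l) x = trans (height-below a (l ∷ʳ x) λ e → 0≢1+n (trans e (length-snoc l x))) (height-snoc-zero l x)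

-- With the bottom of a stack at cell 0, the input word on the tape already is a stack: the reversed
-- word, whose top is the last letter. The output is read by the same identity.
height-reverse : ∀ l j → height (reverse l) j ≡ nth l j
height-reverse []      j       = refl
height-reverse (a ∷ l) zero    = trans (cong (λ z → height z 0) (List.unfold-reverse a l)) (height-snoc-zero (reverse l) a)
height-reverse (a ∷ l) (suc j) = trans (cong (λ z → height z (suc j)) (List.unfold-reverse a l))
  (trans (height-snoc (reverse l) a j) (height-reverse l j))

-- Stack programs

module Stack (nS : ℕ) where

  State : Set
  State = Vec (List Γ) nS

  infixr 5 _⨾_

  -- `case` brings the top symbol into the finite control: it stands for one copy of the
  -- continuation per symbol of `Γ`.
  data Prog : Set where
    skip  : Prog
    push  : Fin nS → Γ → Prog
    pop   : Fin nS → Prog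
    _⨾_   : Prog → Prog → Prog
    ifTop : Fin nS → (Maybe Γ → Bool) → Prog → Prog → Prog
    while : Fin nS → (Maybe Γ → Bool) → Prog → Prog
    case  : Fin nS → (Γ → Prog) → Prog

  top : State → Fin nS → Maybe Γ
  top σ i = List.head (lookup σ i)

  -- `weaken` turns the last index into an upper bound. The 2 charged by `case` leaves room for the
  -- second of the two nested tests that decode a symbol.
  data Run : Prog → State → State → ℕ → Set where
    skip   : ∀ {σ} → Run skip σ σ 1
    push   : ∀ {σ i a} → Run (push i a) σ (σ [ i ]%= (a ∷_)) 1
    pop    : ∀ {σ i} → Run (pop i) σ (σ [ i ]%= List.drop 1) 1
    _⨾_    : ∀ {p q σ σ' σ'' a b} → Run p σ σ' a → Run q σ' σ'' b → Run (p ⨾ q) σ σ'' (a + b)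
    if-yes : ∀ {i b p q σ σ' s} → b (top σ i) ≡ true → Run p σ σ' s → Run (ifTop i b p q) σ σ' (suc s)
    if-no  : ∀ {i b p q σ σ' s} → b (top σ i) ≡ false → Run q σ σ' s → Run (ifTop i b p q) σ σ' (suc s)
    leave   : ∀ {i b p σ} → b (top σ i) ≡ false → Run (while i b p) σ σ 1
    loop   : ∀ {i b p σ σ' σ'' s r} → b (top σ i) ≡ true → Run p σ σ' s →
             Run (while i b p) σ' σ'' r → Run (while i b p) σ σ'' (suc (s + r))
    case   : ∀ {i p σ σ' s a} → top σ i ≡ just a → Run (p a) σ σ' s → Run (case i p) σ σ' (2 + s)
    weaken : ∀ {p σ σ' s r} → s ≤ r → Run p σ σ' s → Run p σ σ' r

  length-update : ∀ (σ : State) i f s → (∀ l → length (f l) ≤ length l + s) →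
                  ∀ j → length (lookup (σ [ i ]%= f) j) ≤ length (lookup σ j) + s
  length-update σ i f s le j with j Fin.≟ i
  ... | yes refl rewrite lookup∘updateAt i {f} σ = le (lookup σ i)
  ... | no j≢i   rewrite lookup∘updateAt′ j i {f} j≢i σ = m≤m+n _ s

  -- A unit of time pushes at most one symbol. Hence time also bounds the stretch of tape in use,
  -- and the overhead of the sweeps stays polynomial.
  run-length : ∀ {p σ σ' s} → Run p σ σ' s → ∀ i → length (lookup σ' i) ≤ length (lookup σ i) + s
  run-length skip i = m≤m+n _ 1
  run-length (push {σ} {j} {a}) i = length-update σ j (a ∷_) 1 (λ l → ≤-reflexive (+-comm 1 (length l))) i
  run-length (pop {σ} {j}) i = length-update σ j (List.drop 1) 1 (λ { [] → z≤n ; (a ∷ l) → m≤n⇒m≤1+n (m≤m+n _ 1) }) i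
  run-length (_⨾_ {σ = σ} {σ'} {σ''} {a} {b} r r') i = begin
    length (lookup σ'' i)         ≤⟨ run-length r' i ⟩
    length (lookup σ' i) + b      ≤⟨ +-monoˡ-≤ b (run-length r i) ⟩
    length (lookup σ i) + a + b   ≡⟨ +-assoc _ a b ⟩
    length (lookup σ i) + (a + b) ∎
    where open ≤-Reasoning
  run-length (if-yes _ r) i = ≤-trans (run-length r i) (+-monoʳ-≤ _ (n≤1+n _))
  run-length (if-no _ r) i = ≤-trans (run-length r i) (+-monoʳ-≤ _ (n≤1+n _))
  run-length (leave _) i = m≤m+n _ 1
  run-length (loop {σ = σ} {σ'} {σ''} {s} {r} _ d d') i = begin
    length (lookup σ'' i)               ≤⟨ run-length d' i ⟩
    length (lookup σ' i) + r            ≤⟨ +-monoˡ-≤ r (run-length d i) ⟩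
    length (lookup σ i) + s + r         ≡⟨ +-assoc _ s r ⟩
    length (lookup σ i) + (s + r)       ≤⟨ +-monoʳ-≤ _ (n≤1+n _) ⟩
    length (lookup σ i) + (suc (s + r)) ∎
    where open ≤-Reasoning
  run-length (case _ r) i = ≤-trans (run-length r i) (+-monoʳ-≤ _ (m≤n+m _ 2))
  run-length (weaken le r) i = ≤-trans (run-length r i) (+-monoʳ-≤ _ le)

  abstract
    -- A composite symbol records the content of each of the `suc nS` tracks, which is blank or one
    -- of four symbols. Abstraction keeps this power from being evaluated.
    K : ℕ
    K = 5 ^ suc nS

  open Tape K renaming (_⨾_ to _；_) public

  raw : Maybe Γ → Sym K
  raw a = toFin₅ a ↑ˡ K

  -- Track 0 marks cell 0, and track i + 1 holds stack i with its bottom at cell 0.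
  -- A symbol of the input alphabet stands for an unmarked cell where only stack 0 is occupied.
  module Tracks where
    abstract
      rawTrack : Fin 5 → Fin (suc nS) → Maybe Γ
      rawTrack x 1F = fromFin₅ x
      rawTrack x _  = nothing

      rd : Fin (suc nS) → Sym K → Maybe Γ
      rd i x with splitAt 5 x
      ... | inj₁ r = rawTrack r i
      ... | inj₂ c = fromFin₅ (finToFun {5} {suc nS} c i)

      override : Fin (suc nS) → Maybe Γ → Sym K → Fin (suc nS) → Maybe Γ
      override i a x j with j Fin.≟ i
      ... | yes _ = a
      ... | no _  = rd j x

      wr : Fin (suc nS) → Maybe Γ → Sym K → Sym K
      wr i a x = 5 ↑ʳ funToFin (toFin₅ ∘ override i a x)

      rd-wr : ∀ i a x j → rd j (wr i a x) ≡ override i a x j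
      rd-wr i a x j rewrite splitAt-↑ʳ 5 K (funToFin (toFin₅ ∘ override i a x)) =
        trans (cong fromFin₅ (finToFun-funToFin (toFin₅ ∘ override i a x) j)) (fromFin₅-toFin₅ _)

      rd-wr-same : ∀ i a x → rd i (wr i a x) ≡ a
      rd-wr-same i a x with i Fin.≟ i | rd-wr i a x i
      ... | yes _ | e = e
      ... | no ¬p | e = ⊥-elim (¬p refl)

      rd-wr-other : ∀ i a x {j} → j ≢ i → rd j (wr i a x) ≡ rd j x
      rd-wr-other i a x {j} j≢i with j Fin.≟ i | rd-wr i a x j
      ... | yes p | e = ⊥-elim (j≢i p)
      ... | no _  | e = e

      rd-raw-zero : ∀ a → rd zero (raw a) ≡ nothing
      rd-raw-zero a rewrite splitAt-↑ˡ 5 (toFin₅ a) K = refl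

      rd-raw-input : ∀ {i} → toℕ i ≡ 0 → ∀ a → rd (suc i) (raw a) ≡ a
      rd-raw-input {zero} refl a rewrite splitAt-↑ˡ 5 (toFin₅ a) K = fromFin₅-toFin₅ a

      rd-raw-other : ∀ {i} → toℕ i ≢ 0 → ∀ a → rd (suc i) (raw a) ≡ nothing
      rd-raw-other {zero}  i≢0 a = ⊥-elim (i≢0 refl)
      rd-raw-other {suc i} i≢0 a rewrite splitAt-↑ˡ 5 (toFin₅ a) K = refl
  open Tracks

  record Rep (t : Tp) (σ : State) : Set where
    field
      tracks   : ∀ i j → rd (suc i) (t j) ≡ height (lookup σ i) j
      marked   : rd zero (t 0) ≡ just `0
      unmarked : ∀ j → rd zero (t (suc j)) ≡ nothing
  open Rep

  rep-update : ∀ {t σ h} i a f → Rep t σ → height (f (lookup σ i)) h ≡ a →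
               (∀ j → h ≢ j → height (f (lookup σ i)) j ≡ height (lookup σ i) j) →
               Rep (write t h (wr (suc i) a (t h))) (σ [ i ]%= f)
  rep-update {t} {σ} {h} i a f rep hit miss = record
    { tracks   = tr
    ; marked   = mk 0 (marked rep)
    ; unmarked = λ j → mk (suc j) (unmarked rep j)
    }
    where
    mk : ∀ j {x} → rd zero (t j) ≡ x → rd zero (write t h (wr (suc i) a (t h)) j) ≡ x
    mk j e with h ≟ j
    ... | yes refl = trans (rd-wr-other (suc i) a (t h) λ ()) e
    ... | no _     = e
    tr : ∀ i' j → rd (suc i') (write t h (wr (suc i) a (t h)) j) ≡ height (lookup (σ [ i ]%= f) i') j
    tr i' j with i' Fin.≟ i
    tr i' j | yes refl rewrite lookup∘updateAt i {f} σ with h ≟ j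
    ... | yes refl = trans (rd-wr-same (suc i) a (t h)) (sym hit)
    ... | no h≢j   = trans (tracks rep i j) (sym (miss j h≢j))
    tr i' j | no i'≢i rewrite lookup∘updateAt′ i' i {f} i'≢i σ with h ≟ j
    ... | yes refl = trans (rd-wr-other (suc i) a (t h) λ { refl → i'≢i refl }) (tracks rep i' h)
    ... | no _     = tracks rep i' j

  -- Compilation of stack programs into sweeps over the tape.

  occupied : Fin nS → Sym K → Bool
  occupied i x = is-just (rd (suc i) x)

  -- For an empty stack the left move is made at cell 0 and stays there. That cell is blank on the
  -- track, in agreement with `List.head [] ≡ nothing`.
  goEnd goTop : Fin nS → TapeProg
  goEnd i = while (occupied i) (act (λ x → x) Move.R)
  goTop i = goEnd i ； act (λ x → x) Move.L

  home : TapeProg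
  home = while (is-nothing ∘ rd zero) (act (λ x → x) Move.L)

  cell : (Maybe Γ → Bool) → Fin nS → Sym K → Bool
  cell b i x = b (rd (suc i) x)

  colored marked? : Maybe Γ → Bool
  colored (just a) = proj₁ a
  colored nothing  = false
  marked? (just a) = proj₂ a
  marked? nothing  = false

  -- Each compiled program starts and ends at cell 0, which `home` recognizes by its mark. Tests are
  -- made at the top of a stack, so a loop returns to cell 0 before its body and walks to the top
  -- again after it.
  compile : Prog → TapeProg
  compile skip            = act (λ x → x) Move.S
  compile (push i a)      = goEnd i ； act (wr (suc i) (just a)) Move.S ； home
  compile (pop i)         = goTop i ； act (wr (suc i) nothing) Move.S ； home
  compile (p ⨾ q)         = compile p ； compile q
  compile (ifTop i b p q) = goTop i ； ite (cell b i) (home ； compile p) (home ； compile q)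
  compile (while i b p)   = goTop i ； while (cell b i) (home ； compile p ； goTop i) ； home

  compile (case i p)      = goTop i ； ite (cell colored i)
    (ite (cell marked? i) (home ； compile (p `$)) (home ； compile (p `1)))
    (ite (cell marked? i) (home ； compile (p `#)) (home ； compile (p `0)))

  module _ {t σ} (rep : Rep t σ) where

    goEnd-run : ∀ i → TapeRun (goEnd i) t 0 t (length (lookup σ i)) (length (lookup σ i) * 2 + 1)
    goEnd-run i = go 0 (length (lookup σ i)) refl
      where
      go : ∀ h d → h + d ≡ length (lookup σ i) → TapeRun (goEnd i) t h t (length (lookup σ i)) (d * 2 + 1)
      go h zero    e with trans (sym (+-identityʳ h)) e
      ... | refl = leave (cong is-just (trans (tracks rep i h) (height-beyond (lookup σ i) ≤-refl)))
      go h (suc d) e = loop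
        (trans (cong is-just (tracks rep i h))
          (height-inside (lookup σ i) (subst (h <_) e (m<m+n h (s≤s z≤n)))))
        (act (write-id t h)) (go (suc h) d (trans (sym (+-suc h d)) e))

    goTop-run : ∀ i → TapeRun (goTop i) t 0 t (pred (length (lookup σ i))) (length (lookup σ i) * 2 + 1 + 1)
    goTop-run i = goEnd-run i ； subst (λ z → TapeRun (act (λ x → x) Move.L) t (length (lookup σ i)) t z 1) (left≡pred (length (lookup σ i))) (act (write-id t (length (lookup σ i))))
      where
      left≡pred : ∀ m → move Move.L m ≡ pred m
      left≡pred zero    = refl
      left≡pred (suc m) = refl

    home-run : ∀ h → TapeRun home t h t 0 (h * 2 + 1)
    home-run zero    = leave (cong is-nothing (marked rep))
    home-run (suc h) = loop (cong is-nothing (unmarked rep h)) (act (write-id t (suc h))) (home-run h)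

    cell-top : ∀ b i → cell b i (t (pred (length (lookup σ i)))) ≡ b (top σ i)
    cell-top b i = cong b (trans (tracks rep i _) (height-pred (lookup σ i)))

  -- A walk over `M` cells takes a test and a move per cell, the exit test, and at most one more
  -- move. `unitCost` allows a walk out, a walk home and one action.
  walkCost : ℕ → ℕ
  walkCost M = M * 2 + 1 + 1

  unitCost : ℕ → ℕ
  unitCost M = suc (walkCost M + walkCost M)

  record Simulated (p : TapeProg) (t : Tp) (h h' : ℕ) (σ' : State) (bound : ℕ) : Set where
    constructor sim
    field
      {t'}    : Tp
      {s}     : ℕ
      derived : TapeRun p t h t' h' s
      repr    : Rep t' σ'
      bounded : s ≤ bound

  module _ (M : ℕ) where
    private
      V U : ℕ
      V = walkCost M
      U = unitCost M

      goEnd≤ : ∀ {l} → l ≤ M → l * 2 + 1 ≤ V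
      goEnd≤ le = ≤-trans (+-monoˡ-≤ 1 (*-monoˡ-≤ 2 le)) (m≤m+n _ 1)

      goTop≤ : ∀ {l} → l ≤ M → l * 2 + 1 + 1 ≤ V
      goTop≤ le = +-monoˡ-≤ 1 (+-monoˡ-≤ 1 (*-monoˡ-≤ 2 le))

      home≤ : ∀ {l} → l ≤ M → pred l * 2 + 1 ≤ V
      home≤ {l} le = goEnd≤ (≤-trans (pred[n]≤n {l}) le)

      one≤U : ∀ {x} → x ≤ U → x ≤ 1 * U
      one≤U le = ≤-trans le (≤-reflexive (sym (+-identityʳ U)))

      around : ∀ {x y} → x ≤ V → y ≤ V → x + suc y ≤ U
      around {x} {y} x≤ y≤ = ≤-trans (≤-reflexive (+-suc x y)) (s≤s (+-mono-≤ x≤ y≤))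

    -- Height plus remaining time is a potential that never grows along a run, by `run-length`. One
    -- bound `M` therefore covers every sweep of the run.
    record Fits (σ : State) (s : ℕ) : Set where
      constructor fits
      field fit : ∀ i → length (lookup σ i) + s ≤ M
    open Fits

    private
      fits-len : ∀ {σ s} → Fits σ s → ∀ i → length (lookup σ i) ≤ M
      fits-len f i = ≤-trans (m≤m+n _ _) (fit f i)

      fits-less : ∀ {σ s r} → s ≤ r → Fits σ r → Fits σ s
      fits-less le f = fits λ i → ≤-trans (+-monoʳ-≤ _ le) (fit f i)

      fits-after : ∀ {p σ σ' a b} → Run p σ σ' a → Fits σ (a + b) → Fits σ' b
      fits-after {σ = σ} {a = a} {b} r f = fits λ i → ≤-trans (+-monoˡ-≤ b (run-length r i))
        (≤-trans (≤-reflexive (+-assoc (length (lookup σ i)) a b)) (fit f i))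

    compile-run : ∀ {p σ σ' s} → Run p σ σ' s → Fits σ s → ∀ {t} → Rep t σ →
                  Simulated (compile p) t 0 0 σ' (s * U)

    -- Measured from stack top to stack top, where the loop test takes place. The reserve `V + V`
    -- pays for the walk to the first test and for the way home after the last one.
    while-run : ∀ {i b p σ σ' s} → Run (while i b p) σ σ' s → Fits σ s → ∀ {t} → Rep t σ →
                Σ ℕ λ r → (r + (V + V) ≤ s * U) ×
                Simulated (while (cell b i) (home ； compile p ； goTop i)) t
                          (pred (length (lookup σ i))) (pred (length (lookup σ' i))) σ' r
    private
      around-while : ∀ {i b p σ σ' s} → Run (while i b p) σ σ' s → Fits σ s → ∀ {t} → Rep t σ →
                     (Σ ℕ λ r → (r + (V + V) ≤ s * U) ×
                     Simulated (while (cell b i) (home ； compile p ； goTop i)) t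
                               (pred (length (lookup σ i))) (pred (length (lookup σ' i))) σ' r) →
                     Simulated (compile (while i b p)) t 0 0 σ' (s * U)
      around-while {i} {s = s} d f rep (r , le , sim {s = x} td rep' le') =
        sim (goTop-run rep i ； td ； home-run rep' _) rep' (begin
          _           ≤⟨ +-mono-≤ (goTop≤ (fits-len f i)) (+-mono-≤ le' (home≤ (≤-trans (run-length d i) (fit f i)))) ⟩
          V + (r + V) ≡⟨ cong (V +_) (+-comm r V) ⟩
          V + (V + r) ≡⟨ sym (+-assoc V V r) ⟩
          V + V + r   ≡⟨ +-comm (V + V) r ⟩
          r + (V + V) ≤⟨ le ⟩
          s * U       ∎)
        where open ≤-Reasoning

    while-run {i} {b} {σ = σ} (leave e) f rep =
      1 , ≤-reflexive (sym (+-identityʳ U)) , sim (leave (trans (cell-top rep b i) e)) rep ≤-refl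
    while-run {i} {b} {σ = σ} (loop {p = p} {σ' = σ'} {s = s} {r} e d d') f rep
      with compile-run d (fits-less (≤-trans (m≤m+n s r) (n≤1+n _)) f) rep
    ... | sim {s = x} td rep' le
      with while-run d' (fits-after d (fits-less (n≤1+n _) f)) rep'
    ... | r' , le' , sim {s = y} td' rep'' le'' =
      suc ((V + (s * U + V)) + r') , total ,
      sim (loop (trans (cell-top rep b i) e)
            (home-run rep _ ； td ； goTop-run rep' i) td') rep''
          (s≤s (+-mono-≤ (+-mono-≤ (home≤ (fits-len f i)) (+-mono-≤ le (goTop≤ (fits-len (fits-after d (fits-less (n≤1+n (s + r)) f)) i)))) le''))
      where
      open ≤-Reasoning
      total : suc ((V + (s * U + V)) + r') + (V + V) ≤ suc (s + r) * U
      total = begin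
        suc ((V + (s * U + V)) + r') + (V + V) ≡⟨ cong suc (+-assoc (V + (s * U + V)) r' (V + V)) ⟩
        suc ((V + (s * U + V)) + (r' + (V + V))) ≤⟨ s≤s (+-monoʳ-≤ (V + (s * U + V)) le') ⟩
        suc ((V + (s * U + V)) + r * U)          ≡⟨ cong (λ z → suc ((V + z) + r * U)) (+-comm (s * U) V) ⟩
        suc ((V + (V + s * U)) + r * U)          ≡⟨ cong (λ z → suc (z + r * U)) (sym (+-assoc V V (s * U))) ⟩
        suc ((V + V + s * U) + r * U)            ≡⟨ cong suc (+-assoc (V + V) (s * U) (r * U)) ⟩
        U + (s * U + r * U)                      ≡⟨ cong (U +_) (sym (*-distribʳ-+ U s r)) ⟩
        suc (s + r) * U ∎
    while-run (weaken le d) f rep with while-run d (fits-less le f) rep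
    ... | r , le' , z = r , ≤-trans le' (*-monoˡ-≤ U le) , z

    compile-run skip f rep = sim (act (write-id _ 0)) rep (s≤s z≤n)
    compile-run (push {σ} {i} {a}) f {t} rep =
      sim (goEnd-run rep i ； act (λ _ → refl) ； home-run rep' _) rep'
          (one≤U (around (goEnd≤ (fits-len f i)) (goEnd≤ (fits-len f i))))
      where
      l = lookup σ i
      rep' = rep-update i (just a) (a ∷_) rep (height-top a l) (λ j ne → height-below a l (ne ∘ sym))
    compile-run (pop {σ} {i}) f {t} rep =
      sim (goTop-run rep i ； act (λ _ → refl) ； home-run rep' _) rep'
          (one≤U (around (goTop≤ (fits-len f i)) (home≤ (fits-len f i))))
      where
      emptied : ∀ l → height (List.drop 1 l) (pred (length l)) ≡ nothing
      emptied []      = refl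
      emptied (a ∷ l) = height-beyond l ≤-refl
      untouched : ∀ l j → pred (length l) ≢ j → height (List.drop 1 l) j ≡ height l j
      untouched []      j ne = refl
      untouched (a ∷ l) j ne = sym (height-below a l (ne ∘ sym))
      rep' = rep-update i nothing (List.drop 1) rep (emptied (lookup σ i)) (untouched (lookup σ i))
    compile-run (_⨾_ {a = a} {b} d d') f rep with compile-run d (fits-less (m≤m+n a b) f) rep
    ... | sim td rep' le with compile-run d' (fits-after d f) rep'
    ... | sim td' rep'' le' = sim (td ； td') rep''
      (≤-trans (+-mono-≤ le le') (≤-reflexive (sym (*-distribʳ-+ U a b))))
    compile-run (if-yes {i} {b} e d) f rep with compile-run d (fits-less (n≤1+n _) f) rep
    ... | sim td rep' le = sim (goTop-run rep i ； ite-yes (trans (cell-top rep b i) e) (home-run rep _ ； td)) rep'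
      (≤-trans (≤-reflexive (sym (+-assoc _ (suc _) _)))
        (+-mono-≤ (around (goTop≤ (fits-len f i)) (home≤ (fits-len f i))) le))
    compile-run (if-no {i} {b} e d) f rep with compile-run d (fits-less (n≤1+n _) f) rep
    ... | sim td rep' le = sim (goTop-run rep i ； ite-no (trans (cell-top rep b i) e) (home-run rep _ ； td)) rep'
      (≤-trans (≤-reflexive (sym (+-assoc _ (suc _) _)))
        (+-mono-≤ (around (goTop≤ (fits-len f i)) (home≤ (fits-len f i))) le))
    compile-run d@(leave _) f rep = around-while d f rep (while-run d f rep)
    compile-run d@(loop _ _ _) f rep = around-while d f rep (while-run d f rep)
    compile-run (case {i} {p} {σ} {s = r} {a} e d) f {t} rep with compile-run d (fits-less (m≤n+m _ 2) f) rep
    ... | sim {s = s'} td rep' le = sim (goTop-run rep i ； branches a e td) rep' (begin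
      goTop-cost + suc (suc (home-cost + s'))   ≡⟨ +-suc goTop-cost (suc (home-cost + s')) ⟩
      suc (goTop-cost + suc (home-cost + s'))   ≤⟨ +-mono-≤ {1} {U} (s≤s z≤n) (≤-trans
        (≤-reflexive (sym (+-assoc goTop-cost (suc home-cost) s')))
        (+-mono-≤ (around (goTop≤ (fits-len f i)) (home≤ (fits-len f i))) le)) ⟩
      U + (U + r * U)                           ∎)
      where
      open ≤-Reasoning
      goTop-cost = length (lookup σ i) * 2 + 1 + 1
      home-cost = pred (length (lookup σ i)) * 2 + 1
      is : ∀ b {x} → top σ i ≡ x → cell b i (t (pred (length (lookup σ i)))) ≡ b x
      is b e = trans (cell-top rep b i) (cong b e)
      branches : ∀ a → top σ i ≡ just a → ∀ {t' s} → TapeRun (compile (p a)) t 0 t' 0 s →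
                 TapeRun (ite (cell colored i)
                   (ite (cell marked? i) (home ； compile (p `$)) (home ； compile (p `1)))
                   (ite (cell marked? i) (home ； compile (p `#)) (home ； compile (p `0))))
                   t (pred (length (lookup σ i))) t' 0 (suc (suc (home-cost + s)))
      branches `0 e r = ite-no (is colored e) (ite-no (is marked? e) (home-run rep _ ； r))
      branches `1 e r = ite-yes (is colored e) (ite-no (is marked? e) (home-run rep _ ； r))
      branches `# e r = ite-no (is colored e) (ite-yes (is marked? e) (home-run rep _ ； r))
      branches `$ e r = ite-yes (is colored e) (ite-yes (is marked? e) (home-run rep _ ； r))
    compile-run (weaken le d) f rep with compile-run d (fits-less le f) rep
    ... | sim td rep' le' = sim td rep' (≤-trans le' (*-monoˡ-≤ U le))

-- Input and output of the machine.

module StackMachine (m : ℕ) where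
  open Stack (suc m)
  open Tracks

  start : List Γ → State
  start w = reverse w ∷ Vec.replicate m []

  start-length : ∀ w i → length (lookup (start w) i) ≤ length w
  start-length w zero    = ≤-reflexive (List.length-reverse w)
  start-length w (suc i) = ≤-trans (≤-reflexive (cong length (lookup-replicate i []))) z≤n

  symbol : Γ → Sym K
  symbol = raw ∘ just

  -- Composite symbols are replaced by plain ones from the bottom of the output stack upwards, and
  -- the final blank delimits the word. Composite symbols may survive only behind that blank.
  copyOut emit : Fin (suc m) → TapeProg
  copyOut i = while (occupied i) (act (raw ∘ rd (suc i)) Move.R)
  emit i = copyOut i ； act (λ _ → blank) Move.S

  -- The track is assumed intact only from the head on, because the cells behind the head have been
  -- overwritten.
  copyOut-run : ∀ i l {u} h d → h + d ≡ length l → (∀ j → h ≤ j → rd (suc i) (u j) ≡ height l j) →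
                Σ Tp λ u' → TapeRun (copyOut i) u h u' (length l) (d * 2 + 1) ×
                (∀ j → j < h → u' j ≡ u j) × (∀ j → h ≤ j → j < length l → u' j ≡ raw (height l j))
  copyOut-run i l {u} h zero e tr with trans (sym (+-identityʳ h)) e
  ... | refl = u , leave (cong is-just (trans (tr h ≤-refl) (height-beyond l ≤-refl))) , (λ _ _ → refl) ,
    λ j h≤j j<h → ⊥-elim (<⇒≱ j<h h≤j)
  copyOut-run i l {u} h (suc d) e tr
    with copyOut-run i l {write u h (raw (rd (suc i) (u h)))} (suc h) d (trans (sym (+-suc h d)) e)
           (λ j h<j → trans (cong (rd (suc i)) (write-there u _ (<⇒≢ h<j))) (tr j (<⇒≤ h<j)))
  ... | u' , r , below , above =
    u' , loop (trans (cong is-just (tr h ≤-refl)) (height-inside l (subst (h <_) e (m<m+n h (s≤s z≤n))))) (act (λ _ → refl)) r ,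
    (λ j j<h → trans (below j (m<n⇒m<1+n j<h)) (write-there u _ (≢-sym (<⇒≢ j<h)))) ,
    λ j h≤j j<l → here-or-later j h≤j j<l
    where
    here-or-later : ∀ j → h ≤ j → j < length l → u' j ≡ raw (height l j)
    here-or-later j h≤j j<l with h ≟ j
    ... | yes refl = trans (below h ≤-refl) (trans (write-here u h _) (cong raw (tr h ≤-refl)))
    ... | no h≢j   = above j (≤∧≢⇒< h≤j h≢j) j<l

  private
    nth-map : ∀ o (i : Fin (length (List.map symbol o))) → raw (nth o (toℕ i)) ≡ List.lookup (List.map symbol o) i
    nth-map (a ∷ o) zero    = refl
    nth-map (a ∷ o) (suc i) = nth-map o i

    input-nth : ∀ w j → inputTape (List.map symbol w) j ≡ raw (nth w j)
    input-nth []      j       = refl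
    input-nth (a ∷ w) zero    = refl
    input-nth (a ∷ w) (suc j) = input-nth w j

  markLeft : TapeProg
  markLeft = act (wr zero (just `0)) Move.S

  markLeft-rep : ∀ w → Rep (write (inputTape (List.map symbol w)) 0 (wr zero (just `0) (inputTape (List.map symbol w) 0))) (start w)
  markLeft-rep w = record
    { tracks   = λ { zero zero → trans (rd-wr-other zero _ _ λ ()) (inp 0)
                   ; zero (suc j) → inp (suc j)
                   ; (suc i) zero → trans (rd-wr-other zero _ _ λ ()) (rest i 0)
                   ; (suc i) (suc j) → rest i (suc j) }
    ; marked   = rd-wr-same zero _ _
    ; unmarked = λ j → trans (cong (rd zero) (input-nth w (suc j))) (rd-raw-zero (nth w (suc j)))
    }
    where
    inp : ∀ j → rd (suc zero) (inputTape (List.map symbol w) j) ≡ height (reverse w) j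
    inp j = trans (cong (rd (suc zero)) (input-nth w j)) (trans (rd-raw-input refl (nth w j)) (sym (height-reverse w j)))
    rest : ∀ (i : Fin m) j → rd (suc (suc i)) (inputTape (List.map symbol w) j) ≡ height (lookup (Vec.replicate m []) i) j
    rest i j rewrite lookup-replicate {A = List Γ} i [] = trans (cong (rd (suc (suc i))) (input-nth w j)) (rd-raw-other (λ ()) (nth w j))

  stackMachine : Prog → Fin (suc m) → TM
  stackMachine p out = machine (markLeft ； compile p ； emit out)

  -- The summands are the jump out of the start state, the marking of cell 0, the simulation with
  -- stacks of height at most `l + s`, and the copying of the output.
  machineCost : ℕ → ℕ → ℕ
  machineCost l s = suc (1 + (s * unitCost (l + s) + ((l + s) * 2 + 1 + 1)))

  stackMachine-halts : ∀ {p out w σ s o} → Run p (start w) σ s → lookup σ out ≡ reverse o →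
    Σ ℕ λ r → r ≤ machineCost (length w) s ×
    HaltsWithin (stackMachine p out) (List.map symbol w) r (List.map symbol o)
  stackMachine-halts {p} {out} {w} {σ} {s} {o} d eq
    with compile-run (length w + s) d (fits λ i → +-monoˡ-≤ s (start-length w i)) (markLeft-rep w)
  ... | sim td rep le with copyOut-run out (lookup σ out) 0 (length (lookup σ out)) refl (λ j _ → Rep.tracks rep out j)
  ... | u' , r , _ , above with machine-halts (markLeft ； compile p ； emit out) {List.map symbol w} (act (λ _ → refl) ； td ； r ； act (λ _ → refl))
  ... | halted , tp = _ , s≤s (s≤s (+-mono-≤ le (+-monoˡ-≤ 1 (+-monoˡ-≤ 1 (*-monoˡ-≤ 2 out≤))))) , halted , holds , end
    where
    open ≡-Reasoning
    out≤ : length (lookup σ out) ≤ length w + s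
    out≤ = ≤-trans (run-length d out) (+-monoˡ-≤ s (start-length w out))
    len : length (lookup σ out) ≡ length (List.map symbol o)
    len = trans (cong length eq) (trans (List.length-reverse o) (sym (List.length-map symbol o)))
    holds : ∀ i → _
    holds i = begin
      _                            ≡⟨ tp (toℕ i) ⟩
      write u' (length (lookup σ out)) blank (toℕ i) ≡⟨ write-there u' {length (lookup σ out)} blank (λ e → <⇒≢ i< (sym e)) ⟩
      u' (toℕ i)                   ≡⟨ above (toℕ i) z≤n i< ⟩
      raw (height (lookup σ out) (toℕ i)) ≡⟨ cong (λ z → raw (height z (toℕ i))) eq ⟩
      raw (height (reverse o) (toℕ i))    ≡⟨ cong raw (height-reverse o (toℕ i)) ⟩
      raw (nth o (toℕ i))                 ≡⟨ nth-map o i ⟩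
      List.lookup (List.map symbol o) i      ∎
      where
      i< : toℕ i < length (lookup σ out)
      i< = subst (toℕ i <_) (sym len) (toℕ<n i)
    end : _
    end = trans (tp (length (List.map symbol o))) (trans (cong (write u' (length (lookup σ out)) blank) (sym len)) (write-here u' (length (lookup σ out)) blank))

xor-exchange : ∀ a b x y → a xor x ≡ b xor y → a xor b ≡ x xor y
xor-exchange true  true  true  true  _ = refl
xor-exchange true  true  false false _ = refl
xor-exchange true  false true  false _ = refl
xor-exchange true  false false true  _ = refl
xor-exchange false true  true  false _ = refl
xor-exchange false true  false true  _ = refl
xor-exchange false false true  true  _ = refl
xor-exchange false false false false _ = refl

-- Rows of linked vertices

-- A vector of cells is a coloring (first components) together with a vertex set (second components).
Cells : _ → Set
Cells = Vec Γ

color mem : ∀ {n} → Cells n → Fin n → Bool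
color X i = proj₁ (lookup X i)
mem   X i = proj₂ (lookup X i)

joinCell : Γ → Γ → Γ
joinCell x r = proj₁ x , proj₂ x ∨ proj₂ r

flipCell unmark : Γ → Γ
flipCell (c , f) = f xor c , f
unmark   (c , _) = c , false

meets : ∀ {n} → Cells n → Cells n → Bool
meets []      []      = false
meets (x ∷ X) (r ∷ R) = (proj₂ x ∧ proj₂ r) ∨ meets X R

absorbRow : ∀ {n} → Cells n → Cells n → Cells n
absorbRow R X = if meets X R then zipWith joinCell X R else X

absorb : ∀ {n} → List (Cells n) → Cells n → Cells n
absorb []      X = X
absorb (R ∷ P) X = absorb P (absorbRow R X)

private
  ∨-true : ∀ x {y} → x ∨ y ≡ true → x ≡ true ⊎ y ≡ true
  ∨-true true  _ = inj₁ refl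
  ∨-true false e = inj₂ e

  ∨-falseʳ : ∀ x {y} → x ∨ y ≡ false → y ≡ false
  ∨-falseʳ false e = e

  true≢false : ∀ {b} → b ≡ true → b ≢ false
  true≢false refl ()

meets-yes : ∀ {n} (X R : Cells n) → meets X R ≡ true → ∃ λ i → mem X i ≡ true × mem R i ≡ true
meets-yes []      []      ()
meets-yes ((_ , true) ∷ X) ((_ , true) ∷ R) e = zero , refl , refl
meets-yes ((_ , true) ∷ X) ((_ , false) ∷ R) e with meets-yes X R e
... | i , p , q = suc i , p , q
meets-yes ((_ , false) ∷ X) (_ ∷ R) e with meets-yes X R e
... | i , p , q = suc i , p , q

meets-no : ∀ {n} (X R : Cells n) → meets X R ≡ false → ∀ i → mem R i ≡ true → mem X i ≡ false
meets-no ((_ , true) ∷ X) ((_ , true) ∷ R) () zero r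
meets-no ((_ , false) ∷ X) (_ ∷ R) e zero r = refl
meets-no (x ∷ X) (r ∷ R) e (suc i) q = meets-no X R (∨-falseʳ (proj₂ x ∧ proj₂ r) e) i q

absorbRow-color : ∀ {n} (R X : Cells n) i → color (absorbRow R X) i ≡ color X i
absorbRow-color R X i with meets X R
... | true  = cong proj₁ (lookup-zipWith joinCell i X R)
... | false = refl

absorb-color : ∀ {n} P (X : Cells n) i → color (absorb P X) i ≡ color X i
absorb-color []      X i = refl
absorb-color (R ∷ P) X i = trans (absorb-color P (absorbRow R X) i) (absorbRow-color R X i)

absorbRow-mono : ∀ {n} (R X : Cells n) i → mem X i ≡ true → mem (absorbRow R X) i ≡ true
absorbRow-mono R X i e with meets X R
... | true  = trans (cong proj₂ (lookup-zipWith joinCell i X R)) (cong (_∨ mem R i) e)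
... | false = e

absorb-mono : ∀ {n} P (X : Cells n) i → mem X i ≡ true → mem (absorb P X) i ≡ true
absorb-mono []      X i e = e
absorb-mono (R ∷ P) X i e = absorb-mono P (absorbRow R X) i (absorbRow-mono R X i e)

-- One notion with three uses. For the indicator of a set it says that no row is split by the set;
-- for the difference of two colorings, that they agree up to a flip on each row; for the members of
-- a newer row, that the rows are laminar.
Constant : ∀ {n} → List (Cells n) → (Fin n → Bool) → Set
Constant P g = All (λ R → ∀ a b → mem R a ≡ true → mem R b ≡ true → g a ≡ g b) P

constant-map : ∀ {n} {P : List (Cells n)} {g h} → (∀ a b → g a ≡ g b → h a ≡ h b) → Constant P g → Constant P h
constant-map f = All.map λ c a b p q → f a b (c a b p q)

constant-cong : ∀ {n} {P : List (Cells n)} {g h} → g ≗ h → Constant P g → Constant P h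
constant-cong g≗h = constant-map λ a b e → trans (sym (g≗h a)) (trans e (g≗h b))

-- Minimality of the closure: a row is absorbed only if it shares a vertex with what has been
-- gathered, and that vertex transports the common value `e` to the whole row.
absorb-constant : ∀ {n} P (X : Cells n) {g e} → Constant P g → (∀ i → mem X i ≡ true → g i ≡ e) →
                  ∀ i → mem (absorb P X) i ≡ true → g i ≡ e
absorb-constant []      X []       h = h
absorb-constant (R ∷ P) X {g} {e} (c ∷ cs) h = absorb-constant P (absorbRow R X) cs h'
  where
  h' : ∀ i → mem (absorbRow R X) i ≡ true → g i ≡ e
  h' i p with meets X R in eq
  ... | false = h i p
  ... | true with ∨-true (mem X i) (trans (sym (cong proj₂ (lookup-zipWith joinCell i X R))) p) | meets-yes X R eq
  ...   | inj₁ q | _         = h i q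
  ...   | inj₂ q | j , r , s = trans (c i j q s) (h j r)

-- Each row is a union of older rows and of vertices outside of them, so that a single
-- pass of absorb, from the newest row to the oldest, already yields a closed set.
Laminar : ∀ {n} → List (Cells n) → Set
Laminar []      = ⊤
Laminar (R ∷ P) = Constant P (mem R) × Laminar P

-- A row that is met becomes contained. A row `R` that is missed at its turn stays missed: `mem R`
-- is constant on all older rows, so absorbing these never enters `R`.
absorb-closed : ∀ {n} P (X : Cells n) → Laminar P → Constant P (mem (absorb P X))
absorb-closed []      X _         = []
absorb-closed (R ∷ P) X (c , lam) = head ∷ absorb-closed P (absorbRow R X) lam
  where
  head : ∀ a b → mem R a ≡ true → mem R b ≡ true →
         mem (absorb P (absorbRow R X)) a ≡ mem (absorb P (absorbRow R X)) b
  head a b p q with meets X R in eq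
  ... | true  = trans (inside a p) (sym (inside b q))
    where
    inside : ∀ i → mem R i ≡ true → mem (absorb P (zipWith joinCell X R)) i ≡ true
    inside i r = absorb-mono P _ i (trans (cong proj₂ (lookup-zipWith joinCell i X R))
                                   (trans (cong (mem X i ∨_) r) (∨-zeroʳ (mem X i))))
  ... | false = trans (outside a p) (sym (outside b q))
    where
    avoid : ∀ i → mem X i ≡ true → mem R i ≡ false
    avoid i x with mem R i in r
    ... | false = refl
    ... | true  = contradiction (meets-no X R eq i r) (true≢false x)
    outside : ∀ i → mem R i ≡ true → mem (absorb P X) i ≡ false
    outside i r with mem (absorb P X) i in s
    ... | false = refl
    ... | true  = contradiction (absorb-constant P X c avoid i s) (true≢false r)

-- Solutions of a family of rows and their flips.

Solution : ∀ {n} → List (Cells n) → (Fin n → Bool) → (Fin n → Bool) → Set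
Solution P x Y = Constant P (λ i → Y i xor x i)

flipOn : ∀ {n} → (Fin n → Bool) → (Fin n → Bool) → Fin n → Bool
flipOn S Y i = S i xor Y i

private
  shift : ∀ s y x → y xor (s xor x) ≡ s xor (y xor x)
  shift false y     x = refl
  shift true  false x = refl
  shift true  true  x = refl

  unshift : ∀ s y x → y xor x ≡ s xor (y xor (s xor x))
  unshift false y     x = refl
  unshift true  false false = refl
  unshift true  false true  = refl
  unshift true  true  false = refl
  unshift true  true  true  = refl

constant-xor : ∀ {n} {P : List (Cells n)} {s g h} → Constant P s → Constant P g →
               (∀ i → h i ≡ s i xor g i) → Constant P h
constant-xor []       []       e = []
constant-xor (c ∷ cs) (d ∷ ds) e =
  (λ a b p q → trans (e a) (trans (cong₂ _xor_ (c a b p q) (d a b p q)) (sym (e b)))) ∷ constant-xor cs ds e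

solution-self : ∀ {n} (P : List (Cells n)) x → Solution P x x
solution-self P x = All.universal (λ R a b _ _ → trans (xor-same (x a)) (sym (xor-same (x b)))) P

solution-flip : ∀ {n} {P : List (Cells n)} {S x Y} → Constant P S → Solution P x Y → Solution P x (flipOn S Y)
solution-flip {S = S} {x} {Y} c s = constant-xor c s (λ i → xor-assoc (S i) (Y i) (x i))

solution-rebase : ∀ {n} {P : List (Cells n)} {S x Y} → Constant P S → Solution P x Y → Solution P (flipOn S x) Y
solution-rebase {S = S} {x} {Y} c s = constant-xor c s (λ i → shift (S i) (Y i) (x i))

solution-unbase : ∀ {n} {P : List (Cells n)} {S x Y} → Constant P S → Solution P (flipOn S x) Y → Solution P x Y
solution-unbase {S = S} {x} {Y} c s = constant-xor c s (λ i → unshift (S i) (Y i) (x i))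

solution-difference : ∀ {n} {P : List (Cells n)} {x Y Y'} → Solution P x Y → Solution P x Y' → Constant P (λ i → Y i xor Y' i)
solution-difference {x = x} {Y} {Y'} s s' = constant-xor s s' (λ i → cancel (Y i) (Y' i) (x i))
  where
  cancel : ∀ a b x → a xor b ≡ (a xor x) xor (b xor x)
  cancel true  true  x     = sym (xor-same (not x))
  cancel false false x     = sym (xor-same x)
  cancel true  false true  = refl
  cancel true  false false = refl
  cancel false true  true  = refl
  cancel false true  false = refl

-- Components and the linking of two of them.

Clear : ∀ {n} → Cells n → Set
Clear X = ∀ i → mem X i ≡ false

mark : ∀ {n} → Cells n → Fin n → Cells n
mark X u = X [ u ]≔ (color X u , true)

mark-color : ∀ {n} (X : Cells n) u i → color (mark X u) i ≡ color X i
mark-color X u i with i Fin.≟ u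
... | yes refl = cong proj₁ (lookup∘update u X (color X u , true))
... | no i≢u   = cong proj₁ (lookup∘update′ i≢u X (color X u , true))

mark-here : ∀ {n} (X : Cells n) u → mem (mark X u) u ≡ true
mark-here X u = cong proj₂ (lookup∘update u X (color X u , true))

mark-only : ∀ {n} (X : Cells n) u → Clear X → ∀ i → mem (mark X u) i ≡ true → i ≡ u
mark-only X u clr i e with i Fin.≟ u
... | yes i≡u = i≡u
... | no i≢u  = contradiction (clr i) (true≢false (trans (sym (cong proj₂ (lookup∘update′ i≢u X (color X u , true)))) e))

component : ∀ {n} → List (Cells n) → Cells n → Fin n → Cells n
component P X u = absorb P (mark X u)

module _ {n} (P : List (Cells n)) (X : Cells n) (u : Fin n) where

  component-color : ∀ i → color (component P X u) i ≡ color X i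
  component-color i = trans (absorb-color P (mark X u) i) (mark-color X u i)

  component-self : mem (component P X u) u ≡ true
  component-self = absorb-mono P (mark X u) u (mark-here X u)

  component-constant : Clear X → ∀ {g} → Constant P g → ∀ i → mem (component P X u) i ≡ true → g i ≡ g u
  component-constant clr {g} c = absorb-constant P (mark X u) c λ i e → cong g (mark-only X u clr i e)

cells-ext : ∀ {n} {X Y : Cells n} → lookup X ≗ lookup Y → X ≡ Y
cells-ext {X = X} {Y} e = trans (sym (tabulate∘lookup X)) (trans (tabulate-cong e) (tabulate∘lookup Y))

unmark-clear : ∀ {n} (X : Cells n) → Clear (Vec.map unmark X)
unmark-clear X i = cong proj₂ (lookup-map i unmark X)

unmark-color : ∀ {n} (X : Cells n) i → color (Vec.map unmark X) i ≡ color X i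
unmark-color X i = cong proj₁ (lookup-map i unmark X)

unmark-component : ∀ {n} P (X : Cells n) u → Clear X → Vec.map unmark (component P X u) ≡ X
unmark-component P X u clr = cells-ext λ i → trans (lookup-map i unmark (component P X u))
  (cong₂ _,_ (component-color P X u i) (sym (clr i)))

-- Setting v to the wrong color first compensates for the flip of the marked cells.
merge : ∀ {n} → (flip : Bool) → Cells n → Fin n → Bool → Cells n
merge true  X v d = Vec.map flipCell (X [ v ]≔ (not d , true))
merge false X v d = X [ v ]≔ (d , true)

-- The flip needed to make the colors c and d equal (w = true) or different (w = false).
mismatch : Bool → Bool → Bool → Bool
mismatch w c d = not (w xor (c xor d))

link : ∀ {n} → List (Cells n) → Cells n → Fin n → Bool → Bool → Bool → Cells n
link P X v w c d = absorb P (merge (mismatch w c d) X v d)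

module Link {n} (P : List (Cells n)) (X : Cells n) (lam : Laminar P) (clr : Clear X) (u v : Fin n)
            (free : mem (component P X u) v ≡ false) (w : Bool) where

  private
    c d : Bool
    c = color X u
    d = color (component P X u) v

    X₁ X₂ : Cells n
    X₁ = component P X u
    X₂ = merge (mismatch w c d) X₁ v d

    -- The set on which the base coloring is flipped: the component of `u` if the present colors
    -- contradict `w`, and the empty set otherwise. It splits no row, so passing to `x'` does not
    -- change the solutions of the old rows; `v` keeps its color by `free`.
    S : Fin n → Bool
    S i = mismatch w c d ∧ mem X₁ i

    x' : Fin n → Bool
    x' = flipOn S (color X)

    S-constant : Constant P S
    S-constant = constant-map (λ a b e → cong (mismatch w c d ∧_) e) (absorb-closed P (mark X u) lam)

    merge-color : ∀ f i → color (merge f X₁ v d) i ≡ (f ∧ mem X₁ i) xor color X i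
    merge-color true i with i Fin.≟ v
    ... | yes refl rewrite lookup-map i flipCell (X₁ [ i ]≔ (not d , true)) | lookup∘update i X₁ (not d , true) | free =
      trans (not-involutive d) (component-color P X u i)
    ... | no i≢v rewrite lookup-map i flipCell (X₁ [ v ]≔ (not d , true)) | lookup∘update′ i≢v X₁ (not d , true) =
      cong (mem X₁ i xor_) (component-color P X u i)
    merge-color false i with i Fin.≟ v
    ... | yes refl rewrite lookup∘update i X₁ (d , true) = component-color P X u i
    ... | no i≢v rewrite lookup∘update′ i≢v X₁ (d , true) = component-color P X u i

    merge-mem : ∀ f i → mem (merge f X₁ v d) i ≡ true → mem X₁ i ≡ true ⊎ i ≡ v
    merge-mem f i e with i Fin.≟ v
    ... | yes i≡v = inj₂ i≡v
    merge-mem true i e | no i≢v rewrite lookup-map i flipCell (X₁ [ v ]≔ (not d , true)) | lookup∘update′ i≢v X₁ (not d , true) = inj₁ e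
    merge-mem false i e | no i≢v rewrite lookup∘update′ i≢v X₁ (d , true) = inj₁ e

    merge-mono : ∀ f i → mem X₁ i ≡ true ⊎ i ≡ v → mem (merge f X₁ v d) i ≡ true
    merge-mono f i e with i Fin.≟ v
    merge-mono true i e | yes refl rewrite lookup-map i flipCell (X₁ [ v ]≔ (not d , true)) | lookup∘update i X₁ (not d , true) = refl
    merge-mono false i e | yes refl rewrite lookup∘update i X₁ (d , true) = refl
    merge-mono f i (inj₂ i≡v) | no i≢v = contradiction i≡v i≢v
    merge-mono true i (inj₁ e) | no i≢v rewrite lookup-map i flipCell (X₁ [ v ]≔ (not d , true)) | lookup∘update′ i≢v X₁ (not d , true) = e
    merge-mono false i (inj₁ e) | no i≢v rewrite lookup∘update′ i≢v X₁ (d , true) = e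

  row : Cells n
  row = link P X₁ v w c d

  private
    row-color : ∀ i → color row i ≡ x' i
    row-color i = trans (absorb-color P X₂ i) (merge-color (mismatch w c d) i)

    row-u : mem row u ≡ true
    row-u = absorb-mono P X₂ u (merge-mono (mismatch w c d) u (inj₁ (component-self P X u)))

    row-v : mem row v ≡ true
    row-v = absorb-mono P X₂ v (merge-mono (mismatch w c d) v (inj₂ refl))

    x'-uv : x' u xor x' v ≡ not w
    x'-uv rewrite component-self P X u | free | sym (component-color P X u v) = table w (color X u) d
      where
      table : ∀ w c d → ((mismatch w c d ∧ true) xor c) xor ((mismatch w c d ∧ false) xor d) ≡ not w
      table true  true  true  = refl
      table true  true  false = refl
      table true  false true  = refl
      table true  false false = refl
      table false true  true  = refl
      table false true  false = refl
      table false false true  = refl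
      table false false false = refl

    based : ∀ {Y} → Solution P x' Y → Solution P (color row) Y
    based {Y} = constant-cong λ i → cong (Y i xor_) (sym (row-color i))

    unbased : ∀ {Y} → Solution P (color row) Y → Solution P x' Y
    unbased {Y} = constant-cong λ i → cong (Y i xor_) (row-color i)

  row-laminar : Laminar (row ∷ P)
  row-laminar = absorb-closed P X₂ lam , lam

  row-sound : ∀ {Y} → Solution (row ∷ P) (color row) Y → Solution P (color X) Y × Y u xor Y v ≡ not w
  row-sound {Y} (h ∷ s) = solution-unbase {S = S} {color X} {Y} S-constant (unbased {Y} s) ,
    trans (xor-exchange (Y u) (Y v) (x' u) (x' v)
      (trans (cong (Y u xor_) (sym (row-color u))) (trans (h u v row-u row-v) (cong (Y v xor_) (row-color v))))) x'-uv

  -- The difference between `Y` and the new base is constant on either component already. The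
  -- prescribed relation between `u` and `v` makes the two constants equal, and `absorb-constant`
  -- spreads the value over the merged row.
  row-complete : ∀ {Y} → Solution P (color X) Y → Y u xor Y v ≡ not w → Solution (row ∷ P) (color row) Y
  row-complete {Y} s e = (λ a b p q → trans (all-equal a p) (sym (all-equal b q))) ∷ based {Y} rebased
    where
    rebased : Solution P x' Y
    rebased = solution-rebase {S = S} {color X} {Y} S-constant s
    g : Fin n → Bool
    g i = Y i xor x' i
    g-v : g v ≡ g u
    g-v = xor-exchange (Y v) (x' v) (Y u) (x' u) (lemma (Y u) (Y v) (x' u) (x' v) (trans e (sym x'-uv)))
      where
      lemma : ∀ a b x y → a xor b ≡ x xor y → b xor a ≡ y xor x
      lemma a b x y e = trans (xor-comm b a) (trans e (xor-comm x y))
    on-X₂ : ∀ i → mem X₂ i ≡ true → g i ≡ g u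
    on-X₂ i p with merge-mem (mismatch w c d) i p
    ... | inj₁ q    = component-constant P X u clr rebased i q
    ... | inj₂ refl = g-v
    all-equal : ∀ i → mem row i ≡ true → Y i xor color row i ≡ g u
    all-equal i p = trans (cong (Y i xor_) (row-color i)) (absorb-constant P X₂ rebased on-X₂ i p)

-- The search, for a fixed sequence of guesses

-- gr are the remaining guesses, gl the used ones (in reverse order), d records that the current
-- sample needs no more work, and f that the search has failed.
record Search (n : ℕ) : Set where
  constructor search
  field
    X     : Cells n
    P     : List (Cells n)
    gl gr : List Bool
    d f   : Bool
open Search

-- The closed form is `t * (t + 1)`. The recursive form follows both the induction over the negative
-- samples and the program that writes this many guesses.
triangle : ℕ → ℕ
triangle zero    = 0
triangle (suc t) = suc t * 2 + triangle t

module _ {n : ℕ} where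

  attach : Bool → Bool → Bool → Cells n → Fin n → List (Cells n) → List Bool → List Bool → Bool → Bool → Search n
  attach w c e X₁ v P gl gr d f =
    search (Vec.map unmark (link P X₁ v w c e)) (link P X₁ v w c e ∷ P) gl gr (d ∨ w) f

  -- Without a guess left the edge becomes bichromatic, the choice that never finishes a negative
  -- sample, so a lack of guesses cannot produce a false success.
  resolve : Bool → Bool → Γ → Cells n → Fin n → List (Cells n) → List Bool → List Bool → Bool → Bool → Search n
  resolve m c (e , true) X₁ v P gl gr d f =
    search (Vec.map unmark X₁) P gl gr (d ∨ (not m ∧ not (c xor e))) (f ∨ (m ∧ not (c xor e)))
  resolve true  c (e , false) X₁ v P gl gr       d f = attach false c e X₁ v P gl gr d f
  resolve false c (e , false) X₁ v P gl []       d f = attach false c e X₁ v P gl [] d f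
  resolve false c (e , false) X₁ v P gl (b ∷ gr) d f = attach b c e X₁ v P (b ∷ gl) gr d f

  edgeStep : Bool → Fin n → Fin n → Search n → Search n
  edgeStep m u v (search X P gl gr d f) =
    resolve m (color X u) (lookup (component P X u) v) (component P X u) v P gl gr d f

  runEdges : Bool → Graph n → Search n → Search n
  runEdges m []             s = s
  runEdges m ((u , v) ∷ es) s = if d s then s else runEdges m es (edgeStep m u v s)

  finish : Bool → Search n → Search n
  finish true  (search X P gl gr d f) = search X P gl gr false f
  finish false (search X P gl gr d f) = search X P gl gr false (f ∨ not d)

  -- It is called with `l xor m`, which holds exactly for the samples foreign to the pass `m`. Such
  -- a sample counts as done at once: its edges are skipped and `finish` does not fail on it.
  enter : Bool → Search n → Search n
  enter b (search X P gl gr d f) = search X P gl gr (d ∨ b) f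

  runSample : Bool → Sample n → Search n → Search n
  runSample m (E , l) s = finish m (runEdges m E (enter (l xor m) s))

  runPass : Bool → List (Sample n) → Search n → Search n
  runPass m []       s = s
  runPass m (x ∷ xs) s = runPass m xs (runSample m x s)

  initialSearch : List Bool → Search n
  initialSearch g = search (Vec.replicate n `0) [] [] g false false

  attempt : List (Sample n) → List Bool → Search n
  attempt ss g = runPass false ss (runPass true ss (initialSearch g))

  -- Logical effect of processing one edge.

  record Invariant (X : Cells n) (P : List (Cells n)) : Set where
    constructor inv
    field
      clear   : Clear X
      laminar : Laminar P

  Sol : Search n → (Fin n → Bool) → Set
  Sol s = Solution (P s) (color (X s))

  Coloring : Set
  Coloring = Fin n → Bool

  private
    xor-false : ∀ {a b} → a xor b ≡ false → a ≡ b
    xor-false {true}  {true}  _ = refl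
    xor-false {false} {false} _ = refl

    xor-true : ∀ {a b} → a xor b ≡ true → a ≢ b
    xor-true {true} {false} _ ()
    xor-true {false} {true} _ ()

    ≢-xor : ∀ {a b} → a ≢ b → a xor b ≡ true
    ≢-xor {true}  {true}  ne = contradiction refl ne
    ≢-xor {true}  {false} ne = refl
    ≢-xor {false} {true}  ne = refl
    ≢-xor {false} {false} ne = contradiction refl ne

    ≡-xor : ∀ {a b} → a ≡ b → a xor b ≡ false
    ≡-xor {a} refl = xor-same a

    dependent : ∀ {P} {X : Cells n} {u v} → Invariant X P → mem (component P X u) v ≡ true → ∀ Y → Solution P (color X) Y →
                Y u xor Y v ≡ color X u xor color (component P X u) v
    dependent {P} {X} {u} {v} (inv clr lam) e Y s rewrite component-color P X u v =
      xor-exchange (Y u) (Y v) (color X u) (color X v) (sym (component-constant P X u clr s v e))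

  -- Separates the logic of an edge from the manipulation of cells. Either all solutions agree on
  -- the edge, with value `r`, or each outcome `w` describes exactly those solutions in which the
  -- edge has that outcome.
  data EdgeView (X : Cells n) (P : List (Cells n)) (u v : Fin n) : Set where
    dep   : ∀ r → (∀ Y → Solution P (color X) Y → Y u xor Y v ≡ r) →
            (∀ m gl gr d f → edgeStep m u v (search X P gl gr d f) ≡ search X P gl gr (d ∨ (not m ∧ not r)) (f ∨ (m ∧ not r))) →
            EdgeView X P u v
    indep : (X' : Bool → Cells n) (R : Bool → Cells n) → (∀ w → Invariant (X' w) (R w ∷ P)) →
            (∀ w Y → Solution (R w ∷ P) (color (X' w)) Y → Solution P (color X) Y × Y u xor Y v ≡ not w) →
            (∀ w Y → Solution P (color X) Y → Y u xor Y v ≡ not w → Solution (R w ∷ P) (color (X' w)) Y) →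
            mem (component P X u) v ≡ false →
            (∀ gl gr d f → edgeStep true u v (search X P gl gr d f) ≡ search (X' false) (R false ∷ P) gl gr (d ∨ false) f) →
            (∀ gl d f → edgeStep false u v (search X P gl [] d f) ≡ search (X' false) (R false ∷ P) gl [] (d ∨ false) f) →
            (∀ gl b gr d f → edgeStep false u v (search X P gl (b ∷ gr) d f) ≡ search (X' b) (R b ∷ P) (b ∷ gl) gr (d ∨ b) f) →
            EdgeView X P u v

  edgeView : ∀ {X P} u v → Invariant X P → EdgeView X P u v
  edgeView {X} {P} u v i@(inv clr lam) with lookup (component P X u) v in eq
  ... | e , true = dep (color X u xor e)
    (λ Y s → trans (dependent i (cong proj₂ eq) Y s) (cong (color X u xor_) (cong proj₁ eq)))
    unchanged
    where
    unchanged : ∀ m gl gr d f → edgeStep m u v (search X P gl gr d f) ≡ search X P gl gr (d ∨ (not m ∧ not (color X u xor e))) (f ∨ (m ∧ not (color X u xor e)))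
    unchanged m gl gr d f rewrite eq | unmark-component P X u clr = refl
  ... | e , false = indep (λ w → Vec.map unmark (row w)) row
    (λ w → inv (unmark-clear (row w)) (row-laminar w))
    (λ w Y s → row-sound w {Y} (constant-cong (λ i → cong (Y i xor_) (unmark-color (row w) i)) s))
    (λ w Y s q → constant-cong (λ i → cong (Y i xor_) (sym (unmark-color (row w) i))) (row-complete w {Y} s q))
    free
    pos neg₀ neg₁
    where
    free = cong proj₂ eq
    open Link P X lam clr u v free
    pos : ∀ gl gr d f → edgeStep true u v (search X P gl gr d f) ≡ search (Vec.map unmark (row false)) (row false ∷ P) gl gr (d ∨ false) f
    pos gl gr d f rewrite eq = refl
    neg₀ : ∀ gl d f → edgeStep false u v (search X P gl [] d f) ≡ search (Vec.map unmark (row false)) (row false ∷ P) gl [] (d ∨ false) f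
    neg₀ gl d f rewrite eq = refl
    neg₁ : ∀ gl b gr d f → edgeStep false u v (search X P gl (b ∷ gr) d f) ≡ search (Vec.map unmark (row b)) (row b ∷ P) (b ∷ gl) gr (d ∨ b) f
    neg₁ gl b gr d f rewrite eq = refl

  ProperEdges : Graph n → Coloring → Set
  ProperEdges E Y = All (λ e → Y (proj₁ e) ≢ Y (proj₂ e)) E

  MonoEdge : Graph n → Coloring → Set
  MonoEdge E Y = Any (λ e → Y (proj₁ e) ≡ Y (proj₂ e)) E

  PosSat NegSat : List (Sample n) → Coloring → Set
  PosSat ss Y = All (λ x → proj₂ x ≡ true  → ProperEdges (proj₁ x) Y) ss
  NegSat ss Y = All (λ x → proj₂ x ≡ false → MonoEdge (proj₁ x) Y) ss

  -- Positive samples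

  -- Positive constraints lose no solution, hence both directions; soundness presupposes success,
  -- since a failed state describes nothing. Quantifying `result` over `gl` and `gr` expresses that
  -- no guess is consumed.
  record Forced (X : Cells n) (P : List (Cells n)) (f : Bool) (go : Search n → Search n) (Good : Coloring → Set) : Set where
    field
      {X'} : Cells n
      {P'} : List (Cells n)
      {f'} : Bool
      invariant : Invariant X' P'
      sound     : f' ≡ false → f ≡ false × (∀ Y → Solution P' (color X') Y → Solution P (color X) Y × Good Y)
      complete  : ∀ Y → Solution P (color X) Y → Good Y → Solution P' (color X') Y × f' ≡ f
      result    : ∀ gl gr → go (search X P gl gr false f) ≡ search X' P' gl gr false f'

  forced-trans : ∀ {X P f g h A B C} → (F : Forced X P f g A) → Forced (Forced.X' F) (Forced.P' F) (Forced.f' F) h B →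
                 (∀ Y → A Y → B Y → C Y) → (∀ Y → C Y → A Y) → (∀ Y → C Y → B Y) → Forced X P f (h ∘ g) C
  forced-trans {h = h} F G pair left right = record
    { invariant = Forced.invariant G
    ; sound     = λ e → let e₁ , s₁ = Forced.sound G e ; e₀ , s₀ = Forced.sound F e₁ in
                  e₀ , λ Y s → let s' , b = s₁ Y s ; s'' , a = s₀ Y s' in s'' , pair Y a b
    ; complete  = λ Y s c → let s' , e = Forced.complete F Y s (left Y c) ; s'' , e' = Forced.complete G Y s' (right Y c) in
                  s'' , trans e' e
    ; result    = λ gl gr → trans (cong h (Forced.result F gl gr)) (Forced.result G gl gr)
    }

  forced-none : ∀ {X P f A} → Invariant X P → (∀ Y → A Y) → Forced X P f id A
  forced-none i a = record
    { invariant = i ; sound = λ e → e , λ Y s → s , a Y ; complete = λ Y s _ → s , refl ; result = λ _ _ → refl }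

  forced-edge : ∀ {X P f} u v → Invariant X P → Forced X P f (edgeStep true u v) (λ Y → Y u ≢ Y v)
  forced-edge {X} {P} {f} u v i with edgeView u v i
  ... | dep true h eq = record
    { invariant = i
    ; sound     = λ e → e , λ Y s → s , xor-true (h Y s)
    ; complete  = λ Y s _ → s , refl
    ; result    = λ gl gr → trans (eq true gl gr false f) (cong (search X P gl gr false) (∨-identityʳ f))
    }
  ... | dep false h eq = record
    { invariant = i
    ; sound     = λ ()
    ; complete  = λ Y s ne → contradiction (xor-false (h Y s)) ne
    ; result    = λ gl gr → trans (eq true gl gr false f) (cong (search X P gl gr false) (∨-zeroʳ f))
    }
  ... | indep X' R i' snd cmp _ eq _ _ = record
    { invariant = i' false
    ; sound     = λ e → e , λ Y s → proj₁ (snd false Y s) , xor-true (proj₂ (snd false Y s))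
    ; complete  = λ Y s ne → cmp false Y s (≢-xor ne) , refl
    ; result    = λ gl gr → eq gl gr false f
    }

  forced-edges : ∀ {X P f} E → Invariant X P → Forced X P f (runEdges true E) (ProperEdges E)
  forced-edges []            i = forced-none i λ _ → []
  forced-edges {X} {P} {f} ((u , v) ∷ E) i = record
    { invariant = invariant ; sound = sound ; complete = complete ; result = result }
    where
    F = forced-edge u v i
    both = forced-trans {C = ProperEdges ((u , v) ∷ E)} F (forced-edges E (Forced.invariant F)) (λ _ → _∷_) (λ _ → All.head) (λ _ → All.tail)
    open Forced both

  forced-pass : ∀ {X P f} ss → Invariant X P → Forced X P f (runPass true ss) (PosSat ss)
  forced-pass [] i = forced-none i λ _ → []
  forced-pass {X} {P} {f} ((E , l) ∷ ss) i =
    forced-trans {C = PosSat ((E , l) ∷ ss)} (F l) (forced-pass ss (Forced.invariant (F l))) (λ _ → _∷_) (λ _ → All.head) (λ _ → All.tail)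
    where
    skipped : ∀ E gl gr → runEdges true E (search X P gl gr true f) ≡ search X P gl gr true f
    skipped []      gl gr = refl
    skipped (_ ∷ _) gl gr = refl
    F : ∀ l → Forced X P f (runSample true (E , l)) (λ Y → l ≡ true → ProperEdges E Y)
    F true = record
      { invariant = invariant
      ; sound     = λ e → let e' , s = sound e in e' , λ Y t → proj₁ (s Y t) , λ _ → proj₂ (s Y t)
      ; complete  = λ Y s g → complete Y s (g refl)
      ; result    = λ gl gr → cong (finish true) (result gl gr)
      }
      where open Forced (forced-edges {X} {P} {f} E i)
    F false = record
      { invariant = i
      ; sound     = λ e → e , λ Y t → t , λ ()
      ; complete  = λ Y s _ → s , refl
      ; result    = λ gl gr → cong (finish true) (skipped E gl gr)
      }

  -- Negative samples: soundness

  -- In contrast to `Forced` there is only soundness, because a guess discards solutions. It holds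
  -- for every guess sequence, good or bad.
  record Chosen (s : Search n) (go : Search n → Search n) (Good : Coloring → Set) : Set where
    field
      invariant : Invariant (X (go s)) (P (go s))
      open-d    : d (go s) ≡ false
      unfailed  : f (go s) ≡ false → f s ≡ false
      sound     : f (go s) ≡ false → ∀ Y → Sol (go s) Y → Sol s Y × Good Y

  -- The flag `d` turning true certifies one edge that is monochromatic in all solutions that
  -- remain; later rows can only shrink this set, so the certificate persists.
  record EdgesChosen (s : Search n) (E : Graph n) (s' : Search n) : Set where
    field
      invariant : Invariant (X s') (P s')
      same-f    : f s' ≡ f s
      extends   : ∀ Y → Sol s' Y → Sol s Y
      satisfied : d s ≡ false → d s' ≡ true → ∀ Y → Sol s' Y → MonoEdge E Y

  chosen-edges : ∀ E s → Invariant (X s) (P s) → EdgesChosen s E (runEdges false E s)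
  chosen-edges [] s i = record { invariant = i ; same-f = refl ; extends = λ _ t → t ; satisfied = λ { p q → contradiction (trans (sym p) q) λ () } }
  chosen-edges ((u , v) ∷ E) (search X P gl gr true f) i =
    record { invariant = i ; same-f = refl ; extends = λ _ t → t ; satisfied = λ () }
  chosen-edges ((u , v) ∷ E) (search X P gl gr false f) i with edgeView u v i
  ... | dep r h eq = subst (EdgesChosen (search X P gl gr false f) ((u , v) ∷ E))
      (cong (runEdges false E) (sym (trans (eq false gl gr false f) (cong (search X P gl gr (not r)) (∨-identityʳ f)))))
      record { invariant = invariant ; same-f = same-f ; extends = extends ; satisfied = λ _ → sat r h satisfied extends }
    where
    s' = runEdges false E (search X P gl gr (not r) f)
    open EdgesChosen (chosen-edges E (search X P gl gr (not r) f) i)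
    sat : ∀ r → (∀ Y → Solution P (color X) Y → Y u xor Y v ≡ r) →
          (not r ≡ false → d s' ≡ true → ∀ Y → Sol s' Y → MonoEdge E Y) →
          (∀ Y → Sol s' Y → Solution P (color X) Y) →
          d s' ≡ true → ∀ Y → Sol s' Y → MonoEdge ((u , v) ∷ E) Y
    sat true  h rec ext q Y t = there (rec refl q Y t)
    sat false h rec ext q Y t = here (xor-false (h Y (ext Y t)))
  ... | indep X' R i' snd _ _ _ eq₀ eq₁ = choose gr
    where
    chosen : ∀ b gl' gr' s' → EdgesChosen (search (X' b) (R b ∷ P) gl' gr' b f) E s' →
             EdgesChosen (search X P gl gr false f) ((u , v) ∷ E) s'
    chosen b gl' gr' s' c = record
      { invariant = invariant ; same-f = same-f ; extends = λ Y t → proj₁ (snd b Y (extends Y t)) ; satisfied = λ _ → sat b c }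
      where
      open EdgesChosen c
      sat : ∀ b → EdgesChosen (search (X' b) (R b ∷ P) gl' gr' b f) E s' →
            d s' ≡ true → ∀ Y → Sol s' Y → MonoEdge ((u , v) ∷ E) Y
      sat true  c q Y t = here (xor-false (proj₂ (snd true Y (EdgesChosen.extends c Y t))))
      sat false c q Y t = there (EdgesChosen.satisfied c refl q Y t)
    choose : ∀ g → EdgesChosen (search X P gl gr false f) ((u , v) ∷ E) (runEdges false E (edgeStep false u v (search X P gl g false f)))
    choose [] = subst (EdgesChosen (search X P gl gr false f) ((u , v) ∷ E)) (cong (runEdges false E) (sym (eq₀ gl false f)))
      (chosen false gl [] _ (chosen-edges E _ (i' false)))
    choose (b ∷ g) = subst (EdgesChosen (search X P gl gr false f) ((u , v) ∷ E)) (cong (runEdges false E) (sym (eq₁ gl b g false f)))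
      (chosen b (b ∷ gl) g _ (chosen-edges E _ (i' b)))

  chosen-sample : ∀ E l s → Invariant (X s) (P s) → d s ≡ false →
                  Chosen s (runSample false (E , l)) (λ Y → l ≡ false → MonoEdge E Y)
  chosen-sample E true (search X P gl gr false f) i refl = done E
    where
    done : ∀ E → Chosen (search X P gl gr false f) (runSample false (E , true)) (λ Y → true ≡ false → MonoEdge E Y)
    done [] = record { invariant = i ; open-d = refl ; unfailed = λ e → trans (sym (∨-identityʳ f)) e ; sound = λ _ Y t → t , λ () }
    done (_ ∷ _) = record { invariant = i ; open-d = refl ; unfailed = λ e → trans (sym (∨-identityʳ f)) e ; sound = λ _ Y t → t , λ () }
  chosen-sample E false (search X P gl gr false f) i refl = record
    { invariant = invariant
    ; open-d    = refl
    ; unfailed  = λ e → trans (sym same-f) (proj₁ (split (Search.f r) (Search.d r) e))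
    ; sound     = λ e Y t → extends Y t , λ _ → satisfied refl (proj₂ (split (Search.f r) (Search.d r) e)) Y t
    }
    where
    r = runEdges false E (search X P gl gr false f)
    open EdgesChosen (chosen-edges E (search X P gl gr false f) i)
    split : ∀ a b → a ∨ not b ≡ false → a ≡ false × b ≡ true
    split false true _ = refl , refl

  chosen-pass : ∀ ss s → Invariant (X s) (P s) → d s ≡ false → Chosen s (runPass false ss) (NegSat ss)
  chosen-pass [] s i e = record { invariant = i ; open-d = e ; unfailed = λ z → z ; sound = λ _ Y t → t , [] }
  chosen-pass ((E , l) ∷ ss) s i e = record
    { invariant = Chosen.invariant C'
    ; open-d    = Chosen.open-d C'
    ; unfailed  = λ q → Chosen.unfailed C (Chosen.unfailed C' q)
    ; sound     = λ q Y t → let t' , g = Chosen.sound C' q Y t ; t'' , h = Chosen.sound C (Chosen.unfailed C' q) Y t' in t'' , h ∷ g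
    }
    where
    C = chosen-sample E l s i e
    C' = chosen-pass ss (runSample false (E , l) s) (Chosen.invariant C) (Chosen.open-d C)

  -- Negative samples: completeness

  -- The coloring `Y` is part of the result, since the given one may have to be flipped; `Rest`
  -- hands on what later samples need of it. The arbitrary suffix `g'` holds the guesses for those
  -- samples.
  record Guess (E : Graph n) (X : Cells n) (P : List (Cells n)) (bound : ℕ) (Rest : Coloring → Set) : Set where
    field
      g         : List Bool
      short     : length g ≤ bound
      {X'}      : Cells n
      {P'}      : List (Cells n)
      invariant : Invariant X' P'
      {Y}       : Coloring
      solution  : Solution P' (color X') Y
      rest      : Rest Y
      result    : ∀ gl g' f → ∃ λ gl' → runEdges false E (search X P gl (g ++ g') false f) ≡ search X' P' gl' g' true f

  private
    run-done : ∀ E (s : Search n) → d s ≡ true → runEdges false E s ≡ s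
    run-done []      s e = refl
    run-done (_ ∷ E) (search X P gl gr .true f) refl = refl

  -- The values of Y on T guarantee the remaining samples. If a linked component avoids T it can be
  -- flipped, so the edge may be made monochromatic; otherwise T meets both components, and once
  -- the edge is fixed as bichromatic one vertex of T becomes redundant. So |T| bounds the number of 0-guesses.
  guess-edges : ∀ E X P Y (T : List (Fin n)) {Rest} → Invariant X P → Solution P (color X) Y →
                (∀ Y' → Solution P (color X) Y' → (∀ a → a ∈ T → Y' a ≡ Y a) → Rest Y') →
                MonoEdge E Y → Guess E X P (suc (length T)) Rest
  guess-edges ((u , v) ∷ E) X P Y T {Rest} i s keep mono with edgeView u v i
  ... | dep false h eq = record
    { g = [] ; short = z≤n ; invariant = i ; solution = s ; rest = keep Y s (λ _ _ → refl)
    ; result = λ gl g' f → gl , trans (cong (runEdges false E) (trans (eq false gl g' false f) (cong (search X P gl g' true) (∨-identityʳ f))))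
                                      (run-done E _ refl) }
  ... | dep true h eq = record
    { g = g ; short = short ; invariant = invariant ; solution = solution ; rest = rest
    ; result = λ gl g' f → let gl' , r = result gl g' f in
        gl' , trans (cong (runEdges false E) (trans (eq false gl (g ++ g') false f) (cong (search X P gl (g ++ g') false) (∨-identityʳ f)))) r }
    where
    later : MonoEdge ((u , v) ∷ E) Y → MonoEdge E Y
    later (here e)  = contradiction e (xor-true (h Y s))
    later (there m) = m
    open Guess (guess-edges E X P Y T {Rest} i s keep (later mono))
  ... | indep X' R i' snd cmp free _ _ eq₁ = decide (Any.any? (λ a → mem Cu a Bool.≟ true) T) (Any.any? (λ a → mem Cv a Bool.≟ true) T)
    where
    Cu = component P X u
    Cv = component P X v
    Cu-closed = absorb-closed P (mark X u) (Invariant.laminar i)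
    Cv-closed = absorb-closed P (mark X v) (Invariant.laminar i)

    -- `Cu` splits no row, so membership in it is constant along `Cv`, and `v` lies outside.
    disjoint : ∀ a → mem Cv a ≡ true → mem Cu a ≡ false
    disjoint a e = trans (component-constant P X v (Invariant.clear i) Cu-closed a e) free

    u∉Cv : mem Cv u ≡ false
    u∉Cv with mem Cv u in e
    ... | false = refl
    ... | true  = contradiction (trans (sym (component-self P X u)) (disjoint u e)) λ ()

    accept : ∀ Y' → Solution P (color X) Y' → (∀ a → a ∈ T → Y' a ≡ Y a) → Y' u ≡ Y' v → Guess ((u , v) ∷ E) X P (suc (length T)) Rest
    accept Y' s' agree e = record
      { g = true ∷ [] ; short = s≤s z≤n ; invariant = i' true ; solution = cmp true Y' s' (≡-xor e) ; rest = keep Y' s' agree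
      ; result = λ gl g' f → true ∷ gl , trans (cong (runEdges false E) (eq₁ gl true g' false f)) (run-done E _ refl) }

    -- A set `C` that contains exactly one endpoint and avoids `T`: flipping it turns the edge
    -- monochromatic without disturbing the protected colors.
    flipped : ∀ (C : Cells n) → Constant P (mem C) → ¬ Any (λ a → mem C a ≡ true) T → Y u ≢ Y v → mem C u xor mem C v ≡ true →
              Guess ((u , v) ∷ E) X P (suc (length T)) Rest
    flipped C closed avoid ne one = accept (flipOn (mem C) Y) (solution-flip {S = mem C} {color X} {Y} closed s)
      (λ a a∈T → cong (_xor Y a) (¬-not {y = true} λ e → avoid (Any.map (λ { refl → e }) a∈T)))
      (xor-false (table (mem C u) (mem C v) (Y u) (Y v) one (≢-xor ne)))
      where
      table : ∀ a b x y → a xor b ≡ true → x xor y ≡ true → (a xor x) xor (b xor y) ≡ false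
      table true  false true  false _ _ = refl
      table true  false false true  _ _ = refl
      table false true  true  false _ _ = refl
      table false true  false true  _ _ = refl

    -- The guess 0 is paid for by dropping `b` from `T`. This ends after at most `length T` such
    -- guesses, because with `T` empty one of the flips is always possible.
    reject : ∀ a b → a ∈ T → mem Cu a ≡ true → b ∈ T → mem Cv b ≡ true → Y u ≢ Y v → Guess ((u , v) ∷ E) X P (suc (length T)) Rest
    reject a b a∈T pa b∈T pb ne with ∈-∃++ b∈T
    ... | T₁ , T₂ , refl = record
      { g = false ∷ g ; short = s≤s (≤-trans short (≤-reflexive (sym (List.length-++-sucʳ T₁ b T₂))))
      ; invariant = invariant ; solution = solution ; rest = rest
      ; result = λ gl g' f → let gl' , r = result (false ∷ gl) g' f in
          gl' , trans (cong (runEdges false E) (eq₁ gl false (g ++ g') false f)) r }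
      where
      a≢b : a ≢ b
      a≢b refl = contradiction (trans (sym pa) (disjoint b pb)) λ ()

      drop-b : ∀ {c} → c ∈ T₁ ++ b ∷ T₂ → c ≢ b → c ∈ T₁ ++ T₂
      drop-b c∈ c≢b with ∈-++⁻ T₁ c∈
      ... | inj₁ p         = ∈-++⁺ˡ p
      ... | inj₂ (here e)  = contradiction e c≢b
      ... | inj₂ (there p) = ∈-++⁺ʳ T₁ p

      later : MonoEdge ((u , v) ∷ E) Y → MonoEdge E Y
      later (here e)  = contradiction e ne
      later (there m) = m

      keep' : ∀ Y' → Solution (R false ∷ P) (color (X' false)) Y' → (∀ c → c ∈ T₁ ++ T₂ → Y' c ≡ Y c) → Rest Y'
      keep' Y' s' agree = keep Y' (proj₁ (snd false Y' s')) on-T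
        where
        on-a : Y' a ≡ Y a
        on-a = agree a (drop-b a∈T a≢b)
        on-T : ∀ c → c ∈ T₁ ++ b ∷ T₂ → Y' c ≡ Y c
        on-T c c∈T with c Fin.≟ b
        ... | no c≢b   = agree c (drop-b c∈T c≢b)
        -- Before the merge, the difference of `Y'` and `Y` is constant on each component. Both
        -- colorings make the edge bichromatic, so the two constants coincide, and at `a` the
        -- constant is seen to be `false`.
        ... | yes refl = xor-false (begin
          Y' b xor Y b ≡⟨ component-constant P X v (Invariant.clear i) difference b pb ⟩
          Y' v xor Y v ≡⟨ xor-exchange (Y' v) (Y v) (Y' u) (Y u) (trans (xor-comm (Y' v) (Y' u)) (trans relation (trans (sym (≢-xor ne)) (xor-comm (Y u) (Y v))))) ⟩
          Y' u xor Y u ≡⟨ component-constant P X u (Invariant.clear i) difference a pa ⟨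
          Y' a xor Y a ≡⟨ ≡-xor on-a ⟩
          false        ∎)
          where
          open ≡-Reasoning
          relation : Y' u xor Y' v ≡ true
          relation = proj₂ (snd false Y' s')
          difference : Constant P (λ i → Y' i xor Y i)
          difference = solution-difference {x = color X} {Y'} {Y} (proj₁ (snd false Y' s')) s

      open Guess (guess-edges E (X' false) (R false ∷ P) Y (T₁ ++ T₂) {Rest} (i' false) (cmp false Y s (≢-xor ne)) keep' (later mono))

    decide : Dec (Any (λ a → mem Cu a ≡ true) T) → Dec (Any (λ a → mem Cv a ≡ true) T) →
             Guess ((u , v) ∷ E) X P (suc (length T)) Rest
    decide in-u in-v with Y u Bool.≟ Y v
    ... | yes e = accept Y s (λ _ _ → refl) e
    decide (no ¬p) _ | no ne = flipped Cu Cu-closed ¬p ne (cong₂ _xor_ (component-self P X u) free)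
    decide (yes _) (no ¬q) | no ne = flipped Cv Cv-closed ¬q ne (cong₂ _xor_ u∉Cv (component-self P X v))
    decide (yes p) (yes q) | no ne with find p | find q
    ... | a , a∈T , pa | b , b∈T , pb = reject a b a∈T pa b∈T pb ne

  -- The two endpoints of one monochromatic edge per negative sample: any coloring that agrees with
  -- `Y` there keeps all these edges monochromatic.
  witnesses : ∀ ss Y → NegSat ss Y → Σ (List (Fin n)) λ T → length T ≤ negCount ss * 2 ×
              (∀ Y' → (∀ a → a ∈ T → Y' a ≡ Y a) → NegSat ss Y')
  witnesses []                 Y []       = [] , z≤n , λ _ _ → []
  witnesses ((E , true) ∷ ss)  Y (_ ∷ ns) with witnesses ss Y ns
  ... | T , le , keep = T , le , λ Y' agree → (λ ()) ∷ keep Y' agree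
  witnesses ((E , false) ∷ ss) Y (m ∷ ns) with witnesses ss Y ns | find (m refl)
  ... | T , le , keep | (u , v) , e∈E , eq = u ∷ v ∷ T , s≤s (s≤s le) , λ Y' agree →
    (λ _ → Any.map (λ { refl → trans (agree u (here refl)) (trans eq (sym (agree v (there (here refl))))) }) e∈E)
    ∷ keep Y' (λ a a∈T → agree a (there (there a∈T)))

  -- At each negative sample `T` protects only the samples after it, and it is chosen afresh for the
  -- coloring that the previous sample returned.
  guess-pass : ∀ ss X P Y → Invariant X P → Solution P (color X) Y → NegSat ss Y →
               Σ (List Bool) λ g → length g ≤ triangle (negCount ss) ×
               (∀ gl g' f → Search.f (runPass false ss (search X P gl (g ++ g') false f)) ≡ f)
  guess-pass [] X P Y i s [] = [] , z≤n , λ _ _ _ → refl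
  guess-pass ((E , true) ∷ ss) X P Y i s (_ ∷ ns) with guess-pass ss X P Y i s ns
  ... | g , le , r = g , le , λ gl g' f → trans (cong (λ z → Search.f (runPass false ss (finish false z))) (run-done E (search X P gl (g ++ g') true f) refl))
    (trans (r gl g' (f ∨ false)) (∨-identityʳ f))
  guess-pass ((E , false) ∷ ss) X P Y i s (m ∷ ns)
    with witnesses ss Y ns
  ... | T , le , keep with guess-edges E X P Y T {NegSat ss} i s (λ Y' _ → keep Y') (m refl)
  ... | G with guess-pass ss (Guess.X' G) (Guess.P' G) (Guess.Y G) (Guess.invariant G) (Guess.solution G) (Guess.rest G)
  ... | g , le' , r = Guess.g G ++ g ,
    -- With t negative samples from here on, `T` has at most 2(t - 1) vertices, and the accepting
    -- guess makes 2t - 1; this is rounded up to the summand 2t of `triangle`.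
    ≤-trans (≤-reflexive (List.length-++ (Guess.g G))) (+-mono-≤ (≤-trans (Guess.short G) (s≤s (≤-trans le (n≤1+n _)))) le') ,
    λ gl g' f → let gl' , q = Guess.result G gl (g ++ g') f in
      trans (cong (λ z → Search.f (runPass false ss (finish false (runEdges false E (search X P gl z false f))))) (List.++-assoc (Guess.g G) g g'))
      (trans (cong (λ z → Search.f (runPass false ss (finish false z))) q) (trans (r gl' g' (f ∨ false)) (∨-identityʳ f)))

  private
    initial-invariant : Invariant (Vec.replicate n `0) []
    initial-invariant = inv (λ i → cong proj₂ (lookup-replicate i `0)) tt

  -- The final base coloring is a solution of its own rows by `solution-self`, so it can be output
  -- without any further choice.
  attempt-sound : ∀ ss g → f (attempt ss g) ≡ false → PosSat ss (color (X (attempt ss g))) × NegSat ss (color (X (attempt ss g)))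
  attempt-sound ss g e = proj₂ (proj₂ (Forced.sound F unfailed₁) x (proj₁ solved)) , proj₂ solved
    where
    F = forced-pass {f = false} ss initial-invariant
    s₁ = runPass true ss (initialSearch g)
    C = chosen-pass ss (search (Forced.X' F) (Forced.P' F) [] g false (Forced.f' F)) (Forced.invariant F) refl
    x = color (X (attempt ss g))
    e' = trans (cong (λ z → f (runPass false ss z)) (sym (Forced.result F [] g))) e
    unfailed₁ = Chosen.unfailed C e'
    x' : Sol (runPass false ss (search (Forced.X' F) (Forced.P' F) [] g false (Forced.f' F))) x
    x' = subst (λ z → Sol z x) (cong (runPass false ss) (Forced.result F [] g)) (solution-self (P (attempt ss g)) x)
    solved = Chosen.sound C e' x x'

  -- Unmarked cells are exactly the symbols 0 and 1, which makes the vertex stack a legal encoding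
  -- of a subset.
  attempt-clear : ∀ ss g → Clear (X (attempt ss g))
  attempt-clear ss g = subst (λ z → Clear (X (runPass false ss z))) (sym (Forced.result F [] g))
    (Invariant.clear (Chosen.invariant (chosen-pass ss _ (Forced.invariant F) refl)))
    where F = forced-pass {f = false} ss initial-invariant

  -- The enumeration runs over sequences of one length. Padding with `false` is harmless because
  -- `guess-pass` allows any suffix.
  attempt-complete : ∀ ss Y → PosSat ss Y → NegSat ss Y →
                     Σ (List Bool) λ g → length g ≡ triangle (negCount ss) × f (attempt ss g) ≡ false
  attempt-complete ss Y pos neg with Forced.complete F Y [] pos
    where F = forced-pass {f = false} ss initial-invariant
  ... | s , e with guess-pass ss _ _ Y (Forced.invariant (forced-pass {f = false} ss initial-invariant)) s neg
  ... | g , le , r = g ++ List.replicate pad false ,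
    trans (List.length-++ g) (trans (cong (length g +_) (List.length-replicate pad)) (m+[n∸m]≡n le)) ,
    trans (cong (λ z → f (runPass false ss z)) (Forced.result (forced-pass {f = false} ss initial-invariant) [] (g ++ List.replicate pad false)))
      (trans (r [] (List.replicate pad false) _) e)
    where
    pad : ℕ
    pad = triangle (negCount ss) ∸ length g

-- Stack layout and running times of program fragments.

open Stack 11

-- IL/IR, XL/XR, AL/AR and GL/GR are the two halves of tapes for the samples, the vertices, the rows and the
-- guesses; HS, DS and FS are one-bit registers (row hit, sample done, search failed).
pattern IL = 0F
pattern IR = 1F
pattern XL = 2F
pattern XR = 3F
pattern AL = 4F
pattern AR = 5F
pattern GL = 6F
pattern GR = 7F
pattern HS = 8F
pattern DS = 9F
pattern FS = suc 9F

st : (il ir xl xr al ar gl gr hs ds fs : List Γ) → State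
st il ir xl xr al ar gl gr hs ds fs = il ∷ ir ∷ xl ∷ xr ∷ al ∷ ar ∷ gl ∷ gr ∷ hs ∷ ds ∷ fs ∷ []

moveBy : (Γ → Γ) → Fin 11 → Fin 11 → Prog
moveBy g i j = case i λ a → pop i ⨾ push j (g a)

moveBy-run : ∀ {g i j σ a} → top σ i ≡ just a → Run (moveBy g i j) σ ((σ [ i ]%= List.drop 1) [ j ]%= (g a ∷_)) 4
moveBy-run e = case e (pop ⨾ push)

moveAllBy : (Γ → Γ) → Fin 11 → Fin 11 → Prog
moveAllBy g i j = while i is-just (moveBy g i j)

moveAll : Fin 11 → Fin 11 → Prog
moveAll = moveAllBy id

-- The context c isolates stacks i and j.
moveAllBy-run : ∀ {g i j} (c : List Γ → List Γ → State) → (∀ x y → top (c x y) i ≡ List.head x) →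
                (∀ a x y b → (c (a ∷ x) y [ i ]%= List.drop 1) [ j ]%= (b ∷_) ≡ c x (b ∷ y)) →
                ∀ x y → Run (moveAllBy g i j) (c x y) (c [] (List.map g x ʳ++ y)) (length x * 5 + 1)
moveAllBy-run c t e [] y = leave (cong is-just (t [] y))
moveAllBy-run {g} {i} {j} c t e (a ∷ x) y = loop (cong is-just (t (a ∷ x) y))
  (subst (λ z → Run (moveBy g i j) (c (a ∷ x) y) z 4) (e a x y (g a)) (moveBy-run (t (a ∷ x) y)))
  (moveAllBy-run c t e x (g a ∷ y))

moveAll-run : ∀ {i j} (c : List Γ → List Γ → State) → (∀ x y → top (c x y) i ≡ List.head x) →
              (∀ a x y b → (c (a ∷ x) y [ i ]%= List.drop 1) [ j ]%= (b ∷_) ≡ c x (b ∷ y)) →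
              ∀ x y → Run (moveAll i j) (c x y) (c [] (x ʳ++ y)) (length x * 5 + 1)
moveAll-run {i} {j} c t e x y =
  subst (λ z → Run (moveAll i j) (c x y) (c [] (z ʳ++ y)) (length x * 5 + 1)) (List.map-id x) (moveAllBy-run c t e x y)

into : ∀ {p σ σ' σ'' s} → σ' ≡ σ'' → Run p σ σ' s → Run p σ σ'' s
into refl r = r

tok : Bool → List Γ
tok true  = `0 ∷ []
tok false = []

-- Popping an empty stack does nothing, so a one-bit register holds exactly one token afterwards,
-- whether or not it was raised before.
raise : Fin 11 → Prog
raise i = pop i ⨾ push i `0

when : Bool → Prog → Prog
when b p = if b then p else skip

-- Costs are counted in multiples of a unit that exceeds the cost of a pass over the vertices.
unit : ℕ → ℕ
unit n = n * 12 + 12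

record Within (n : ℕ) (p : Prog) (σ σ' : State) (k : ℕ) : Set where
  constructor within
  field run-within : Run p σ σ' (k * unit n)
open Within

infixr 5 _▸_
_▸_ : ∀ {n p p' σ σ' σ'' a b} → Within n p σ σ' a → Within n p' σ' σ'' b → Within n (p ⨾ p') σ σ'' (a + b)
_▸_ {n} {a = a} {b} (within r) (within r') = within (subst (Run _ _ _) (sym (*-distribʳ-+ (unit n) a b)) (r ⨾ r'))

-- The constant 12 dominates the per-vertex and the fixed cost of each elementary pass; the two side
-- conditions are decided by evaluating `≤ᵇ`.
pass : ∀ {n p σ σ'} m a b {a≤ : T (a ≤ᵇ 12)} {b≤ : T (b ≤ᵇ 12)} → m ≤ n → Run p σ σ' (m * a + b) → Within n p σ σ' 1
pass {n} m a b {a≤} {b≤} m≤n r = within (weaken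
  (≤-trans (+-mono-≤ (*-mono-≤ m≤n (≤ᵇ⇒≤ a 12 a≤)) (≤ᵇ⇒≤ b 12 b≤)) (≤-reflexive (sym (+-identityʳ (unit n))))) r)

short : ∀ {n p σ σ' s} {_ : T (s ≤ᵇ 12)} → Run p σ σ' s → Within n p σ σ' 1
short {s = s} {le} = pass 0 0 s {b≤ = le} z≤n

after : ∀ {n p σ σ' σ'' k} → σ' ≡ σ'' → Within n p σ σ' k → Within n p σ σ'' k
after refl w = w

at-most : ∀ {n p σ σ' k l} → k ≤ l → Within n p σ σ' k → Within n p σ σ' l
at-most {n} le (within r) = within (weaken (*-monoˡ-≤ (unit n) le) r)

restore : ∀ (x y : List Γ) → (x ʳ++ []) ʳ++ y ≡ x ++ y
restore x y = List.ʳ++-ʳ++ x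

restore-all : ∀ (x : List Γ) → (x ʳ++ []) ʳ++ [] ≡ x
restore-all x = trans (restore x []) (List.++-identityʳ x)

length-ʳ++[] : ∀ (x : List Γ) → length (x ʳ++ []) ≡ length x
length-ʳ++[] x = trans (List.length-ʳ++ x) (+-identityʳ _)

-- Lockstep passes over the vertices and a row

lockstep : (Γ → Γ → Bool) → (Γ → Γ → Γ) → Prog
lockstep h g = while XR is-just (case XR λ x → case AR λ r →
  pop XR ⨾ push XL (g x r) ⨾ pop AR ⨾ push AL r ⨾ when (h x r) (raise HS))

hits : ∀ {n} → (Γ → Γ → Bool) → Cells n → Cells n → Bool
hits h []      []       = false
hits h (x ∷ X) (r ∷ R') = h x r ∨ hits h X R'

raise-HS : ∀ {il ir xl xr al ar gl gr ds fs} c b →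
           Run (when b (raise HS)) (st il ir xl xr al ar gl gr (tok c) ds fs) (st il ir xl xr al ar gl gr (tok (c ∨ b)) ds fs) 2
raise-HS c     false rewrite ∨-identityʳ c = weaken (s≤s z≤n) skip
raise-HS true  true = pop ⨾ push
raise-HS false true = pop ⨾ push

lockstep-run : ∀ {n h g il ir gl gr ds fs} (X R : Cells n) xl al ar c →
  Run (lockstep h g) (st il ir xl (toList X) al (toList R ++ ar) gl gr (tok c) ds fs)
      (st il ir (toList (zipWith g X R) ʳ++ xl) [] (toList R ʳ++ al) ar gl gr (tok (c ∨ hits h X R)) ds fs) (n * 11 + 1)
lockstep-run [] [] xl al ar c rewrite ∨-identityʳ c = leave refl
lockstep-run {h = h} {g} (x ∷ X) (r ∷ R) xl al ar c = loop refl
  (case refl (case refl (pop ⨾ push ⨾ pop ⨾ push ⨾ raise-HS c (h x r))))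
  (into (cong (λ z → st _ _ (toList (zipWith g X R) ʳ++ (g x r ∷ xl)) [] (toList R ʳ++ (r ∷ al)) ar _ _ (tok z) _ _)
              (∨-assoc c (h x r) (hits h X R))) (lockstep-run X R (g x r ∷ xl) (r ∷ al) ar (c ∨ h x r)))

retreat : Prog
retreat = while XL is-just (moveBy id XL XR ⨾ moveBy id AL AR)

-- In continuation form because the cells return in reverse order: the head of the vector, which
-- induction peels off, is the last one moved.
retreat-run : ∀ {n il ir gl gr hs ds fs σ s} (X R : Cells n) {xl xr al ar} →
  Run retreat (st il ir xl (toList X ++ xr) al (toList R ++ ar) gl gr hs ds fs) σ s →
  Run retreat (st il ir (toList X ʳ++ xl) xr (toList R ʳ++ al) ar gl gr hs ds fs) σ (n * 9 + s)
retreat-run []      []      k = k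
retreat-run {suc n} {s = s} (x ∷ X) (r ∷ R) k =
  weaken (≤-reflexive (trans (sym (+-assoc (n * 9) 9 s)) (cong (_+ s) (+-comm (n * 9) 9))))
    (retreat-run X R (loop refl (moveBy-run refl ⨾ moveBy-run refl) k))

touch : Γ → Γ → Bool
touch x r = proj₂ x ∧ proj₂ r

meets-hits : ∀ {n} (X R : Cells n) → hits touch X R ≡ meets X R
meets-hits []      []      = refl
meets-hits (x ∷ X) (r ∷ R) = cong (touch x r ∨_) (meets-hits X R)

no-hits : ∀ {n} (X R : Cells n) → hits (λ _ _ → false) X R ≡ false
no-hits []      []      = refl
no-hits (x ∷ X) (r ∷ R) = no-hits X R

zipWith-left : ∀ {n} (X R : Cells n) → zipWith (λ x _ → x) X R ≡ X
zipWith-left []      []      = refl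
zipWith-left (x ∷ X) (r ∷ R) = cong (x ∷_) (zipWith-left X R)

toList-empty : ∀ {n} (X : Cells n) → toList X ++ [] ≡ toList X
toList-empty X = List.++-identityʳ (toList X)

keepCell : Γ → Γ → Γ
keepCell x _ = x

-- Whether to join is known only after the whole row has been read, so one pass detects a common
-- vertex and a second one joins. If nothing is joined, the second pass still carries the row over
-- to `AL`.
absorbRowProg : Prog
absorbRowProg =
  lockstep touch keepCell ⨾ retreat ⨾
  ifTop HS is-just (pop HS ⨾ lockstep (λ _ _ → false) joinCell) (lockstep (λ _ _ → false) keepCell) ⨾
  moveAll XL XR

rewind-run : ∀ {n il ir al ar gl gr hs ds fs} xl xr → length xl ≤ n →
             Within n (moveAll XL XR) (st il ir xl xr al ar gl gr hs ds fs) (st il ir [] (xl ʳ++ xr) al ar gl gr hs ds fs) 1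
rewind-run {n} {il} {ir} {al} {ar} {gl} {gr} {hs} {ds} {fs} xl xr le =
  pass (length xl) 5 1 le
      (moveAll-run (λ x y → st il ir x y al ar gl gr hs ds fs) (λ _ _ → refl) (λ _ _ _ _ → refl) xl xr)

absorbRow-run : ∀ {n il ir gl gr ds fs} (X R : Cells n) al ar →
  Within n absorbRowProg (st il ir [] (toList X) al (toList R ++ ar) gl gr [] ds fs)
         (st il ir [] (toList (absorbRow R X)) (toList R ʳ++ al) ar gl gr [] ds fs) 4
absorbRow-run {n} {il} {ir} {gl} {gr} {ds} {fs} X R al ar =
  pass n 11 1 ≤-refl (into scanned (lockstep-run X R [] al ar false)) ▸
  pass n 9 1 ≤-refl (into (cong (λ z → st il ir [] z al (toList R ++ ar) gl gr (tok (meets X R)) ds fs) (toList-empty X))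
    (retreat-run X R {[]} {[]} {al} {ar} (leave refl))) ▸
  pass n 11 3 ≤-refl (weaken (≤-reflexive (reorder n)) (update (meets X R))) ▸
  after (cong (λ z → st il ir [] z (toList R ʳ++ al) ar gl gr [] ds fs) (restore-all _))
    (rewind-run (toList (absorbRow R X) ʳ++ []) [] (≤-reflexive (trans (length-ʳ++[] (toList (absorbRow R X))) (length-toList (absorbRow R X)))))
  where
  reorder : ∀ n → 2 + (n * 11 + 1) ≡ n * 11 + 3
  reorder = solve-∀
  scanned : st il ir (toList (zipWith keepCell X R) ʳ++ []) [] (toList R ʳ++ al) ar gl gr (tok (hits touch X R)) ds fs
          ≡ st il ir (toList X ʳ++ []) [] (toList R ʳ++ al) ar gl gr (tok (meets X R)) ds fs
  scanned rewrite zipWith-left X R | meets-hits X R = refl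
  update : ∀ b → Run (ifTop HS is-just (pop HS ⨾ lockstep (λ _ _ → false) joinCell) (lockstep (λ _ _ → false) keepCell))
    (st il ir [] (toList X) al (toList R ++ ar) gl gr (tok b) ds fs)
    (st il ir (toList (if b then zipWith joinCell X R else X) ʳ++ []) [] (toList R ʳ++ al) ar gl gr [] ds fs) (2 + (n * 11 + 1))
  update true = if-yes refl (pop ⨾ into (cong (λ z → st il ir (toList (zipWith joinCell X R) ʳ++ []) [] (toList R ʳ++ al) ar gl gr (tok z) ds fs) (no-hits X R))
    (lockstep-run X R [] al ar false))
  update false = weaken (n≤1+n _) (if-no refl (into (cong₂ (λ y z → st il ir (toList y ʳ++ []) [] (toList R ʳ++ al) ar gl gr (tok z) ds fs) (zipWith-left X R) (no-hits X R))
    (lockstep-run X R [] al ar false)))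

-- No separators are stored: a row has as many cells as there are vertices, and `lockstep` stops
-- when the vertex stack is exhausted.
rows : ∀ {n} → List (Cells n) → List Γ
rows []      = []
rows (R ∷ P) = toList R ++ rows P

rows-length : ∀ {n} (P : List (Cells n)) → length (rows P) ≡ length P * n
rows-length []      = refl
rows-length (R ∷ P) = trans (List.length-++ (toList R)) (cong₂ _+_ (length-toList R) (rows-length P))

absorbProg : Prog
absorbProg = while AR is-just absorbRowProg ⨾ moveAll AL AR

-- With at least one vertex every row is a nonempty word, so the test `is-just` on `AR` detects each
-- remaining row. A vertex exists whenever there is an edge to process.
absorb-run : ∀ {n il ir gl gr ds fs} (P : List (Cells (suc n))) (X : Cells (suc n)) →
  Within (suc n) absorbProg (st il ir [] (toList X) [] (rows P) gl gr [] ds fs)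
         (st il ir [] (toList (absorb P X)) [] (rows P) gl gr [] ds fs) (length P * 6 + 2)
absorb-run {n} {il} {ir} {gl} {gr} {ds} {fs} P X =
  at-most (≤-reflexive (total (length P))) (scan P X [] ▸
    after (cong (λ z → st il ir [] (toList (absorb P X)) [] z gl gr [] ds fs) (restore-all (rows P)))
      (within (weaken cost (moveAll-run (λ x y → st il ir [] (toList (absorb P X)) x y gl gr [] ds fs) (λ _ _ → refl) (λ _ _ _ _ → refl) (rows P ʳ++ []) []))))
  where
  open ≤-Reasoning
  total : ∀ p → (p * 5 + 1) + (p + 1) ≡ p * 6 + 2
  total = solve-∀
  cost : length (rows P ʳ++ []) * 5 + 1 ≤ (length P + 1) * unit (suc n)
  cost = begin
    length (rows P ʳ++ []) * 5 + 1              ≡⟨ cong (λ z → z * 5 + 1) (trans (length-ʳ++[] (rows P)) (rows-length P)) ⟩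
    length P * suc n * 5 + 1                    ≤⟨ +-mono-≤ (≤-reflexive (*-assoc (length P) (suc n) 5)) (≤ᵇ⇒≤ 1 12 _) ⟩
    length P * (suc n * 5) + 12                 ≤⟨ +-mono-≤ (*-monoʳ-≤ (length P) (≤-trans (*-monoʳ-≤ (suc n) (≤ᵇ⇒≤ 5 12 _)) (m≤m+n _ 12))) (m≤n+m 12 (suc n * 12)) ⟩
    length P * unit (suc n) + unit (suc n)      ≡⟨ cong (length P * unit (suc n) +_) (sym (*-identityˡ (unit (suc n)))) ⟩
    length P * unit (suc n) + 1 * unit (suc n)  ≡⟨ *-distribʳ-+ (unit (suc n)) (length P) 1 ⟨
    (length P + 1) * unit (suc n)               ∎
  scan : ∀ P X al → Within (suc n) (while AR is-just absorbRowProg) (st il ir [] (toList X) al (rows P) gl gr [] ds fs)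
         (st il ir [] (toList (absorb P X)) (rows P ʳ++ al) [] gl gr [] ds fs) (length P * 5 + 1)
  scan [] X al = short (leave refl)
  scan (R@(_ ∷ _) ∷ P) X al = within (weaken (begin
    suc (4 * q + (length P * 5 + 1) * q) ≤⟨ +-monoˡ-≤ _ {1} {q} (≤-trans (≤ᵇ⇒≤ 1 12 _) (m≤n+m 12 (suc n * 12))) ⟩
    q + (4 * q + (length P * 5 + 1) * q) ≡⟨ fold q (length P * 5 + 1) ⟩
    (length (R ∷ P) * 5 + 1) * q         ∎)
    (loop refl (run-within (absorbRow-run X R al (rows P)))
      (into (cong (λ z → st il ir [] (toList (absorb P (absorbRow R X))) z [] gl gr [] ds fs) (sym (List.++-ʳ++ (toList R))))
        (run-within (scan P (absorbRow R X) (toList R ʳ++ al))))))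
    where
    q = unit (suc n)
    fold : ∀ q p → q + (4 * q + p * q) ≡ (5 + p) * q
    fold = solve-∀

sweep : (Γ → Γ) → Prog
sweep g = moveAllBy g XR XL ⨾ moveAll XL XR

sweep-run : ∀ {n g il ir al ar gl gr hs ds fs} (X : Cells n) →
  Within n (sweep g) (st il ir [] (toList X) al ar gl gr hs ds fs) (st il ir [] (toList (Vec.map g X)) al ar gl gr hs ds fs) 2
sweep-run {n} {g} {il} {ir} {al} {ar} {gl} {gr} {hs} {ds} {fs} X =
  pass (length (toList X)) 5 1 (≤-reflexive (length-toList X))
    (into (cong (λ z → st il ir (z ʳ++ []) [] al ar gl gr hs ds fs) (sym (toList-map g X)))
      (moveAllBy-run (λ x y → st il ir y x al ar gl gr hs ds fs) (λ _ _ → refl) (λ _ _ _ _ → refl) (toList X) [])) ▸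
  after (cong (λ z → st il ir [] z al ar gl gr hs ds fs) (restore-all (toList (Vec.map g X))))
    (rewind-run (toList (Vec.map g X) ʳ++ []) [] (≤-reflexive (trans (length-ʳ++[] (toList (Vec.map g X))) (length-toList (Vec.map g X)))))

pushRow : Prog
pushRow = moveAll XR XL ⨾ while XL is-just (case XL λ x → pop XL ⨾ push XR x ⨾ push AR x)

pushRow-run : ∀ {n il ir al ar gl gr hs ds fs} (X : Cells n) →
  Within n pushRow (st il ir [] (toList X) al ar gl gr hs ds fs) (st il ir [] (toList X) al (toList X ++ ar) gl gr hs ds fs) 2
pushRow-run {n} {il} {ir} {al} {ar} {gl} {gr} {hs} {ds} {fs} X =
  pass (length (toList X)) 5 1 (≤-reflexive (length-toList X))
    (moveAll-run (λ x y → st il ir y x al ar gl gr hs ds fs) (λ _ _ → refl) (λ _ _ _ _ → refl) (toList X) []) ▸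
  after (cong₂ (λ y z → st il ir [] y al z gl gr hs ds fs) (restore-all (toList X)) (restore (toList X) ar))
    (pass (length (toList X ʳ++ [])) 6 1 (≤-reflexive (trans (length-ʳ++[] (toList X)) (length-toList X))) (copy (toList X ʳ++ []) [] ar))
  where
  copy : ∀ l xr ar → Run (while XL is-just (case XL λ x → pop XL ⨾ push XR x ⨾ push AR x))
    (st il ir l xr al ar gl gr hs ds fs) (st il ir [] (l ʳ++ xr) al (l ʳ++ ar) gl gr hs ds fs) (length l * 6 + 1)
  copy []      xr ar = leave refl
  copy (x ∷ l) xr ar = loop refl (case refl (pop ⨾ push ⨾ push)) (copy l (x ∷ xr) (x ∷ ar))

is-1 : Maybe Γ → Bool
is-1 (just `1) = true
is-1 _         = false

-- The unary number of a vertex acts as its own address: the vertex stack advances one cell per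
-- symbol 1 read.
walk : Prog
walk = while IR is-1 (moveBy id IR IL ⨾ moveBy id XR XL)

pre post : ∀ {n} → Cells n → Fin n → List Γ
pre  (x ∷ X) zero    = []
pre  (x ∷ X) (suc u) = x ∷ pre X u
post (x ∷ X) zero    = toList X
post (x ∷ X) (suc u) = post X u

pre-length : ∀ {n} (X : Cells n) u → length (pre X u) ≤ n
pre-length (x ∷ X) zero    = z≤n
pre-length (x ∷ X) (suc u) = s≤s (pre-length X u)

put : ∀ {n} (X : Cells n) u a → pre X u ++ a ∷ post X u ≡ toList (X [ u ]≔ a)
put (x ∷ X) zero    a = refl
put (x ∷ X) (suc u) a = cong (x ∷_) (put X u a)

walk-run : ∀ {n il ir al ar gl gr hs ds fs} (X : Cells n) u →
  Within n walk (st il (replicate (toℕ u) `1 ++ `# ∷ ir) [] (toList X) al ar gl gr hs ds fs)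
         (st (replicate (toℕ u) `1 ʳ++ il) (`# ∷ ir) (pre X u ʳ++ []) (lookup X u ∷ post X u) al ar gl gr hs ds fs) 1
walk-run {n} {il} {ir} {al} {ar} {gl} {gr} {hs} {ds} {fs} X u = pass (toℕ u) 9 1 (<⇒≤ (toℕ<n u)) (go X u il [])
  where
  go : ∀ {n} (X : Cells n) u il xl → Run walk (st il (replicate (toℕ u) `1 ++ `# ∷ ir) xl (toList X) al ar gl gr hs ds fs)
    (st (replicate (toℕ u) `1 ʳ++ il) (`# ∷ ir) (pre X u ʳ++ xl) (lookup X u ∷ post X u) al ar gl gr hs ds fs) (toℕ u * 9 + 1)
  go (x ∷ X) zero    il xl = leave refl
  go (x ∷ X) (suc u) il xl = loop refl (moveBy-run refl ⨾ moveBy-run refl) (go X u (`1 ∷ il) (x ∷ xl))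

settle : Γ → Prog
settle a = pop XR ⨾ push XR a ⨾ moveAll XL XR ⨾ moveBy id IR IL

settle-run : ∀ {n il ir al ar gl gr hs ds fs x} a (X : Cells n) u →
  Within n (settle a) (st il (`# ∷ ir) (pre X u ʳ++ []) (x ∷ post X u) al ar gl gr hs ds fs)
         (st (`# ∷ il) ir [] (toList (X [ u ]≔ a)) al ar gl gr hs ds fs) 4
settle-run {n} {il} {ir} {al} {ar} {gl} {gr} {hs} {ds} {fs} a X u =
  short pop ▸ short push ▸
  after (cong (λ z → st il (`# ∷ ir) [] z al ar gl gr hs ds fs) (trans (restore (pre X u) _) (put X u a)))
    (rewind-run (pre X u ʳ++ []) (a ∷ post X u) (≤-trans (≤-reflexive (length-ʳ++[] (pre X u))) (pre-length X u))) ▸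
  short (moveBy-run refl)

-- The program for one edge.

signal : Bool → Prog
signal true  = raise FS
signal false = raise DS

attachProg : Bool → Bool → Bool → Prog
attachProg w c e =
  settle ((if mismatch w c e then not e else e) , true) ⨾ when (mismatch w c e) (sweep flipCell) ⨾
  absorbProg ⨾ pushRow ⨾ sweep unmark ⨾ when w (signal false)

resolveProg : Bool → Bool → Γ → Prog
resolveProg m c (e , true) = settle (e , true) ⨾ sweep unmark ⨾ when (not (c xor e)) (signal m)
resolveProg true  c (e , false) = attachProg false c e
resolveProg false c (e , false) =
  ifTop GR is-just (case GR λ b → pop GR ⨾ push GL b ⨾ attachProg (proj₁ b) c e) (attachProg false c e)

-- The cell of `u` and later that of `v` are held in the finite control by `case`, so comparing the
-- two colors needs no further stack.
edgeProg : Bool → Prog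
edgeProg m = walk ⨾ case XR λ x → settle (proj₁ x , true) ⨾ absorbProg ⨾ walk ⨾ case XR λ y → resolveProg m (proj₁ x) y

unaryΓ : ℕ → List Γ
unaryΓ m = replicate m `1 ++ `# ∷ []

edgeΓ : ∀ {n} → Fin n × Fin n → List Γ
edgeΓ (u , v) = unaryΓ (toℕ u) ++ unaryΓ (toℕ v)

bit : Bool → Γ
bit b = b , false

stack : ∀ {n} → List Γ → List Γ → Search n → State
stack il ir (search X P gl gr d f) = st il ir [] (toList X) [] (rows P) (List.map bit gl) (List.map bit gr) [] (tok d) (tok f)

raise-DS : ∀ {n il ir xl xr al ar gl gr hs fs} d b → Within n (when b (signal false))
           (st il ir xl xr al ar gl gr hs (tok d) fs) (st il ir xl xr al ar gl gr hs (tok (d ∨ b)) fs) 1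
raise-DS d     false rewrite ∨-identityʳ d = short skip
raise-DS true  true  = short (pop ⨾ push)
raise-DS false true  = short (pop ⨾ push)

raise-FS : ∀ {n il ir xl xr al ar gl gr hs ds} f b → Within n (when b (signal true))
           (st il ir xl xr al ar gl gr hs ds (tok f)) (st il ir xl xr al ar gl gr hs ds (tok (f ∨ b))) 1
raise-FS f     false rewrite ∨-identityʳ f = short skip
raise-FS true  true  = short (pop ⨾ push)
raise-FS false true  = short (pop ⨾ push)

case-within : ∀ {n i p σ σ' k a} → top σ i ≡ just a → Within n (p a) σ σ' k → Within n (case i p) σ σ' (1 + k)
case-within {n} e (within r) = within (weaken (+-monoˡ-≤ _ {2} (≤-trans (≤ᵇ⇒≤ 2 12 _) (m≤n+m 12 (n * 12)))) (case e r))

unit-pos : ∀ n → 1 ≤ unit n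
unit-pos n = ≤-trans (≤ᵇ⇒≤ 1 12 _) (m≤n+m 12 (n * 12))

if-yes-within : ∀ {n i b p q σ σ' k} → b (top σ i) ≡ true → Within n p σ σ' k → Within n (ifTop i b p q) σ σ' (1 + k)
if-yes-within {n} e (within r) = within (weaken (+-monoˡ-≤ _ {1} (unit-pos n)) (if-yes e r))

if-no-within : ∀ {n i b p q σ σ' k} → b (top σ i) ≡ false → Within n q σ σ' k → Within n (ifTop i b p q) σ σ' (1 + k)
if-no-within {n} e (within r) = within (weaken (+-monoˡ-≤ _ {1} (unit-pos n)) (if-no e r))

attach-run : ∀ {n il ir gl gr} w c e (X₁ : Cells (suc n)) v P d f {x} →
  Within (suc n) (attachProg w c e)
    (st il (`# ∷ ir) (pre X₁ v ʳ++ []) (x ∷ post X₁ v) [] (rows P) (List.map bit gl) (List.map bit gr) [] (tok d) (tok f))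
    (stack (`# ∷ il) ir (attach w c e X₁ v P gl gr d f)) (4 + (2 + ((length P * 6 + 2) + (2 + (2 + 1)))))
attach-run {n} w c e X₁ v P d f =
  settle-run _ X₁ v ▸ flips (mismatch w c e) ▸ absorb-run P (merge (mismatch w c e) X₁ v e) ▸ pushRow-run _ ▸ sweep-run _ ▸ raise-DS d w
  where
  flips : ∀ {il ir ar gl gr ds fs} b → Within (suc n) (when b (sweep flipCell))
    (st il ir [] (toList (X₁ [ v ]≔ ((if b then not e else e) , true))) [] ar gl gr [] ds fs)
    (st il ir [] (toList (merge b X₁ v e)) [] ar gl gr [] ds fs) 2
  flips true  = sweep-run _
  flips false = at-most (s≤s z≤n) (short skip)

resolve-run : ∀ {n il ir} m c (X₁ : Cells (suc n)) v P gl gr d f y → lookup X₁ v ≡ y →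
  Within (suc n) (resolveProg m c y)
    (st il (`# ∷ ir) (pre X₁ v ʳ++ []) (y ∷ post X₁ v) [] (rows P) (List.map bit gl) (List.map bit gr) [] (tok d) (tok f))
    (stack (`# ∷ il) ir (resolve m c y X₁ v P gl gr d f)) (length P * 6 + 17)
resolve-run m c X₁ v P gl gr d f (e , true) eq =
  at-most (≤-trans (≤ᵇ⇒≤ 7 17 _) (m≤n+m 17 (length P * 6)))
    (settle-run _ X₁ v ▸
     after (cong (λ z → st _ _ [] z [] _ _ _ [] _ _) (cong (λ z → toList (Vec.map unmark z)) unchanged)) (sweep-run _) ▸
     raised m)
  where
  unchanged : X₁ [ v ]≔ (e , true) ≡ X₁
  unchanged = trans (cong (X₁ [ v ]≔_) (sym eq)) ([]≔-lookup X₁ v)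
  raised : ∀ {n} m {il ir xr ar gl gr} → Within n (when (not (c xor e)) (signal m)) (st il ir [] xr [] ar gl gr [] (tok d) (tok f))
    (st il ir [] xr [] ar gl gr [] (tok (d ∨ (not m ∧ not (c xor e)))) (tok (f ∨ (m ∧ not (c xor e))))) 1
  raised true  rewrite ∨-identityʳ d = raise-FS f (not (c xor e))
  raised false rewrite ∨-identityʳ f = raise-DS d (not (c xor e))
resolve-run true c X₁ v P gl gr d f (e , false) eq =
  at-most (bound (length P)) (attach-run false c e X₁ v P d f)
  where
  bound : ∀ p → 4 + (2 + ((p * 6 + 2) + (2 + (2 + 1)))) ≤ p * 6 + 17
  bound p = ≤-trans (≤-reflexive (reorder p)) (+-monoʳ-≤ (p * 6) (≤ᵇ⇒≤ 13 17 _))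
    where
    reorder : ∀ p → 4 + (2 + ((p * 6 + 2) + (2 + (2 + 1)))) ≡ p * 6 + 13
    reorder = solve-∀
resolve-run false c X₁ v P gl [] d f (e , false) eq =
  at-most (bound (length P)) (if-no-within refl (attach-run false c e X₁ v P d f))
  where
  bound : ∀ p → 1 + (4 + (2 + ((p * 6 + 2) + (2 + (2 + 1))))) ≤ p * 6 + 17
  bound p = ≤-trans (≤-reflexive (reorder p)) (+-monoʳ-≤ (p * 6) (≤ᵇ⇒≤ 14 17 _))
    where
    reorder : ∀ p → 1 + (4 + (2 + ((p * 6 + 2) + (2 + (2 + 1))))) ≡ p * 6 + 14
    reorder = solve-∀
resolve-run false c X₁ v P gl (b ∷ gr) d f (e , false) eq =
  at-most (≤-reflexive (reorder (length P))) (if-yes-within refl (case-within refl (short pop ▸ short push ▸ attach-run b c e X₁ v P d f)))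
  where
  reorder : ∀ p → 1 + (1 + (1 + (1 + (4 + (2 + ((p * 6 + 2) + (2 + (2 + 1)))))))) ≡ p * 6 + 17
  reorder = solve-∀

edgeΓ-++ : ∀ {n} (u v : Fin n) ir → edgeΓ (u , v) ++ ir ≡ replicate (toℕ u) `1 ++ `# ∷ (replicate (toℕ v) `1 ++ `# ∷ ir)
edgeΓ-++ u v ir = trans (List.++-assoc (unaryΓ (toℕ u)) (unaryΓ (toℕ v)) ir)
  (trans (List.++-assoc (replicate (toℕ u) `1) (`# ∷ []) (unaryΓ (toℕ v) ++ ir))
  (cong (λ z → replicate (toℕ u) `1 ++ `# ∷ z) (List.++-assoc (replicate (toℕ v) `1) (`# ∷ []) ir)))

edgeΓ-ʳ++ : ∀ {n} (u v : Fin n) il → edgeΓ (u , v) ʳ++ il ≡ `# ∷ (replicate (toℕ v) `1 ʳ++ (`# ∷ (replicate (toℕ u) `1 ʳ++ il)))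
edgeΓ-ʳ++ u v il = trans (List.++-ʳ++ (unaryΓ (toℕ u))) (trans (List.++-ʳ++ (replicate (toℕ v) `1))
  (cong (λ z → `# ∷ (replicate (toℕ v) `1 ʳ++ z)) (List.++-ʳ++ (replicate (toℕ u) `1))))

edge-run : ∀ {n} m u v (s : Search n) il ir →
  Within n (edgeProg m) (stack il (edgeΓ (u , v) ++ ir) s) (stack (edgeΓ (u , v) ʳ++ il) ir (edgeStep m u v s)) (length (P s) * 12 + 27)
edge-run {suc n} m u v s@(search X P gl gr d f) il ir rewrite edgeΓ-++ u v ir | edgeΓ-ʳ++ u v il =
  at-most (≤-reflexive (reorder (length P)))
    (walk-run X u ▸ case-within refl (settle-run _ X u ▸ absorb-run P (mark X u) ▸ walk-run (component P X u) v ▸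
      case-within refl (resolve-run m (color X u) (component P X u) v P gl gr d f (lookup (component P X u) v) refl)))
  where
  reorder : ∀ p → 1 + (1 + (4 + ((p * 6 + 2) + (1 + (1 + (p * 6 + 17)))))) ≡ p * 12 + 27
  reorder = solve-∀

loop-within : ∀ {n i b p σ σ' σ'' a c} → b (top σ i) ≡ true → Within n p σ σ' a →
              Within n (while i b p) σ' σ'' c → Within n (while i b p) σ σ'' (1 + (a + c))
loop-within {n} {a = a} {c} e (within r) (within r') = within (weaken
  (+-mono-≤ (unit-pos n) (≤-reflexive (sym (*-distribʳ-+ (unit n) a c)))) (loop e r r'))

before : ∀ {n p σ σ' σ'' k} → σ ≡ σ' → Within n p σ' σ'' k → Within n p σ σ'' k
before refl w = w

counted : ∀ {n p σ σ' s} → Run p σ σ' s → Within n p σ σ' s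
counted {n} {s = s} r = within (weaken (≤-trans (≤-reflexive (sym (*-identityʳ s))) (*-monoʳ-≤ s (unit-pos n))) r)

-- Programs for edge lists, samples and passes.

not-$ : Maybe Γ → Bool
not-$ (just `$) = false
not-$ (just _)  = true
not-$ nothing   = false

edgesΓ : ∀ {n} → Graph n → List Γ
edgesΓ = concatMap edgeΓ

sampleΓ : ∀ {n} → Sample n → List Γ
sampleΓ (E , l) = bit l ∷ edgesΓ E ++ `$ ∷ []

samplesΓ : ∀ {n} → List (Sample n) → List Γ
samplesΓ = concatMap sampleΓ

edgeΓ-length : ∀ {n} (e : Fin n × Fin n) → 1 ≤ length (edgeΓ e)
edgeΓ-length (u , v) = positive (toℕ u)
  where
  positive : ∀ k {l} → 1 ≤ length (unaryΓ k ++ l)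
  positive zero    = s≤s z≤n
  positive (suc k) = s≤s z≤n

edges-length : ∀ {n} (E : Graph n) → length E ≤ length (edgesΓ E)
edges-length []      = z≤n
edges-length (e ∷ E) = ≤-trans (+-mono-≤ (edgeΓ-length e) (edges-length E)) (≤-reflexive (sym (List.length-++ (edgeΓ e))))

Plain : List Γ → Set
Plain = All (λ a → not-$ (just a) ≡ true)

unaryΓ-plain : ∀ m → Plain (unaryΓ m)
unaryΓ-plain zero    = refl ∷ []
unaryΓ-plain (suc m) = refl ∷ unaryΓ-plain m

edges-plain : ∀ {n} (E : Graph n) → Plain (edgesΓ E)
edges-plain []            = []
edges-plain ((u , v) ∷ E) = All.++⁺ (All.++⁺ (unaryΓ-plain (toℕ u)) (unaryΓ-plain (toℕ v))) (edges-plain E)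

sampleLoop : Bool → Prog
sampleLoop m = while IR not-$ (ifTop DS is-just (moveBy id IR IL) (edgeProg m))

skip-run : ∀ {n m X P gl gr f} l il ir → Plain l → let s = search {n} X P gl gr true f in
           Within n (sampleLoop m) (stack il (l ++ `$ ∷ ir) s) (stack (l ʳ++ il) (`$ ∷ ir) s) (length l * 3 + 1)
skip-run []      il ir []       = short (leave refl)
skip-run {P = P} (a ∷ l) il ir (e ∷ es) = loop-within e (if-yes-within refl (short (moveBy-run refl))) (skip-run {P = P} l (a ∷ il) ir es)

-- At most one new row per edge. Two passes over samples of encoded length N thus leave at most 2N
-- rows, which keeps every closure computation polynomial.
resolve-rows : ∀ {n} m c y (X : Cells n) v P gl gr d f → length (Search.P (resolve m c y X v P gl gr d f)) ≤ suc (length P)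
resolve-rows m     c (e , true)  X v P gl gr       d f = n≤1+n _
resolve-rows true  c (e , false) X v P gl gr       d f = ≤-refl
resolve-rows false c (e , false) X v P gl []       d f = ≤-refl
resolve-rows false c (e , false) X v P gl (b ∷ gr) d f = ≤-refl

edgeStep-rows : ∀ {n} m u v (s : Search n) → length (P (edgeStep m u v s)) ≤ suc (length (P s))
edgeStep-rows m u v (search X P gl gr d f) = resolve-rows m _ (lookup (component P X u) v) _ v P gl gr d f

runEdges-rows : ∀ {n} m E (s : Search n) → length (P (runEdges m E s)) ≤ length (P s) + length E
runEdges-rows m []            s = m≤m+n _ 0
runEdges-rows m ((u , v) ∷ E) (search X P gl gr true f) = m≤m+n _ _
runEdges-rows m ((u , v) ∷ E) s@(search X P gl gr false f) = ≤-trans (runEdges-rows m E (edgeStep m u v s))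
  (≤-trans (+-monoˡ-≤ (length E) (edgeStep-rows m u v s)) (≤-reflexive (sym (+-suc _ (length E)))))

-- The charge per input symbol. An edge has at least one symbol and costs 27 plus 12 per row, and
-- the loop and the test of `DS` add 2.
symbolCost : ℕ → ℕ
symbolCost r = r * 12 + 30

3≤symbolCost : ∀ r → 3 ≤ symbolCost r
3≤symbolCost r = ≤-trans (≤ᵇ⇒≤ 3 30 _) (m≤n+m 30 (r * 12))

edges-run : ∀ {n} m r E (s : Search n) il ir → length (P s) + length E ≤ r →
  Within n (sampleLoop m) (stack il (edgesΓ E ++ `$ ∷ ir) s) (stack (edgesΓ E ʳ++ il) (`$ ∷ ir) (runEdges m E s))
         (length (edgesΓ E) * symbolCost r + 1)
edges-run m r [] s il ir le = short (leave refl)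
edges-run m r E@(_ ∷ _) s@(search X P gl gr true f) il ir le =
  at-most (+-monoˡ-≤ 1 (*-monoʳ-≤ (length (edgesΓ E)) (3≤symbolCost r))) (skip-run {P = P} (edgesΓ E) il ir (edges-plain E))
edges-run {n} m r ((u , v) ∷ E) s@(search X P gl gr false f) il ir le =
  before (cong (λ z → stack il z s) (List.++-assoc (edgeΓ (u , v)) (edgesΓ E) (`$ ∷ ir)))
    (at-most cost (loop-within (first (toℕ u)) (if-no-within refl (edge-run m u v s il (edgesΓ E ++ `$ ∷ ir)))
      (after (cong (λ z → stack z (`$ ∷ ir) (runEdges m ((u , v) ∷ E) s)) (sym (List.++-ʳ++ (edgeΓ (u , v)))))
        (edges-run m r E (edgeStep m u v s) (edgeΓ (u , v) ʳ++ il) ir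
          (≤-trans (+-monoˡ-≤ (length E) (edgeStep-rows m u v s)) (≤-trans (≤-reflexive (sym (+-suc (length P) (length E)))) le))))))
  where
  first : ∀ k {l} → not-$ (List.head (((replicate k `1 ++ `# ∷ []) ++ unaryΓ (toℕ v)) ++ l)) ≡ true
  first zero    = refl
  first (suc k) = refl
  open ≤-Reasoning
  q = symbolCost r
  cost : 1 + ((1 + (length P * 12 + 27)) + (length (edgesΓ E) * q + 1)) ≤ length (edgesΓ ((u , v) ∷ E)) * q + 1
  cost = begin
    1 + ((1 + (length P * 12 + 27)) + (length (edgesΓ E) * q + 1)) ≡⟨ reorder (length P) (length (edgesΓ E) * q) ⟩
    (length P * 12 + 29) + length (edgesΓ E) * q + 1 ≤⟨ +-monoˡ-≤ 1 (+-monoˡ-≤ _ (+-mono-≤ (*-monoˡ-≤ 12 (≤-trans (m≤m+n (length P) _) le)) (≤ᵇ⇒≤ 29 30 _))) ⟩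
    q + length (edgesΓ E) * q + 1 ≤⟨ +-monoˡ-≤ 1 (*-monoˡ-≤ q (+-monoˡ-≤ (length (edgesΓ E)) (edgeΓ-length (u , v)))) ⟩
    (length (edgeΓ (u , v)) + length (edgesΓ E)) * q + 1 ≡⟨ cong (λ z → z * q + 1) (sym (List.length-++ (edgeΓ (u , v)))) ⟩
    length (edgesΓ ((u , v) ∷ E)) * q + 1 ∎
    where
    reorder : ∀ p z → 1 + ((1 + (p * 12 + 27)) + (z + 1)) ≡ (p * 12 + 29) + z + 1
    reorder = solve-∀

endProg : Bool → Prog
endProg true  = pop DS
endProg false = ifTop DS is-just (pop DS) (raise FS)

end-run : ∀ {n} m (s : Search n) il ir → Within n (endProg m) (stack il ir s) (stack il ir (finish m s)) 2
end-run true  (search X P gl gr true f)  il ir = at-most (s≤s z≤n) (short pop)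
end-run true  (search X P gl gr false f) il ir = at-most (s≤s z≤n) (short pop)
end-run false (search X P gl gr true f)  il ir rewrite ∨-identityʳ f = at-most (s≤s (s≤s z≤n)) (if-yes-within refl (short pop))
end-run false (search X P gl gr false true)  il ir = if-no-within refl (short (pop ⨾ push))
end-run false (search X P gl gr false false) il ir = if-no-within refl (short (pop ⨾ push))

headerProg sampleProg passProg : Bool → Prog
headerProg m = case IR λ h → pop IR ⨾ push IL h ⨾ when (proj₁ h xor m) (signal false)
sampleProg m = headerProg m ⨾ sampleLoop m ⨾ moveBy id IR IL ⨾ endProg m
passProg m = while IR is-just (sampleProg m)

sampleΓ-length : ∀ {n} (E : Graph n) l → length (sampleΓ (E , l)) ≡ 2 + length (edgesΓ E)
sampleΓ-length E l = cong suc (trans (List.length-++ (edgesΓ E)) (+-comm (length (edgesΓ E)) 1))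

sample-run : ∀ {n} m r x (s : Search n) il ir → length (P s) + length (sampleΓ x) ≤ r →
  Within n (sampleProg m) (stack il (sampleΓ x ++ ir) s) (stack (sampleΓ x ʳ++ il) ir (runSample m x s))
         (8 + length (edgesΓ (proj₁ x)) * symbolCost r)
sample-run {n} m r (E , l) s@(search X P gl gr d f) il ir le =
  at-most (≤-reflexive (reorder (length (edgesΓ E) * symbolCost r)))
  (case-within refl (short pop ▸ short push ▸ raise-DS d (l xor m)) ▸
   before (cong (λ z → stack (bit l ∷ il) z s₀) (List.++-assoc (edgesΓ E) (`$ ∷ []) ir))
     (edges-run m r E s₀ (bit l ∷ il) ir
       (≤-trans (+-monoʳ-≤ (length P) (≤-trans (edges-length E) (≤-trans (m≤n+m _ 2) (≤-reflexive (sym (sampleΓ-length E l)))))) le)) ▸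
   short (moveBy-run refl) ▸
   after (cong (λ z → stack z ir (runSample m (E , l) s)) (sym (List.++-ʳ++ (edgesΓ E))))
     (end-run m (runEdges m E s₀) (`$ ∷ (edgesΓ E ʳ++ (bit l ∷ il))) ir))
  where
  s₀ = enter (l xor m) s
  reorder : ∀ z → 4 + ((z + 1) + (1 + 2)) ≡ 8 + z
  reorder = solve-∀

finish-rows : ∀ {n} m (s : Search n) → P (finish m s) ≡ P s
finish-rows true  s = refl
finish-rows false s = refl

runSample-rows : ∀ {n} m x (s : Search n) → length (P (runSample m x s)) ≤ length (P s) + length (sampleΓ x)
runSample-rows m (E , l) s@(search X P gl gr d f) rewrite finish-rows m (runEdges m E (enter (l xor m) s)) =
  ≤-trans (runEdges-rows m E (enter (l xor m) s)) (+-monoʳ-≤ (length P)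
    (≤-trans (edges-length E) (≤-trans (m≤n+m _ 2) (≤-reflexive (sym (sampleΓ-length E l))))))

runPass-rows : ∀ {n} m ss (s : Search n) → length (P (runPass m ss s)) ≤ length (P s) + length (samplesΓ ss)
runPass-rows m []       s = m≤m+n _ 0
runPass-rows m (x ∷ ss) s = ≤-trans (runPass-rows m ss (runSample m x s))
  (≤-trans (+-monoˡ-≤ _ (runSample-rows m x s)) (≤-reflexive (trans (+-assoc (length (P s)) _ _) (cong (length (P s) +_) (sym (List.length-++ (sampleΓ x)))))))

pass-run : ∀ {n} m r ss (s : Search n) il → length (P s) + length (samplesΓ ss) ≤ r →
  Within n (passProg m) (stack il (samplesΓ ss) s) (stack (samplesΓ ss ʳ++ il) [] (runPass m ss s))
         (length (samplesΓ ss) * symbolCost r + 1)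
pass-run m r []       s il le = short (leave refl)
pass-run m r (x@(E , l) ∷ ss) s il le =
  at-most cost (loop-within refl (sample-run m r x s il (samplesΓ ss) (≤-trans (+-monoʳ-≤ _ (≤-trans (m≤m+n _ _) (≤-reflexive (sym split)))) le))
    (after (cong (λ z → stack z [] (runPass m (x ∷ ss) s)) (sym (List.++-ʳ++ (sampleΓ x))))
      (pass-run m r ss (runSample m x s) (sampleΓ x ʳ++ il)
        (≤-trans (+-monoˡ-≤ _ (runSample-rows m x s)) (≤-trans (≤-reflexive (trans (+-assoc (length (P s)) _ _) (cong (length (P s) +_) (sym split)))) le)))))
  where
  open ≤-Reasoning
  q = symbolCost r
  split : length (samplesΓ (x ∷ ss)) ≡ length (sampleΓ x) + length (samplesΓ ss)
  split = List.length-++ (sampleΓ x)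
  e = length (edgesΓ E)
  z = length (samplesΓ ss)
  cost : 1 + ((8 + e * q) + (z * q + 1)) ≤ length (samplesΓ (x ∷ ss)) * q + 1
  cost = begin
    1 + ((8 + e * q) + (z * q + 1)) ≡⟨ reorder (e * q) (z * q) ⟩
    9 + e * q + z * q + 1           ≤⟨ +-monoˡ-≤ 1 (+-monoˡ-≤ (z * q) (+-monoˡ-≤ (e * q) (≤-trans (≤ᵇ⇒≤ 9 30 _) (≤-trans (m≤n+m 30 (r * 12)) (m≤m+n q _))))) ⟩
    (q + (q + 0)) + e * q + z * q + 1     ≡⟨ refold q e z ⟩
    (2 + e + z) * q + 1             ≡⟨ cong (λ y → (y + z) * q + 1) (sym (sampleΓ-length E l)) ⟩
    (length (sampleΓ x) + z) * q + 1 ≡⟨ cong (λ y → y * q + 1) (sym split) ⟩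
    length (samplesΓ (x ∷ ss)) * q + 1 ∎
    where
    reorder : ∀ a b → 1 + ((8 + a) + (b + 1)) ≡ 9 + a + b + 1
    reorder = solve-∀
    refold : ∀ q e z → (q + (q + 0)) + e * q + z * q + 1 ≡ (2 + e + z) * q + 1
    refold = solve-∀

-- One complete attempt.

-- An invariant of the search: moving `GL` back onto `GR` restores the sequence of guesses exactly,
-- so that it can serve as a counter.
guesses : ∀ {n} → Search n → List Bool
guesses s = gl s ʳ++ gr s

resolve-guesses : ∀ {n} m c y (X : Cells n) v P gl gr d f → guesses (resolve m c y X v P gl gr d f) ≡ gl ʳ++ gr
resolve-guesses m     c (e , true)  X v P gl gr       d f = refl
resolve-guesses true  c (e , false) X v P gl gr       d f = refl
resolve-guesses false c (e , false) X v P gl []       d f = refl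
resolve-guesses false c (e , false) X v P gl (b ∷ gr) d f = refl

runEdges-guesses : ∀ {n} m E (s : Search n) → guesses (runEdges m E s) ≡ guesses s
runEdges-guesses m []            s = refl
runEdges-guesses m ((u , v) ∷ E) (search X P gl gr true f) = refl
runEdges-guesses m ((u , v) ∷ E) s@(search X P gl gr false f) =
  trans (runEdges-guesses m E (edgeStep m u v s)) (resolve-guesses m _ (lookup (component P X u) v) _ v P gl gr false f)

runPass-guesses : ∀ {n} m ss (s : Search n) → guesses (runPass m ss s) ≡ guesses s
runPass-guesses m []             s = refl
runPass-guesses m ((E , l) ∷ ss) s = trans (runPass-guesses m ss (runSample m (E , l) s))
  (trans (finish-guesses m (runEdges m E (enter (l xor m) s))) (runEdges-guesses m E (enter (l xor m) s)))
  where
  finish-guesses : ∀ m s → guesses (finish m s) ≡ guesses s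
  finish-guesses true  s = refl
  finish-guesses false s = refl

runPass-open : ∀ {n} m ss (s : Search n) → d s ≡ false → d (runPass m ss s) ≡ false
runPass-open m []             s e = e
runPass-open m ((E , l) ∷ ss) s e = runPass-open m ss (runSample m (E , l) s) (finish-open m (runEdges m E (enter (l xor m) s)))
  where
  finish-open : ∀ m s → d (finish m s) ≡ false
  finish-open true  s = refl
  finish-open false s = refl

clear : Fin 11 → Prog
clear i = while i is-just (pop i)

clear-run : ∀ {i} (c : List Γ → State) → (∀ x → top (c x) i ≡ List.head x) → (∀ a x → c (a ∷ x) [ i ]%= List.drop 1 ≡ c x) →
            ∀ x → Run (clear i) (c x) (c []) (length x * 2 + 1)
clear-run c t e []      = leave (cong is-just (t []))
clear-run c t e (a ∷ x) = loop (cong is-just (t (a ∷ x))) (into (e a x) pop) (clear-run c t e x)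

attemptProg : Prog
attemptProg = sweep (λ _ → `0) ⨾ passProg true ⨾ moveAll IL IR ⨾ passProg false ⨾ moveAll IL IR ⨾ moveAll GL GR ⨾ clear AR

attemptCost : ℕ → ℕ → ℕ
attemptCost N B = 2 + ((N * symbolCost (N + N) + 1) + ((N * 5 + 1) + ((N * symbolCost (N + N) + 1) + ((N * 5 + 1) + ((B * 5 + 1) + (N + N + 1))))))

idle : ∀ {n} → List Γ → Cells n → List Bool → Bool → State
idle w X g f = st [] w [] (toList X) [] [] [] (List.map bit g) [] [] (tok f)

attempt-run : ∀ {n} (ss : List (Sample n)) g X₀ →
  Within n attemptProg (idle (samplesΓ ss) X₀ g false)
         (idle (samplesΓ ss) (X (attempt ss g)) g (f (attempt ss g))) (attemptCost (length (samplesΓ ss)) (length g))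
attempt-run {n} ss g X₀ =
  after (cong (λ z → stack [] w (search z [] [] g false false)) (map-zero X₀)) (sweep-run X₀) ▸
  pass-run true (N + N) ss s₀ [] (m≤n+m N N) ▸
  rewound s₁ ▸
  pass-run false (N + N) ss s₁ [] (+-monoˡ-≤ N (runPass-rows true ss s₀)) ▸
  rewound s₂ ▸
  guesses-back ▸
  cleared
  where
  w = samplesΓ ss
  N = length w
  s₀ = initialSearch g
  s₁ = runPass true ss s₀
  s₂ = attempt ss g

  map-zero : ∀ {n} (X : Cells n) → Vec.map (λ _ → `0) X ≡ Vec.replicate n `0
  map-zero []      = refl
  map-zero (x ∷ X) = cong (`0 ∷_) (map-zero X)

  rewound : ∀ s → Within n (moveAll IL IR) (stack (w ʳ++ []) [] s) (stack [] w s) (N * 5 + 1)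
  rewound s = after (cong (λ z → stack [] z s) (restore-all w)) (at-most (≤-reflexive (cong (λ z → z * 5 + 1) (length-ʳ++[] w)))
    (counted (moveAll-run (λ x y → stack x y s) (λ _ _ → refl) (λ _ _ _ _ → refl) (w ʳ++ []) [])))

  kept : guesses s₂ ≡ g
  kept = trans (runPass-guesses false ss s₁) (runPass-guesses true ss s₀)

  gl-length : length (List.map bit (gl s₂)) ≤ length g
  gl-length = ≤-trans (≤-reflexive (List.length-map bit (gl s₂))) (≤-trans (m≤m+n _ (length (gr s₂)))
    (≤-reflexive (trans (sym (List.length-ʳ++ (gl s₂))) (cong length kept))))

  guesses-back : Within n (moveAll GL GR) (stack [] w s₂)
    (st [] w [] (toList (X s₂)) [] (rows (P s₂)) [] (List.map bit g) [] [] (tok (f s₂))) (length g * 5 + 1)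
  guesses-back = after (cong₂ (λ y z → st [] w [] (toList (X s₂)) [] (rows (P s₂)) [] y [] (tok z) (tok (f s₂)))
      (trans (sym (List.map-ʳ++ bit (gl s₂))) (cong (List.map bit) kept)) (runPass-open false ss s₁ (runPass-open true ss s₀ refl)))
    (at-most (+-monoˡ-≤ 1 (*-monoˡ-≤ 5 gl-length))
      (counted (moveAll-run (λ x y → st [] w [] (toList (X s₂)) [] (rows (P s₂)) x y [] (tok (d s₂)) (tok (f s₂))) (λ _ _ → refl) (λ _ _ _ _ → refl)
        (List.map bit (gl s₂)) (List.map bit (gr s₂)))))

  rows≤ : length (P s₂) ≤ N + N
  rows≤ = ≤-trans (runPass-rows false ss s₁) (+-monoˡ-≤ N (runPass-rows true ss s₀))

  open ≤-Reasoning
  cleared : Within n (clear AR) (st [] w [] (toList (X s₂)) [] (rows (P s₂)) [] (List.map bit g) [] [] (tok (f s₂)))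
    (idle w (X s₂) g (f s₂)) (N + N + 1)
  cleared = within (weaken (begin
    length (rows (P s₂)) * 2 + 1 ≡⟨ cong (λ z → z * 2 + 1) (rows-length (P s₂)) ⟩
    length (P s₂) * n * 2 + 1    ≡⟨ cong (_+ 1) (*-assoc (length (P s₂)) n 2) ⟩
    length (P s₂) * (n * 2) + 1  ≤⟨ +-mono-≤ (*-mono-≤ rows≤ (≤-trans (*-monoʳ-≤ n (≤ᵇ⇒≤ 2 12 _)) (m≤m+n _ 12))) (unit-pos n) ⟩
    (N + N) * unit n + unit n    ≡⟨ refold (N + N) (unit n) ⟩
    (N + N + 1) * unit n         ∎)
    (clear-run (λ x → st [] w [] (toList (X s₂)) [] x [] (List.map bit g) [] [] (tok (f s₂))) (λ _ → refl) (λ _ _ → refl) (rows (P s₂))))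
    where
    refold : ∀ a q → a * q + q ≡ (a + 1) * q
    refold = solve-∀

-- Enumeration of the guesses

-- The number of increments before the counter, with the least significant bit first, overflows.
remaining : List Bool → ℕ
remaining []          = 0
remaining (true ∷ g)  = 2 * remaining g
remaining (false ∷ g) = suc (2 * remaining g)

remaining-injective : ∀ g h → length g ≡ length h → remaining g ≡ remaining h → g ≡ h
remaining-injective []          []          _ _ = refl
remaining-injective (true ∷ g)  (true ∷ h)  l e = cong (true ∷_) (remaining-injective g h (suc-injective l) (*-cancelˡ-≡ _ _ 2 e))
remaining-injective (false ∷ g) (false ∷ h) l e = cong (false ∷_) (remaining-injective g h (suc-injective l) (*-cancelˡ-≡ _ _ 2 (suc-injective e)))
remaining-injective (true ∷ g)  (false ∷ h) l e = contradiction e (even≢odd (remaining g) (remaining h))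
remaining-injective (false ∷ g) (true ∷ h)  l e = contradiction (sym e) (even≢odd (remaining h) (remaining g))

remaining-< : ∀ g → remaining g < 2 ^ length g
remaining-< []          = s≤s z≤n
remaining-< (true ∷ g)  = *-monoʳ-< 2 (remaining-< g)
remaining-< (false ∷ g) = ≤-trans (≤-reflexive (double (remaining g))) (*-monoʳ-≤ 2 (remaining-< g))
  where
  double : ∀ r → suc (suc (2 * r)) ≡ 2 * suc r
  double = solve-∀

remaining-first : ∀ b → suc (remaining (replicate b false)) ≡ 2 ^ b
remaining-first zero    = refl
remaining-first (suc b) = trans (double (remaining (replicate b false))) (cong (2 *_) (remaining-first b))
  where
  double : ∀ r → suc (suc (2 * r)) ≡ 2 * suc r
  double = solve-∀

data Increment : List Bool → Set where
  carry    : ∀ k g → Increment (replicate k true ++ false ∷ g)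
  overflow : ∀ k → Increment (replicate k true)

increment : ∀ g → Increment g
increment []          = overflow 0
increment (false ∷ g) = carry 0 g
increment (true ∷ g)  with increment g
... | carry k h  = carry (suc k) h
... | overflow k = overflow (suc k)

remaining-carry : ∀ k g → remaining (replicate k true ++ false ∷ g) ≡ suc (remaining (replicate k false ++ true ∷ g))
remaining-carry zero    g = refl
remaining-carry (suc k) g = trans (cong (2 *_) (remaining-carry k g)) (double (remaining (replicate k false ++ true ∷ g)))
  where
  double : ∀ r → 2 * suc r ≡ suc (suc (2 * r))
  double = solve-∀

remaining-overflow : ∀ k → remaining (replicate k true) ≡ 0
remaining-overflow zero    = refl
remaining-overflow (suc k) = cong (2 *_) (remaining-overflow k)

carry-length : ∀ k {g} → length (replicate k true ++ false ∷ g) ≡ length (replicate k false ++ true ∷ g)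
carry-length zero    = refl
carry-length (suc k) = cong suc (carry-length k)

-- Binary increment with the least significant bit on top of `GR`: leading ones become zeros and the
-- next zero becomes a one. If no bit is left, all sequences have failed and the answer is the
-- symbol #.
carryProg retryProg : Prog
carryProg = while GR is-1 (pop GR ⨾ push GL `0)
retryProg = while FS is-just (pop FS ⨾ carryProg ⨾
  ifTop GR is-just (pop GR ⨾ push GR `1 ⨾ moveAll GL GR ⨾ attemptProg) (clear XR ⨾ push XR `#))

module _ {w xr : List Γ} where

  carry-run : ∀ k g gl → Run carryProg (st [] w [] xr [] [] gl (List.map bit (replicate k true ++ false ∷ g)) [] [] [])
    (st [] w [] xr [] [] (replicate k `0 ʳ++ gl) (`0 ∷ List.map bit g) [] [] []) (k * 3 + 1)
  carry-run zero    g gl = leave refl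
  carry-run (suc k) g gl = loop refl (pop ⨾ push) (carry-run k g (`0 ∷ gl))

  overflow-run : ∀ k gl → Run carryProg (st [] w [] xr [] [] gl (List.map bit (replicate k true)) [] [] [])
    (st [] w [] xr [] [] (replicate k `0 ʳ++ gl) [] [] [] []) (k * 3 + 1)
  overflow-run zero    gl = leave refl
  overflow-run (suc k) gl = loop refl (pop ⨾ push) (overflow-run k (`0 ∷ gl))

replicate-bits : ∀ k g → (replicate k `0 ʳ++ []) ʳ++ (`1 ∷ List.map bit g) ≡ List.map bit (replicate k false ++ true ∷ g)
replicate-bits k g = trans (restore (replicate k `0) (`1 ∷ List.map bit g)) (go k)
  where
  go : ∀ k → replicate k `0 ++ `1 ∷ List.map bit g ≡ List.map bit (replicate k false ++ true ∷ g)
  go zero    = refl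
  go (suc k) = cong (`0 ∷_) (go k)

replicate-length : ∀ k (y : List Bool) {b : Bool} → k ≤ length (replicate k b ++ y)
replicate-length zero    y = z≤n
replicate-length (suc k) y = s≤s (replicate-length k y)

Answer : ∀ {n} → List (Sample n) → List Γ → Set
Answer {n} ss o =
  (Σ (Cells n) λ X → o ≡ toList X × Clear X × PosSat ss (color X) × NegSat ss (color X))
  ⊎ (o ≡ `# ∷ [] × (∀ Y → PosSat ss Y → ¬ NegSat ss Y))

roundCost : ℕ → ℕ → ℕ
roundCost N B = 1 + (1 + ((B * 3 + 1) + (1 + (1 + (1 + ((B * 5 + 1) + attemptCost N B))))))

module _ {n : ℕ} (ss : List (Sample n)) where
  private
    w : List Γ
    w = samplesΓ ss
    N B : ℕ
    N = length w
    B = triangle (negCount ss)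

  -- The last hypothesis is the loop invariant: all sequences earlier in the enumeration have
  -- failed. On overflow `k` is 0, hence every sequence of length `B` has failed, and
  -- `attempt-complete` excludes a solution.
  retry-run : ∀ k g → length g ≡ B → remaining g ≡ k → (∀ h → length h ≡ B → k < remaining h → f (attempt ss h) ≡ true) →
    Σ (List Γ) λ o → Answer ss o × ∃ λ gl → ∃ λ gr →
    Within n retryProg (idle w (X (attempt ss g)) g (f (attempt ss g))) (st [] w [] o [] [] gl gr [] [] []) (suc k * roundCost N B)
  retry-run k g lg rg failed with f (attempt ss g) in eq
  ... | false = toList (X (attempt ss g)) ,
    inj₁ (X (attempt ss g) , refl , attempt-clear ss g , attempt-sound ss g eq) , [] , List.map bit g ,
    at-most (s≤s z≤n) (short (leave refl))
  ... | true with increment g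
  retry-run k .(replicate j true) lg rg failed | true | overflow j =
    `# ∷ [] , inj₂ (refl , hopeless) , replicate j `0 ʳ++ [] , [] ,
    at-most (≤-trans (≤-reflexive (cong suc (+-comm _ 1))) (≤-trans cost (m≤m+n (roundCost N B) _)))
      (loop-within refl (short pop ▸ counted (overflow-run j []) ▸
        if-no-within refl (pass (length (toList x)) 2 1 (≤-reflexive (length-toList x))
          (clear-run (λ z → st [] w [] z [] [] (replicate j `0 ʳ++ []) [] [] [] []) (λ _ → refl) (λ _ _ → refl) (toList x)) ▸ short push))
        (short (leave refl)))
    where
    x = X (attempt ss (replicate j true))
    j≤B : j ≤ B
    j≤B = ≤-reflexive (trans (sym (List.length-replicate j)) lg)
    cost : suc (1 + (1 + ((j * 3 + 1) + (1 + (1 + 1))))) ≤ roundCost N B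
    cost = s≤s (s≤s (≤-trans (≤-reflexive (reorder (j * 3))) (+-mono-≤ (+-monoˡ-≤ 1 (*-monoˡ-≤ 3 j≤B)) (s≤s (s≤s (s≤s (≤-trans (s≤s z≤n) (m≤n+m _ (B * 5 + 1)))))))))
      where
      reorder : ∀ z → 1 + ((z + 1) + (1 + (1 + 1))) ≡ (z + 1) + (1 + (1 + (1 + 1)))
      reorder = solve-∀
    hopeless : ∀ Y → PosSat ss Y → ¬ NegSat ss Y
    hopeless Y pos neg with attempt-complete ss Y pos neg
    ... | h , lh , ok = contradiction ok (true≢false (visited (remaining h ≟ 0)))
      where
      k≡0 : k ≡ 0
      k≡0 = trans (sym rg) (remaining-overflow j)
      visited : Dec (remaining h ≡ 0) → f (attempt ss h) ≡ true
      visited (yes z) = trans (cong (λ y → f (attempt ss y)) (remaining-injective h (replicate j true) (trans lh (sym lg)) (trans z (sym (remaining-overflow j))))) eq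
      visited (no nz) = failed h lh (subst (_< remaining h) (sym k≡0) (n≢0⇒n>0 nz))
  retry-run zero .(replicate j true ++ false ∷ g') lg rg failed | true | carry j g' = contradiction (trans (sym (remaining-carry j g')) rg) λ ()
  retry-run (suc k) .(replicate j true ++ false ∷ g') lg rg failed | true | carry j g' =
    let o , ans , gl , gr , r = retry-run k g₁ lg₁ rg₁ failed₁ in o , ans , gl , gr ,
    at-most (+-monoˡ-≤ (suc k * roundCost N B) cost)
      (loop-within refl (short pop ▸ counted (carry-run j g' []) ▸
        if-yes-within refl (short pop ▸ short push ▸
          after (cong (λ z → st [] w [] (toList x) [] [] [] z [] [] []) (replicate-bits j g'))
            (at-most (≤-reflexive (cong (λ z → z * 5 + 1) (trans (length-ʳ++[] (replicate j `0)) (List.length-replicate j))))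
              (counted (moveAll-run (λ y z → st [] w [] (toList x) [] [] y z [] [] []) (λ _ _ → refl) (λ _ _ _ _ → refl) (replicate j `0 ʳ++ []) (`1 ∷ List.map bit g')))) ▸
          attempt-run ss g₁ x))
        r)
    where
    g₀ = replicate j true ++ false ∷ g'
    g₁ = replicate j false ++ true ∷ g'
    x = X (attempt ss g₀)
    lg₁ : length g₁ ≡ B
    lg₁ = trans (sym (carry-length j)) lg
    rg₁ : remaining g₁ ≡ k
    rg₁ = suc-injective (trans (sym (remaining-carry j g')) rg)
    failed₁ : ∀ h → length h ≡ B → k < remaining h → f (attempt ss h) ≡ true
    failed₁ h lh lt with remaining h ≟ suc k
    ... | yes e = trans (cong (λ y → f (attempt ss y)) (remaining-injective h g₀ (trans lh (sym lg)) (trans e (sym rg)))) eq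
    ... | no ne = failed h lh (≤∧≢⇒< lt (ne ∘ sym))
    j≤B : j ≤ B
    j≤B = ≤-trans (replicate-length j (false ∷ g')) (≤-reflexive lg)
    cost : 1 + (1 + ((j * 3 + 1) + (1 + (1 + (1 + ((j * 5 + 1) + attemptCost N (length g₁))))))) ≤ roundCost N B
    cost rewrite lg₁ = s≤s (s≤s (+-mono-≤ (+-monoˡ-≤ 1 (*-monoˡ-≤ 3 j≤B)) (s≤s (s≤s (s≤s (+-monoˡ-≤ _ (+-monoˡ-≤ 1 (*-monoˡ-≤ 5 j≤B))))))))

-- Initialisation

instanceΓ : Instance → List Γ
instanceΓ I = unaryΓ (Instance.n I) ++ samplesΓ (Instance.samples I)

is-0 : Γ → Bool
is-0 `0 = true
is-0 _  = false

-- Vertices are written in unary with the symbol 1, so the symbol 0 occurs only as the label of a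
-- negative sample, and counting it yields the parameter.
zeros : List Γ → ℕ
zeros []      = 0
zeros (a ∷ l) = (if is-0 a then 1 else 0) + zeros l

zeros-++ : ∀ l r → zeros (l ++ r) ≡ zeros l + zeros r
zeros-++ []      r = refl
zeros-++ (a ∷ l) r = trans (cong (_ +_) (zeros-++ l r)) (sym (+-assoc (if is-0 a then 1 else 0) (zeros l) (zeros r)))

zeros-unaryΓ : ∀ m → zeros (unaryΓ m) ≡ 0
zeros-unaryΓ zero    = refl
zeros-unaryΓ (suc m) = zeros-unaryΓ m

zeros-edges : ∀ {n} (E : Graph n) → zeros (edgesΓ E) ≡ 0
zeros-edges []            = refl
zeros-edges ((u , v) ∷ E) = trans (zeros-++ (edgeΓ (u , v)) (edgesΓ E))
  (cong₂ _+_ (trans (zeros-++ (unaryΓ (toℕ u)) (unaryΓ (toℕ v))) (cong₂ _+_ (zeros-unaryΓ (toℕ u)) (zeros-unaryΓ (toℕ v)))) (zeros-edges E))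

zeros-samples : ∀ {n} (ss : List (Sample n)) → zeros (samplesΓ ss) ≡ negCount ss
zeros-samples []             = refl
zeros-samples ((E , l) ∷ ss) = trans (zeros-++ (sampleΓ (E , l)) (samplesΓ ss)) (header l)
  where
  body : zeros (edgesΓ E ++ `$ ∷ []) ≡ 0
  body = trans (zeros-++ (edgesΓ E) (`$ ∷ [])) (trans (+-identityʳ _) (zeros-edges E))
  header : ∀ l → zeros (sampleΓ (E , l)) + zeros (samplesΓ ss) ≡ negCount ((E , l) ∷ ss)
  header true  = cong₂ _+_ body (zeros-samples ss)
  header false = cong₂ (λ a b → suc a + b) body (zeros-samples ss)

zeros-instance : ∀ I → zeros (instanceΓ I) ≡ t⁻ I
zeros-instance I = trans (zeros-++ (unaryΓ (Instance.n I)) (samplesΓ (Instance.samples I)))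
  (cong₂ _+_ (zeros-unaryΓ (Instance.n I)) (zeros-samples (Instance.samples I)))

-- `AL` holds one token per negative sample seen. Each new sample adds a token and then two guesses
-- per token, which is the recursion of `triangle`; the guesses start as zeros.
tokensProg countProg readProg initProg : Prog
tokensProg = push AL `0 ⨾ while AL is-just (moveBy id AL AR ⨾ push GR `0 ⨾ push GR `0) ⨾ moveAll AR AL
countProg = while IR is-just (case IR λ a → pop IR ⨾ push IL a ⨾ when (is-0 a) tokensProg)
readProg = while IR is-1 (pop IR ⨾ push XR `0)
initProg = moveAll IL IR ⨾ countProg ⨾ clear AL ⨾ moveAll IL IR ⨾ readProg ⨾ pop IR

replicate-ʳ++ : ∀ {A : Set} (a : A) k l → replicate k a ʳ++ l ≡ replicate k a ++ l
replicate-ʳ++ a zero    l = refl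
replicate-ʳ++ a (suc k) l = trans (replicate-ʳ++ a k (a ∷ l)) (rotate k)
  where
  rotate : ∀ k → replicate k a ++ a ∷ l ≡ a ∷ (replicate k a ++ l)
  rotate zero    = refl
  rotate (suc k) = cong (a ∷_) (rotate k)

tokens-run : ∀ {il ir} j → Run tokensProg (st il ir [] [] (replicate j `0) [] [] (replicate (triangle j) `0) [] [] [])
  (st il ir [] [] (replicate (suc j) `0) [] [] (replicate (triangle (suc j)) `0) [] [] []) (1 + ((suc j * 7 + 1) + (suc j * 5 + 1)))
tokens-run {il} {ir} j = push ⨾ into spread (double (suc j) [] (replicate (triangle j) `0)) ⨾
  into (cong (λ z → st il ir [] [] z [] [] (replicate (triangle (suc j)) `0) [] [] []) gathered)
    (weaken (≤-reflexive (cong (λ z → z * 5 + 1) (List.length-replicate (suc j))))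
      (moveAll-run (λ x y → st il ir [] [] y x [] (replicate (triangle (suc j)) `0) [] [] []) (λ _ _ → refl) (λ _ _ _ _ → refl) (replicate (suc j) `0) []))
  where
  double : ∀ k ar gr → Run (while AL is-just (moveBy id AL AR ⨾ push GR `0 ⨾ push GR `0))
    (st il ir [] [] (replicate k `0) ar [] gr [] [] []) (st il ir [] [] [] (replicate k `0 ʳ++ ar) [] (replicate (k * 2) `0 ʳ++ gr) [] [] []) (k * 7 + 1)
  double zero    ar gr = leave refl
  double (suc k) ar gr = loop refl (moveBy-run refl ⨾ push ⨾ push) (double k (`0 ∷ ar) (`0 ∷ `0 ∷ gr))
  gathered : replicate (suc j) `0 ʳ++ [] ≡ replicate (suc j) `0
  gathered = trans (replicate-ʳ++ `0 (suc j) []) (List.++-identityʳ _)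
  replicate-+ : ∀ a b → replicate {A = Γ} a `0 ++ replicate b `0 ≡ replicate (a + b) `0
  replicate-+ zero    b = refl
  replicate-+ (suc a) b = cong (`0 ∷_) (replicate-+ a b)
  spread : st il ir [] [] [] (replicate (suc j) `0 ʳ++ []) [] (replicate (suc j * 2) `0 ʳ++ replicate (triangle j) `0) [] [] []
         ≡ st il ir [] [] [] (replicate (suc j) `0) [] (replicate (triangle (suc j)) `0) [] [] []
  spread = cong₂ (λ y z → st il ir [] [] [] y [] z [] [] []) gathered
    (trans (replicate-ʳ++ `0 (suc j * 2) _) (replicate-+ (suc j * 2) (triangle j)))

count-run : ∀ t l il j → zeros l + j ≡ t → Run countProg (st il l [] [] (replicate j `0) [] [] (replicate (triangle j) `0) [] [] [])
  (st (l ʳ++ il) [] [] [] (replicate t `0) [] [] (replicate (triangle t) `0) [] [] []) (length l * (t * 12 + 8) + 1)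
count-run t []      il j refl = leave refl
count-run t (a ∷ l) il j e = weaken bound (loop refl (case refl (pop ⨾ push ⨾ tokens a e)) (count-run t l (a ∷ il) _ (next a e)))
  where
  weight : Γ → ℕ
  weight a = if is-0 a then 1 else 0
  next : ∀ a → zeros (a ∷ l) + j ≡ t → zeros l + (weight a + j) ≡ t
  next a e = trans (trans (sym (+-assoc (zeros l) (weight a) j)) (cong (_+ j) (+-comm (zeros l) (weight a)))) e
  tokens : ∀ a → zeros (a ∷ l) + j ≡ t → Run (when (is-0 a) tokensProg) (st (a ∷ il) l [] [] (replicate j `0) [] [] (replicate (triangle j) `0) [] [] [])
    (st (a ∷ il) l [] [] (replicate (weight a + j) `0) [] [] (replicate (triangle (weight a + j)) `0) [] [] []) (t * 12 + 3)
  tokens `0 e = weaken (≤-trans (≤-reflexive (reorder (suc j))) (+-monoˡ-≤ 3 (*-monoˡ-≤ 12 (≤-trans (s≤s (m≤n+m j (zeros l))) (≤-reflexive e))))) (tokens-run j)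
    where
    reorder : ∀ k → 1 + ((k * 7 + 1) + (k * 5 + 1)) ≡ k * 12 + 3
    reorder = solve-∀
  tokens `1 e = weaken (≤-trans (s≤s z≤n) (m≤n+m 3 (t * 12))) skip
  tokens `# e = weaken (≤-trans (s≤s z≤n) (m≤n+m 3 (t * 12))) skip
  tokens `$ e = weaken (≤-trans (s≤s z≤n) (m≤n+m 3 (t * 12))) skip
  bound : suc (2 + (1 + (1 + (t * 12 + 3))) + (length l * (t * 12 + 8) + 1)) ≤ length (a ∷ l) * (t * 12 + 8) + 1
  bound = ≤-reflexive (reorder (t * 12) (length l * (t * 12 + 8)))
    where
    reorder : ∀ x y → suc (2 + (1 + (1 + (x + 3))) + (y + 1)) ≡ x + 8 + y + 1
    reorder = solve-∀

initCost : ℕ → ℕ → ℕ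
initCost t N = (N * 5 + 1) + ((N * (t * 12 + 8) + 1) + ((t * 2 + 1) + ((N * 5 + 1) + ((N * 3 + 1) + 1))))

open StackMachine 10 using (start; symbol; stackMachine; stackMachine-halts; machineCost)

init-run : ∀ I → let w = instanceΓ I in
  Run initProg (start w) (idle (samplesΓ (Instance.samples I)) (Vec.replicate (Instance.n I) `0) (replicate (triangle (t⁻ I)) false) false) (initCost (t⁻ I) (length w))
init-run I =
  rewound [] [] ⨾
  count-run t w [] 0 (trans (+-identityʳ _) (zeros-instance I)) ⨾
  weaken (≤-reflexive (cong (λ z → z * 2 + 1) (List.length-replicate t)))
    (clear-run (λ x → st (w ʳ++ []) [] [] [] x [] [] (replicate (triangle t) `0) [] [] []) (λ _ → refl) (λ _ _ → refl) (replicate t `0)) ⨾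
  rewound [] (replicate (triangle t) `0) ⨾
  weaken (+-monoˡ-≤ 1 (*-monoˡ-≤ 3 n≤)) (read n []) ⨾
  into (cong₂ (λ y z → st [] (samplesΓ ss) [] y [] [] [] z [] [] []) (vertices n) (sym (List.map-replicate bit (triangle t) false))) pop
  where
  w = instanceΓ I
  t = t⁻ I
  n = Instance.n I
  ss = Instance.samples I
  rewound : ∀ al gr → Run (moveAll IL IR) (st (w ʳ++ []) [] [] [] al [] [] gr [] [] []) (st [] w [] [] al [] [] gr [] [] []) (length w * 5 + 1)
  rewound al gr = into (cong (λ z → st [] z [] [] al [] [] gr [] [] []) (restore-all w)) (weaken (≤-reflexive (cong (λ z → z * 5 + 1) (length-ʳ++[] w)))
    (moveAll-run (λ x y → st x y [] [] al [] [] gr [] [] []) (λ _ _ → refl) (λ _ _ _ _ → refl) (w ʳ++ []) []))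
  n≤ : n ≤ length w
  n≤ = go n
    where
    go : ∀ k → k ≤ length (unaryΓ k ++ samplesΓ ss)
    go zero    = z≤n
    go (suc k) = s≤s (go k)
  read : ∀ k xr → Run readProg (st [] (unaryΓ k ++ samplesΓ ss) [] xr [] [] [] (replicate (triangle t) `0) [] [] [])
    (st [] (`# ∷ samplesΓ ss) [] (replicate k `0 ʳ++ xr) [] [] [] (replicate (triangle t) `0) [] [] []) (k * 3 + 1)
  read zero    xr = leave refl
  read (suc k) xr = loop refl (pop ⨾ push) (read k (`0 ∷ xr))
  vertices : ∀ k → replicate k `0 ʳ++ [] ≡ toList (Vec.replicate k `0)
  vertices k = trans (replicate-ʳ++ `0 k []) (trans (List.++-identityʳ _) (go k))
    where
    go : ∀ k → replicate k `0 ≡ toList (Vec.replicate k `0)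
    go zero    = refl
    go (suc k) = cong (`0 ∷_) (go k)

-- The whole program.

-- The last move reverses the answer, since the output is emitted from the bottom of its stack.
mainProg : Prog
mainProg = initProg ⨾ attemptProg ⨾ retryProg ⨾ moveAll XR XL

mainCost : ℕ → ℕ → ℕ
mainCost t N = initCost t N + (attemptCost N (triangle t) * unit N + ((2 ^ triangle t * roundCost N (triangle t)) * unit N + ((1 + N) * 5 + 1)))

attemptCost-mono : ∀ {N N'} B → N ≤ N' → attemptCost N B ≤ attemptCost N' B
attemptCost-mono {N} {N'} B le = s≤s (s≤s (+-mono-≤ once (+-mono-≤ back (+-mono-≤ once (+-mono-≤ back (+-monoʳ-≤ (B * 5 + 1) (+-monoˡ-≤ 1 (+-mono-≤ le le))))))))
  where
  once : N * symbolCost (N + N) + 1 ≤ N' * symbolCost (N' + N') + 1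
  once = +-monoˡ-≤ 1 (*-mono-≤ le (+-monoˡ-≤ 30 (*-monoˡ-≤ 12 (+-mono-≤ le le))))
  back : N * 5 + 1 ≤ N' * 5 + 1
  back = +-monoˡ-≤ 1 (*-monoˡ-≤ 5 le)

roundCost-mono : ∀ {N N'} B → N ≤ N' → roundCost N B ≤ roundCost N' B
roundCost-mono B le = s≤s (s≤s (+-monoʳ-≤ (B * 3 + 1) (s≤s (s≤s (s≤s (+-monoʳ-≤ (B * 5 + 1) (attemptCost-mono B le)))))))

main-run : ∀ I → Σ (List Γ) λ o → Answer (Instance.samples I) o × ∃ λ σ → lookup σ XL ≡ o ʳ++ [] ×
           Run mainProg (start (instanceΓ I)) σ (mainCost (t⁻ I) (length (instanceΓ I)))
main-run I with retry-run (Instance.samples I) _ (replicate (triangle (t⁻ I)) false) (List.length-replicate (triangle (t⁻ I))) refl first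
  where
  first : ∀ h → length h ≡ triangle (t⁻ I) → remaining (replicate (triangle (t⁻ I)) false) < remaining h → f (attempt (Instance.samples I) h) ≡ true
  -- The all-zero counter has the largest value of `remaining` for its length, so the invariant
  -- holds vacuously at the start; that value also gives the number of rounds, 2 to the power `B`.
  first h lh lt = contradiction (remaining-< h) (≤⇒≯ (≤-trans (≤-reflexive (trans (cong (2 ^_) lh) (sym (remaining-first (triangle (t⁻ I)))))) lt))
... | o , ans , gl , gr , r = o , ans , _ , refl ,
  (init-run I ⨾
   weaken (*-mono-≤ attempt≤ unit≤) (run-within (attempt-run ss g₀ (Vec.replicate n `0))) ⨾
   weaken (*-mono-≤ (*-mono-≤ (≤-reflexive (remaining-first B)) (roundCost-mono B N≤)) unit≤) (run-within r) ⨾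
   weaken (+-monoˡ-≤ 1 (*-monoˡ-≤ 5 (o≤ ans)))
     (moveAll-run (λ x y → st [] (samplesΓ ss) y x [] [] gl gr [] [] []) (λ _ _ → refl) (λ _ _ _ _ → refl) o []))
  where
  ss = Instance.samples I
  n = Instance.n I
  B = triangle (t⁻ I)
  g₀ = replicate B false
  w = instanceΓ I
  N≤ : length (samplesΓ ss) ≤ length w
  N≤ = ≤-trans (m≤n+m _ _) (≤-reflexive (sym (List.length-++ (unaryΓ n))))
  n≤ : n ≤ length w
  n≤ = ≤-trans (≤-trans (≤-reflexive (sym (List.length-replicate n))) (≤-trans (m≤m+n _ 1) (≤-reflexive (sym (List.length-++ (replicate n `1))))))
       (≤-trans (m≤m+n _ _) (≤-reflexive (sym (List.length-++ (unaryΓ n)))))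
  unit≤ : unit n ≤ unit (length w)
  unit≤ = +-monoˡ-≤ 12 (*-monoˡ-≤ 12 n≤)
  attempt≤ : attemptCost (length (samplesΓ ss)) (length g₀) ≤ attemptCost (length w) B
  attempt≤ = ≤-trans (≤-reflexive (cong (attemptCost (length (samplesΓ ss))) (List.length-replicate B))) (attemptCost-mono B N≤)
  o≤ : ∀ {o} → Answer ss o → length o ≤ 1 + length w
  o≤ (inj₁ (X , refl , _)) = m≤n⇒m≤1+n (≤-trans (≤-reflexive (length-toList X)) n≤)
  o≤ (inj₂ (refl , _))     = s≤s z≤n

-- Correctness of the output

sat⇒consistent : ∀ {n} (ss : List (Sample n)) Y → PosSat ss Y → NegSat ss Y → All (λ s → Proper2Col Y (proj₁ s) ⇔ (proj₂ s ≡ true)) ss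
sat⇒consistent []                 Y []       []       = []
sat⇒consistent ((E , true) ∷ ss)  Y (p ∷ ps) (_ ∷ ns) =
  mk⇔ (λ _ → refl) (λ _ {_} {_} e∈E → All.lookup (p refl) e∈E) ∷ sat⇒consistent ss Y ps ns
sat⇒consistent ((E , false) ∷ ss) Y (_ ∷ ps) (m ∷ ns) =
  mk⇔ (λ proper → let _ , e∈E , eq = find (m refl) in contradiction eq (proper e∈E)) (λ ()) ∷ sat⇒consistent ss Y ps ns

-- For a negative sample consistency only refutes properness. The monochromatic edge itself comes
-- from a decidable search through the edge list.
consistent⇒sat : ∀ {n} (ss : List (Sample n)) Y → All (λ s → Proper2Col Y (proj₁ s) ⇔ (proj₂ s ≡ true)) ss → PosSat ss Y × NegSat ss Y
consistent⇒sat []             Y []       = [] , []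
consistent⇒sat ((E , l) ∷ ss) Y (c ∷ cs) with consistent⇒sat ss Y cs
... | ps , ns = (λ e → All.tabulate (λ e∈E → Equivalence.from c e e∈E)) ∷ ps , mono ∷ ns
  where
  mono : l ≡ false → MonoEdge E Y
  mono refl with any? (λ e → Y (proj₁ e) Bool.≟ Y (proj₂ e)) E
  ... | yes p = p
  ... | no ¬p = contradiction (Equivalence.to c (λ {_} {_} e∈E eq → ¬p (Any.map (λ { refl → eq }) e∈E))) λ ()

symbols : List Γ → List (Sym K)
symbols = List.map symbol

encode-unary : ∀ m → unary m ≡ symbols (unaryΓ m)
encode-unary zero    = refl
encode-unary (suc m) = cong (_ ∷_) (encode-unary m)

encode-edges : ∀ {n} (E : Graph n) → concatMap encEdge E ≡ symbols (edgesΓ E)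
encode-edges []            = refl
encode-edges ((u , v) ∷ E) = trans
  (cong₂ _++_ (trans (cong₂ _++_ (encode-unary (toℕ u)) (encode-unary (toℕ v))) (sym (List.map-++ symbol (unaryΓ (toℕ u)) (unaryΓ (toℕ v))))) (encode-edges E))
  (sym (List.map-++ symbol (edgeΓ (u , v)) (edgesΓ E)))

encode-bit : ∀ b → bitSym b ≡ symbol (bit b)
encode-bit true  = refl
encode-bit false = refl

encode-samples : ∀ {n} (ss : List (Sample n)) → concatMap encSample ss ≡ symbols (samplesΓ ss)
encode-samples []             = refl
encode-samples ((E , l) ∷ ss) = trans
  (cong₂ _++_ (cong₂ _∷_ (encode-bit l) (trans (cong (_++ sD ∷ []) (encode-edges E)) (sym (List.map-++ symbol (edgesΓ E) (`$ ∷ []))))) (encode-samples ss))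
  (sym (List.map-++ symbol (sampleΓ (E , l)) (samplesΓ ss)))

encode-instance : ∀ I → encInstance K I ≡ symbols (instanceΓ I)
encode-instance I = trans (cong₂ _++_ (encode-unary (Instance.n I)) (encode-samples (Instance.samples I)))
  (sym (List.map-++ symbol (unaryΓ (Instance.n I)) (samplesΓ (Instance.samples I))))

encode-subset : ∀ {n} (X : Cells n) → Clear X → symbols (toList X) ≡ encSubset (color X)
encode-subset []            c = refl
encode-subset ((b , m) ∷ X) c with c zero
... | refl = cong₂ _∷_ (sym (encode-bit b)) (encode-subset X (c ∘ suc))

answer-correct : ∀ I o → Answer (Instance.samples I) o → CorrectOutput K I (symbols o)
answer-correct I o (inj₁ (X , refl , clr , pos , neg)) =
  inj₁ (color X , encode-subset X clr , sat⇒consistent (Instance.samples I) (color X) pos neg)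
answer-correct I o (inj₂ (refl , none)) =
  inj₂ (refl , λ Y c → let pos , neg = consistent⇒sat (Instance.samples I) Y c in none Y pos neg)

-- Bounds of the form f(t) · Nᶜ

data Expr : Set where
  con     : ℕ → Expr
  par     : (ℕ → ℕ) → Expr
  var     : Expr
  _⊕_ _⊗_ : Expr → Expr → Expr

infixl 6 _⊕_
infixl 7 _⊗_

eval : Expr → ℕ → ℕ → ℕ
eval (con c) t N = c
eval (par g) t N = g t
eval var     t N = N
eval (a ⊕ b) t N = eval a t N + eval b t N
eval (a ⊗ b) t N = eval a t N * eval b t N

factor : Expr → ℕ → ℕ
factor (con c) t = c
factor (par g) t = g t
factor var     t = 1
factor (a ⊕ b) t = factor a t + factor b t
factor (a ⊗ b) t = factor a t * factor b t

degree : Expr → ℕ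
degree (con c) = 0
degree (par g) = 0
degree var     = 1
degree (a ⊕ b) = degree a + degree b
degree (a ⊗ b) = degree a + degree b

-- Powers of a nonzero `N` are monotone in the exponent, so both summands of `⊕` can be raised to a
-- common degree. Adding the degrees there is coarser than a maximum but treats both operations
-- alike.
eval-bound : ∀ e t N .{{_ : NonZero N}} → eval e t N ≤ factor e t * N ^ degree e
eval-bound (con c) t N = ≤-reflexive (sym (*-identityʳ c))
eval-bound (par g) t N = ≤-reflexive (sym (*-identityʳ (g t)))
eval-bound var     t N = ≤-reflexive (sym (trans (+-identityʳ _) (*-identityʳ N)))
eval-bound (a ⊕ b) t N = begin
  eval a t N + eval b t N                                         ≤⟨ +-mono-≤ (eval-bound a t N) (eval-bound b t N) ⟩
  factor a t * N ^ degree a + factor b t * N ^ degree b               ≤⟨ +-mono-≤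
    (*-monoʳ-≤ (factor a t) (^-monoʳ-≤ N (m≤m+n (degree a) (degree b))))
    (*-monoʳ-≤ (factor b t) (^-monoʳ-≤ N (m≤n+m (degree b) (degree a)))) ⟩
  factor a t * N ^ (degree a + degree b) + factor b t * N ^ (degree a + degree b) ≡⟨ *-distribʳ-+ (N ^ (degree a + degree b)) (factor a t) (factor b t) ⟨
  (factor a t + factor b t) * N ^ (degree a + degree b)                   ∎
  where open ≤-Reasoning
eval-bound (a ⊗ b) t N = begin
  eval a t N * eval b t N                                         ≤⟨ *-mono-≤ (eval-bound a t N) (eval-bound b t N) ⟩
  (factor a t * N ^ degree a) * (factor b t * N ^ degree b)           ≡⟨ regroup (factor a t) (N ^ degree a) (factor b t) (N ^ degree b) ⟩
  (factor a t * factor b t) * (N ^ degree a * N ^ degree b)           ≡⟨ cong (factor a t * factor b t *_) (^-distribˡ-+-* N (degree a) (degree b)) ⟨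
  (factor a t * factor b t) * N ^ (degree a + degree b)                   ∎
  where
  open ≤-Reasoning
  regroup : ∀ a x b y → (a * x) * (b * y) ≡ (a * b) * (x * y)
  regroup = solve-∀

-- Mirrors `machineCost N (mainCost t N)` so closely that its evaluation is that cost by definition;
-- the successors of the cost functions appear as constants.
costExpr : Expr
costExpr = con 2 ⊕ (main ⊗ (con 1 ⊕ (walkE ⊕ walkE)) ⊕ ((var ⊕ main) ⊗ con 2 ⊕ con 1 ⊕ con 1))
  where
  B init symbolE attemptE roundE unitE main walkE : Expr
  B = par triangle
  init = (var ⊗ con 5 ⊕ con 1) ⊕ ((var ⊗ (par id ⊗ con 12 ⊕ con 8) ⊕ con 1) ⊕ ((par id ⊗ con 2 ⊕ con 1) ⊕ ((var ⊗ con 5 ⊕ con 1) ⊕ ((var ⊗ con 3 ⊕ con 1) ⊕ con 1))))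
  symbolE = (var ⊕ var) ⊗ con 12 ⊕ con 30
  attemptE = con 2 ⊕ ((var ⊗ symbolE ⊕ con 1) ⊕ ((var ⊗ con 5 ⊕ con 1) ⊕ ((var ⊗ symbolE ⊕ con 1) ⊕ ((var ⊗ con 5 ⊕ con 1) ⊕ ((B ⊗ con 5 ⊕ con 1) ⊕ (var ⊕ var ⊕ con 1))))))
  roundE = con 2 ⊕ ((B ⊗ con 3 ⊕ con 1) ⊕ (con 3 ⊕ ((B ⊗ con 5 ⊕ con 1) ⊕ attemptE)))
  unitE = var ⊗ con 12 ⊕ con 12
  main = init ⊕ (attemptE ⊗ unitE ⊕ (((par (λ t → 2 ^ triangle t) ⊗ roundE) ⊗ unitE) ⊕ ((con 1 ⊕ var) ⊗ con 5 ⊕ con 1)))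
  walkE = (var ⊕ main) ⊗ con 2 ⊕ con 1 ⊕ con 1

abstract
  timeFactor : ℕ → ℕ
  timeFactor = factor costExpr

  timeDegree : ℕ
  timeDegree = degree costExpr

  time-bound : ∀ t N .{{_ : NonZero N}} → machineCost N (mainCost t N) ≤ timeFactor t * N ^ timeDegree
  time-bound = eval-bound costExpr

instance-nonZero : ∀ I → NonZero (length (instanceΓ I))
instance-nonZero I = go (Instance.n I)
  where
  go : ∀ k → NonZero (length (unaryΓ k ++ samplesΓ (Instance.samples I)))
  go zero    = _
  go (suc k) = _

program⇒FPT : ∀ p out (cost : ℕ → ℕ → ℕ) F c → (∀ t N .{{_ : NonZero N}} → machineCost N (cost t N) ≤ F t * N ^ c) →
  (∀ I → Σ (List Γ) λ o → Answer (Instance.samples I) o × ∃ λ σ → lookup σ out ≡ o ʳ++ [] ×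
         Run p (start (instanceΓ I)) σ (cost (t⁻ I) (length (instanceΓ I)))) → FPT-ConsCheck2Col-t⁻
program⇒FPT p out cost F c bounded runs = F , c , stackMachine p out , solves
  where
  solves : ∀ (I : Instance) → WellFormed I → Σ ℕ λ s → Σ (List (Sym K)) λ o →
    (s ≤ F (t⁻ I) * length (encInstance K I) ^ c) ×
    HaltsWithin (stackMachine p out) (encInstance K I) s o × CorrectOutput K I o
  solves I _ =
    let o , ans , σ , eq , r = runs I
        s , s≤ , halts = stackMachine-halts {p} {out} {instanceΓ I} {o = o} r eq
    in s , symbols o ,
       ≤-trans s≤ (≤-trans (bounded (t⁻ I) (length (instanceΓ I)) {{instance-nonZero I}})
         (≤-reflexive (cong (λ z → F (t⁻ I) * z ^ c) (sym (trans (cong length (encode-instance I)) (List.length-map symbol (instanceΓ I))))))) ,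
       subst (λ z → HaltsWithin (stackMachine p out) z s (symbols o)) (sym (encode-instance I)) halts ,
       answer-correct I o ans

theorem5 : FPT-ConsCheck2Col-t⁻
theorem5 = program⇒FPT mainProg XL mainCost timeFactor timeDegree time-bound main-run
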